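{- Let $\mathcal{A}$ be a finite alphabet and let $X$ be a minimal shift space over $\mathcal{A}$. The following assertions are equivalent: (i) $X$ is dendric; (ii) the sets of return words $\mathcal{R}_X(w)$, $w\in\mathcal{L}(X)$, are tame bases of the free group $F_{\mathcal{A}}$; (iii) the sets of return words $\mathcal{R}_X(w)$, $w\in\mathcal{L}(X)$, are bases of the free group $F_{\mathcal{A}}$.
   Context: Let $\mathcal{A}$ be a finite set (alphabet), $\mathcal{A}^*$ the free monoid on $\mathcal{A}$ (its elements are words), $\varepsilon$ the empty word, $\mathcal{A}^+=\mathcal{A}^*\setminus\{\varepsilon\}$, and $F_{\mathcal{A}}$ the free group generated by $\mathcal{A}$; $\mathcal{A}^*$ is viewed as a subset of $F_{\mathcal{A}}$. The set $\mathcal{A}^{\mathbb{Z}}$ of two-sided infinite words carries the product topology of the discrete topology on $\mathcal{A}$. A shift space (over $\mathcal{A}$) is a closed subset $X\subseteq\mathcal{A}^{\mathbb{Z}}$ invariant under the shift map $(x_n)_{n\in\mathbb{Z}}\mapsto(x_{n+1})_{n\in\mathbb{Z}}$. Its language $\mathcal{L}(X)$ is the set of all finite words, including $\varepsilon$, occurring as factors $x_i\cdots x_j$ of elements $x\in X$. A shift space is minimal (with respect to inclusion of shift spaces) precisely when $\mathcal{L}(X)$ is uniformly recurrent: for every $u\in\mathcal{L}(X)$ there is $n$ such that $u$ is a factor of every word of length $n$ in $\mathcal{L}(X)$. For $w\in\mathcal{L}(X)$, the set of (left) return words to $w$ is $$\mathcal{R}_X(w)=\{r\in\mathcal{A}^+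 \mid rw\in\mathcal{L}(X)\cap w\mathcal{A}^*\setminus \mathcal{A}^+w\mathcal{A}^+\},$$ i.e. the nonempty words $r$ such that $rw\in\mathcal{L}(X)$, $rw$ begins with $w$, and $w$ has no occurrence in $rw$ other than as a prefix and as a suffix. For $w\in\mathcal{L}(X)$ let $E^-_X(w)=\{a\in\mathcal{A}\mid aw\in\mathcal{L}(X)\}$, $E^+_X(w)=\{b\in\mathcal{A}\mid wb\in\mathcal{L}(X)\}$, $E_X(w)=\{(a,b)\in\mathcal{A}\times\mathcal{A}\mid awb\in\mathcal{L}(X)\}$. The extension graph $\mathcal{E}_X(w)$ is the bipartite graph whose vertex set is the disjoint union of $E^-_X(w)$ and $E^+_X(w)$, with an edge between $a\in E^-_X(w)$ and $b\in E^+_X(w)$ if $(a,b)\in E_X(w)$. A word $w\in\mathcal{L}(X)$ is dendric if $\mathcal{E}_X(w)$ is a tree, and $X$ is dendric if every $w\in\mathcal{L}(X)$ is dendric. A basis of $F_{\mathcal{A}}$ is tame if it is obtained by applying to $\mathcal{A}$ a composition of permutations of $\mathcal{A}$ (extended to morphisms) and morphisms of the form $\alpha_{a,b}$ and $\tilde\alpha_{a,b}$ for $a\neq b$ in $\mathcal{A}$, where $\alpha_{a,b}(a)=ab$, $\tilde\alpha_{a,b}(a)=ba$, and $\alpha_{a,b}(c)=\tilde\alpha_{a,b}(c)=c$ for every letter $c\neq a$.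
   Formalization: It is additionally assumed that every letter of the alphabet occurs in X; otherwise the claim fails, e.g. for alphabet {a,b} and X consisting only of the constant word of a's, which is minimal and dendric although the return words to the empty word are just {a}. -}

module Defs where

open import Algebra.Bundles using (Group)
import Algebra.Morphism.Structures as Morphism
open import Data.Empty using (⊥)
open import Data.Integer.Base as ℤ using (ℤ; +_)
open import Data.List.Base
  using (List; []; _∷_; _++_; _∷ʳ_; [_]; length; map; reverse; applyUpTo)
open import Data.List.Properties
  using (++-assoc; ++-identityʳ; map-++; unfold-reverse; reverse-++)
open import Data.List.Relation.Unary.All using (All)
open import Data.List.Relation.Unary.Linked using (Linked)
open import Data.List.Relation.Unary.Unique.Propositional using (Unique)
open import Data.Nat.Base using (_≤_)
open import Data.Product.Base using (∃; ∃-syntax; _×_; _,_; proj₁)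
open import Data.Sign.Base using (Sign; opposite)
import Data.Sign.Base as Sign
open import Data.Sum.Base using (_⊎_; inj₁; inj₂)
open import Function.Base using (_∘_; id)
open import Function.Bundles using (_⇔_; _↔_; Inverse)
open import Level using (0ℓ)
open import Relation.Binary.Bundles using (Setoid)
open import Relation.Binary.Core using (Rel)
open import Relation.Binary.Definitions using (Symmetric; Irreflexive)
import Relation.Binary.Construct.Closure.Equivalence as Eq
open import Relation.Binary.Construct.Closure.ReflexiveTransitive
  using (Star; ε; _◅_)
open import Relation.Binary.Construct.Closure.Symmetric using (fwd)
import Relation.Binary.Construct.On as On
open import Relation.Binary.PropositionalEquality as ≡
  using (_≡_; _≢_; refl; sym; trans; cong; subst; subst₂)
open import Relation.Nullary.Negation.Core using (¬_)
open import Relation.Unary using (Pred; _∈_; _⊆_)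

------------------------------------------------------------------------
-- Graphs

-- Vertices form a subset of an ambient type, so that the equality of
-- vertices does not depend on membership proofs.
record Graph (V : Set) : Set₁ where
  field
    Vertex  : Pred V 0ℓ
    Adj     : Rel V 0ℓ
    adj-sym : Symmetric Adj
    irrefl  : Irreflexive _≡_ Adj
    adj⇒vtx : ∀ {u v} → Adj u v → u ∈ Vertex × v ∈ Vertex

module _ {V : Set} (G : Graph V) where
  open Graph G

  Connected : Set
  Connected = ∃ Vertex × (∀ {u v} → u ∈ Vertex → v ∈ Vertex → Star Adj u v)

  -- A cycle x, v₁, …, vₖ, x with k ≥ 2 and x, v₁, …, vₖ distinct.
  Cycle : Set
  Cycle = ∃[ x ] ∃[ vs ]
    2 ≤ length vs × Unique (x ∷ vs) × Linked Adj (x ∷ vs ∷ʳ x)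

  IsTree : Set
  IsTree = Connected × ¬ Cycle

------------------------------------------------------------------------
-- Free groups

-- The free group on a setoid of generators: words in signed generators,
-- modulo replacement of a generator by an equal one and insertion or
-- deletion of a pair x x⁻¹ or x⁻¹ x.
module Free (S : Setoid 0ℓ 0ℓ) where
  open Setoid S using () renaming (Carrier to X; _≈_ to _≈ₓ_)

  SignedWord : Set
  SignedWord = List (Sign × X)

  data Step : Rel SignedWord 0ℓ where
    letter : ∀ u {s x y} v → x ≈ₓ y →
             Step (u ++ (s , x) ∷ v) (u ++ (s , y) ∷ v)
    cancel : ∀ u s x v →
             Step (u ++ (s , x) ∷ (opposite s , x) ∷ v) (u ++ v)

  infix 4 _≈_
  _≈_ : Rel SignedWord 0ℓ
  _≈_ = Eq.EqClosure Step

  flip : Sign × X → Sign × X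
  flip (s , x) = opposite s , x

  inv : SignedWord → SignedWord
  inv w = reverse (map flip w)

  private
    ≈-refl = Eq.reflexive Step
    ≈-trans = Eq.transitive Step
    ≈-sym = Eq.symmetric Step

    ≡⇒≈ : ∀ {u v} → u ≡ v → u ≈ v
    ≡⇒≈ refl = ≈-refl

    stepʳ : ∀ t {u v} → Step u v → Step (u ++ t) (v ++ t)
    stepʳ t (letter u v e) =
      subst₂ Step (sym (++-assoc u _ t)) (sym (++-assoc u _ t))
        (letter u (v ++ t) e)
    stepʳ t (cancel u s x v) =
      subst₂ Step (sym (++-assoc u _ t)) (sym (++-assoc u v t))
        (cancel u s x (v ++ t))

    stepˡ : ∀ t {u v} → Step u v → Step (t ++ u) (t ++ v)
    stepˡ t (letter u v e) =
      subst₂ Step (++-assoc t u _) (++-assoc t u _) (letter (t ++ u) v e)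
    stepˡ t (cancel u s x v) =
      subst₂ Step (++-assoc t u _) (++-assoc t u v) (cancel (t ++ u) s x v)

    ++-cong : ∀ {u u′ v v′} → u ≈ u′ → v ≈ v′ → u ++ v ≈ u′ ++ v′
    ++-cong {u′ = u′} {v = v} p q =
      ≈-trans (Eq.gmap (_++ v) (stepʳ v) p) (Eq.gmap (u′ ++_) (stepˡ u′) q)

    opposite² : ∀ s → opposite (opposite s) ≡ s
    opposite² Sign.- = refl
    opposite² Sign.+ = refl

    inv-++ : ∀ u v → inv (u ++ v) ≡ inv v ++ inv u
    inv-++ u v =
      trans (cong reverse (map-++ flip u v))
            (reverse-++ (map flip u) (map flip v))

    inv-∷ : ∀ a w → inv (a ∷ w) ≡ inv w ∷ʳ flip a
    inv-∷ a w = unfold-reverse (flip a) (map flip w)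

    inv-mid : ∀ u a v → inv (u ++ a ∷ v) ≡ inv v ++ flip a ∷ inv u
    inv-mid u a v = trans (inv-++ u (a ∷ v))
      (trans (cong (_++ inv u) (inv-∷ a v)) (++-assoc (inv v) _ (inv u)))

    inv-mid₂ : ∀ u a b v →
               inv (u ++ a ∷ b ∷ v) ≡ inv v ++ flip b ∷ flip a ∷ inv u
    inv-mid₂ u a b v = trans (inv-++ u (a ∷ b ∷ v))
      (trans (cong (_++ inv u) (inv-mid (a ∷ []) b v))
             (++-assoc (inv v) _ (inv u)))

    inv-step : ∀ {u v} → Step u v → Step (inv u) (inv v)
    inv-step (letter u v e) =
      subst₂ Step (sym (inv-mid u _ v)) (sym (inv-mid u _ v))
        (letter (inv v) (inv u) e)
    inv-step (cancel u s x v) =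
      subst₂ Step (sym (inv-mid₂ u _ _ v)) (sym (inv-++ u v))
        (subst (λ t → Step (inv v ++ (opposite (opposite s) , x)
                                       ∷ (t , x) ∷ inv u) (inv v ++ inv u))
          (cong opposite (opposite² s))
          (cancel (inv v) (opposite (opposite s)) x (inv u)))

    cancelStep : ∀ u s x v → u ++ (s , x) ∷ (opposite s , x) ∷ v ≈ u ++ v
    cancelStep u s x v = fwd (cancel u s x v) ◅ ε

    inverseʳ : ∀ w → w ++ inv w ≈ []
    inverseʳ [] = ≈-refl
    inverseʳ ((s , x) ∷ w) =
      ≈-trans (≡⇒≈ (cong ((s , x) ∷_)
                (trans (cong (w ++_) (inv-∷ (s , x) w))
                       (sym (++-assoc w (inv w) _)))))
        (≈-trans (++-cong {u = (s , x) ∷ []} ≈-refl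
                   (++-cong (inverseʳ w) ≈-refl))
          (cancelStep [] s x []))

    inverseˡ : ∀ w → inv w ++ w ≈ []
    inverseˡ [] = ≈-refl
    inverseˡ ((s , x) ∷ w) =
      ≈-trans (≡⇒≈ (trans (cong (_++ (s , x) ∷ w) (inv-∷ (s , x) w))
                     (trans (++-assoc (inv w) _ _)
                       (cong (λ t → inv w ++ (opposite s , x) ∷ (t , x) ∷ w)
                             (sym (opposite² s))))))
        (≈-trans (cancelStep (inv w) (opposite s) x w) (inverseˡ w))

  group : Group 0ℓ 0ℓ
  group = record
    { Carrier = SignedWord
    ; _≈_ = _≈_
    ; _∙_ = _++_
    ; ε = []
    ; _⁻¹ = inv
    ; isGroup = record
      { isMonoid = record
        { isSemigroup = record
          { isMagma = record
            { isEquivalence = Eq.isEquivalence Step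
            ; ∙-cong = ++-cong
            }
          ; assoc = λ u v w → ≡⇒≈ (++-assoc u v w)
          }
        ; identity = (λ _ → ≈-refl) , (λ w → ≡⇒≈ (++-identityʳ w))
        }
      ; inverse = inverseˡ , inverseʳ
      ; ⁻¹-cong = Eq.gmap inv inv-step
      }
    }

  -- The extension to signed words of a map from generators to a group.
  module _ (G : Group 0ℓ 0ℓ) where
    private module G = Group G

    extend : (X → G.Carrier) → SignedWord → G.Carrier
    extend f []                 = G.ε
    extend f ((Sign.+ , x) ∷ w) = f x G.∙ extend f w
    extend f ((Sign.- , x) ∷ w) = f x G.⁻¹ G.∙ extend f w

-- B is a basis of G if the canonical morphism from the free group on B
-- to G is an isomorphism.  Elements of B are compared by the equality of G.
module _ (G : Group 0ℓ 0ℓ) (B : Pred (Group.Carrier G) 0ℓ) where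
  private module G = Group G

  subsetSetoid : Setoid 0ℓ 0ℓ
  subsetSetoid = On.setoid {B = ∃ B} G.setoid proj₁

  IsBasis : Set
  IsBasis = IsGroupIsomorphism (Free.extend subsetSetoid G proj₁)
    where
    open Morphism.GroupMorphisms
           (Group.rawGroup (Free.group subsetSetoid)) G.rawGroup
         using (IsGroupIsomorphism)

module FreeGroup (A : Set) where
  open Free (≡.setoid A) public using (group; extend)
  open Group group public using (Carrier; _≈_; _∙_)

  gen : A → Carrier
  gen a = [ (Sign.+ , a) ]

  embed : List A → Carrier
  embed = map (Sign.+ ,_)

  -- The morphisms sending a to ab (resp. ba) and fixing every other letter
  -- are specified by their values, which avoids a decision procedure for
  -- equality of letters.
  data Elementary : (Carrier → Carrier) → Set where
    perm : (π : A ↔ A) → Elementary (extend group (gen ∘ Inverse.to π))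
    α    : ∀ {a b} → a ≢ b → (f : A → Carrier) →
           f a ≈ gen a ∙ gen b → (∀ c → c ≢ a → f c ≈ gen c) →
           Elementary (extend group f)
    α̃    : ∀ {a b} → a ≢ b → (f : A → Carrier) →
           f a ≈ gen b ∙ gen a → (∀ c → c ≢ a → f c ≈ gen c) →
           Elementary (extend group f)

  data TameMorphism : (Carrier → Carrier) → Set where
    identity : TameMorphism id
    compose  : ∀ {φ ψ} → Elementary φ → TameMorphism ψ → TameMorphism (φ ∘ ψ)

  IsTameBasis : Pred Carrier 0ℓ → Set
  IsTameBasis B = IsBasis group B ×
    ∃[ φ ] TameMorphism φ × (∀ g → g ∈ B ⇔ (∃[ a ] g ≈ φ (gen a)))

  -- The image in the free group of a set of words, closed under _≈_.
  wordSet : Pred (List A) 0ℓ → Pred Carrier 0ℓ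
  wordSet R g = ∃[ r ] r ∈ R × g ≈ embed r

------------------------------------------------------------------------
-- Shift spaces

module _ {A : Set} where

  shift : (ℤ → A) → (ℤ → A)
  shift x i = x (ℤ.suc i)

  -- x belongs to the closure of X for the product topology: every basic
  -- neighbourhood of x, given by finitely many coordinates, meets X.
  Adherent : Pred (ℤ → A) 0ℓ → Pred (ℤ → A) 0ℓ
  Adherent X x = ∀ (I : List ℤ) → ∃[ y ] y ∈ X × All (λ i → y i ≡ x i) I

record ShiftSpace (A : Set) : Set₁ where
  field
    Points    : Pred (ℤ → A) 0ℓ
    closed    : Adherent Points ⊆ Points
    invariant : ∀ x → x ∈ Points ⇔ shift x ∈ Points

open ShiftSpace public using (Points)

module _ {A : Set} where

  -- Minimality among nonempty shift spaces.  The empty shift space also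
  -- qualifies, in agreement with the vacuous uniform recurrence of its
  -- language.
  IsMinimal : ShiftSpace A → Set₁
  IsMinimal X = (Y : ShiftSpace A) → ∃ (Points Y) →
                Points Y ⊆ Points X → Points X ⊆ Points Y

  module _ (X : ShiftSpace A) where

    Language : Pred (List A) 0ℓ
    Language w = ∃[ x ] x ∈ Points X ×
      (∃[ i ] ∃[ n ] w ≡ applyUpTo (λ k → x (i ℤ.+ + k)) n)

    ReturnWord : List A → Pred (List A) 0ℓ
    ReturnWord w r =
      r ≢ [] ×
      Language (r ++ w) ×
      (∃[ s ] r ++ w ≡ w ++ s) ×
      ¬ (∃[ u ] ∃[ v ] u ≢ [] × v ≢ [] × r ++ w ≡ u ++ w ++ v)

    E⁻ : List A → Pred A 0ℓ
    E⁻ w a = Language (a ∷ w)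

    E⁺ : List A → Pred A 0ℓ
    E⁺ w b = Language (w ∷ʳ b)

    E : List A → Rel A 0ℓ
    E w a b = Language (a ∷ w ∷ʳ b)

    Edge : List A → Rel A 0ℓ
    Edge w a b = a ∈ E⁻ w × b ∈ E⁺ w × E w a b

    -- inj₁ is the left copy of the alphabet, inj₂ the right copy.
    extensionGraph : List A → Graph (A ⊎ A)
    extensionGraph w = record
      { Vertex  = λ { (inj₁ a) → a ∈ E⁻ w ; (inj₂ b) → b ∈ E⁺ w }
      ; Adj     = Adj
      ; adj-sym = λ {u} {v} → adj-sym u v
      ; irrefl  = λ { {inj₁ _} refl () ; {inj₂ _} refl () }
      ; adj⇒vtx = λ {u} {v} → adj⇒vtx u v
      }
      where
      Adj : Rel (A ⊎ A) 0ℓ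
      Adj (inj₁ a) (inj₂ b) = Edge w a b
      Adj (inj₂ b) (inj₁ a) = Edge w a b
      Adj (inj₁ _) (inj₁ _) = ⊥
      Adj (inj₂ _) (inj₂ _) = ⊥

      adj-sym : ∀ u v → Adj u v → Adj v u
      adj-sym (inj₁ _) (inj₂ _) e = e
      adj-sym (inj₂ _) (inj₁ _) e = e

      adj⇒vtx : ∀ u v → Adj u v → _ × _
      adj⇒vtx (inj₁ _) (inj₂ _) (a∈ , b∈ , _) = a∈ , b∈
      adj⇒vtx (inj₂ _) (inj₁ _) (a∈ , b∈ , _) = b∈ , a∈

    Dendric : List A → Set
    Dendric w = IsTree (extensionGraph w)

    IsDendric : Set
    IsDendric = ∀ w → w ∈ Language → Dendric w

    ReturnSetsAreBases : Set
    ReturnSetsAreBases = ∀ w → w ∈ Language →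
      IsBasis (FreeGroup.group A) (FreeGroup.wordSet A (ReturnWord w))

    ReturnSetsAreTameBases : Set
    ReturnSetsAreTameBases = ∀ w → w ∈ Language →
      FreeGroup.IsTameBasis A (FreeGroup.wordSet A (ReturnWord w))

{-# OPTIONS --safe #-}

-- Bases ⇒ dendric.  If R(w) is a basis, every function R(w) → ℤ/2 is the
-- restriction of a morphism given by weights λ of the letters.  A 2-colouring
-- of E(w) compatible with its edges yields such a function: the colour of the
-- last letter of r minus that of the letter following w in r w.  By
-- telescoping λ vanishes on R(aw), a basis, so λ = 0 and by recurrence the
-- colouring is constant: E(w) is connected.  If w = avb, the constant function
-- 1 on R(w) gives other weights λ.  By connectedness, the weight of the part
-- of a long word before the first occurrence of w depends only on the first
-- |v|+1 letters; this gives a potential on the vertices of E(v) which jumps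
-- across the edge (a , b) only. Hence no cycle passes through this edge.
--
-- Dendric ⇒ tame bases.  Connectedness shows that the coset, modulo the
-- subgroup spanned by R(w), of the part of a long word before the first
-- occurrence of w is independent of the word, so that R(w) spans.  Acyclicity
-- allows one to truncate a cochain on the language letter by letter (H¹ of a
-- forest is zero) until only letter weights are left, so every function R(w) →
-- ℤ/2 comes from weights.  A spanning family σ in the language with this
-- property is tame, by induction on its total length: if σ j = σ i z or σ j =
-- z σ i, replace σ j by z.  Otherwise σ is a bifix code; by acyclicity,
-- Stallings folding of the loops σ i then never identifies the base point with
-- an inner vertex, so that every letter, being spanned by σ, is one of the σ
-- i.
module Submission where

open import Defs
open import Algebra.Bundles using (Group; module CommutativeRing)
import Algebra.Morphism.Construct.Composition as Composition
import Algebra.Morphism.Construct.Identity as Identity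
import Algebra.Morphism.Structures as Morphism
import Algebra.Properties.Group as GroupProperties
open import Axiom.ExcludedMiddle using (ExcludedMiddle)
open import Data.Bool.Base using (Bool; true; false; _xor_)
open import Data.Bool.Properties
  using (xor-∧-commutativeRing; xor-assoc; xor-comm; xor-same; xor-identityʳ)
open import Data.Bool.Solver using (module xor-∧-Solver)
open import Data.Empty using (⊥-elim)
open import Data.Fin.Base using (Fin; zero; suc)
import Data.Fin.Properties as Fin
import Data.Integer.Base as ℤ
import Data.Integer.Properties as ℤ
open import Data.Integer.Solver using (module +-*-Solver)
open import Data.List.Base hiding (updateAt; and; or; all; any; sum)
open import Data.List.Membership.Propositional using () renaming (_∈_ to _∈ˡ_)
open import Data.List.Membership.Propositional.Properties
  using (∈-cartesianProduct⁺; ∈-cartesianProductWith⁺; ∈-map⁺; ∈-allFin; ∈-filter⁺; ∈-filter⁻;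
         ∈-deduplicate⁺; ∈-deduplicate⁻; ∈-lookup)
open import Data.List.Properties
open import Data.List.Relation.Unary.All as All using (All; []; _∷_)
open import Data.List.Relation.Unary.AllPairs using ([]; _∷_)
open import Data.List.Relation.Unary.Any as Any using (here; there)
open import Data.List.Relation.Unary.Any.Properties using (lookup-index)
open import Data.List.Relation.Unary.Linked using (Linked; []; [-]; _∷_)
open import Data.List.Relation.Unary.Unique.DecPropositional.Properties using (deduplicate-!)
open import Data.List.Relation.Unary.Unique.Propositional using (Unique)
open import Data.Nat.Base using (ℕ; zero; suc; _+_; _∸_; _≤_; _<_; z≤n; s≤s)
open import Data.Nat.Properties
open import Data.Product.Base using (Σ-syntax; ∃; ∃-syntax; _×_; _,_; proj₁; proj₂)
open import Data.Sign.Base using (Sign; opposite)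
open import Data.Sum.Base using (_⊎_; inj₁; inj₂; swap)
open import Data.Vec.Functional using (updateAt)
open import Data.Vec.Functional.Properties using (updateAt-updates; updateAt-minimal)
open import Function.Base using (_∘_; id; const; case_of_)
open import Function.Bundles using (_⇔_; _↔_; Inverse; mk⇔; Equivalence)
open import Level using (0ℓ)
open import Relation.Binary.Bundles using (Setoid)
import Relation.Binary.Construct.Closure.Equivalence as Eq
open import Relation.Binary.Construct.Closure.ReflexiveTransitive as Closure using (Star; ε; _◅_; _◅◅_)
open import Relation.Binary.Construct.Closure.Symmetric using (fwd)
open import Relation.Binary.PropositionalEquality as ≡ hiding ([_]; setoid; isEquivalence)
import Relation.Binary.Reasoning.Setoid as SetoidReasoning
open import Relation.Binary.Structures using (IsEquivalence)
open import Relation.Nullary using (Dec; yes; no; does; ¬_)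
open import Relation.Unary using (Pred; _∈_)

open Morphism.IsGroupHomomorphism using (⟦⟧-cong; homo; ε-homo; ⁻¹-homo)

-- Folding a bifix code in an acyclic language

Prefix : {A : Set} → List A → List A → Set
Prefix s x = ∃[ x′ ] x ≡ s ++ x′

prefix-∷ʳ : {A : Set} (s : List A) {e : A} {x : List A} → Prefix (s ∷ʳ e) x → Prefix s x
prefix-∷ʳ s {e} (x′ , refl) = e ∷ x′ , ++-assoc s _ x′

-- B x y (resp. S x y) says that the word x̃ y, where x̃ is the reversal of x,
-- is in a bifix code (resp. in a language containing it): x and y are read
-- outwards from a position in the word, which makes the notion symmetric.
record Folding (A : Set) : Set₁ where
  field
    B S : List A → List A → Set
    B⇒S : ∀ {x y} → B x y → S x y
    S-prefix : ∀ {s x t y} → S (s ++ x) (t ++ y) → S s t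
    cut : ∀ s t e c → S (s ∷ʳ e) (t ∷ʳ c) →
      Σ[ χ⁻ ∈ (A → Bool) ] Σ[ χ⁺ ∈ (A → Bool) ] χ⁻ e ≢ χ⁺ c ×
        (∀ e′ c′ → S (s ∷ʳ e′) (t ∷ʳ c′) → ¬ (e′ ≡ e × c′ ≡ c) → χ⁻ e′ ≡ χ⁺ c′)
    bifixˡ : ∀ {x y z} → B x y → B (x ++ z) y → z ≡ []
    bifixʳ : ∀ {x y z} → B x y → B x (y ++ z) → z ≡ []
    shiftˡ : ∀ {x c y} → B (c ∷ x) y → B x (c ∷ y)
    shiftʳ : ∀ {x c y} → B x (c ∷ y) → B (c ∷ x) y
    bound : ℕ
    bounded : ∀ {x y} → B x y → length x + length y ≤ bound

mirror : {A : Set} → Folding A → Folding A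
mirror F = record
  { B = λ x y → B y x
  ; S = λ x y → S y x
  ; B⇒S = B⇒S
  ; S-prefix = S-prefix
  ; cut = λ s t e c p → let χ⁻ , χ⁺ , ne , eq = cut t s c e p in
      χ⁺ , χ⁻ , (λ q → ne (sym q)) ,
      λ e′ c′ p′ n → sym (eq c′ e′ p′ (λ (u , v) → n (v , u)))
  ; bifixˡ = bifixʳ
  ; bifixʳ = bifixˡ
  ; shiftˡ = shiftʳ
  ; shiftʳ = shiftˡ
  ; bound = bound
  ; bounded = λ {x} {y} b → subst (_≤ bound) (+-comm (length y) (length x)) (bounded b)
  }
  where open Folding F

module _ {A : Set} where

  -- Paths in the incidence graph of the code, between right parts y, through
  -- left parts extending s and right parts extending t.
  data Path (B : List A → List A → Set) (s t : List A) : ℕ → List A → List A → Set where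
    done : ∀ {y} → Path B s t 0 y y
    step : ∀ {n x y y′ y″} → Prefix t y → Prefix s x →
           B x y → B x y′ →
           Path B s t n y′ y″ → Path B s t (suc n) y y″

  path-++ : ∀ {B s t m n x y z} → Path B s t m x y → Path B s t n y z → Path B s t (m + n) x z
  path-++ done q = q
  path-++ (step a b c d p) q = step a b c d (path-++ p q)

  path-∷ʳ : ∀ {B t n y y′} s {e} → Path B (s ∷ʳ e) t n y y′ → Path B s t n y y′
  path-∷ʳ s done = done
  path-∷ʳ s (step a b c d p) = step a (prefix-∷ʳ s b) c d (path-∷ʳ s p)

  -- The incidence graph is bipartite: an edge at each end turns a path between left parts into a
  -- path between right parts.
  path-turn : ∀ {B s t n x x′ y y′} → Prefix s x′ → Prefix t y → B x y →
              Path (λ x y → B y x) t s n x x′ → B x′ y′ → Path B s t (suc n) y y′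
  path-turn px′ py b done b′ = step py px′ b b′ done
  path-turn px′ py b (step px pw c d p) b′ = step py px b c (path-turn px′ pw d p b′)

  prefix-strict : ∀ {s x : List A} → Prefix s x →
                  x ≡ s ⊎ ∃[ e ] Prefix (s ∷ʳ e) x
  prefix-strict {s} ([] , refl) = inj₁ (++-identityʳ s)
  prefix-strict {s} (e ∷ x , refl) = inj₂ (e , x , sym (++-assoc s _ x))

  prefix-length : ∀ {s x : List A} → Prefix s x → length s ≤ length x
  prefix-length {s} (x , refl) = subst (length s ≤_) (sym (length-++ s)) (m≤m+n _ _)

  prefix-∷ʳ-length : ∀ (s : List A) {e x} → Prefix (s ∷ʳ e) x → suc (length s) ≤ length x
  prefix-∷ʳ-length s p = subst (_≤ _) (trans (length-++ s) (+-comm _ 1)) (prefix-length p)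

  module FoldedGraph (em : ExcludedMiddle 0ℓ) where

    module Search (F : Folding A) (s t : List A) (c : A) where
      open Folding F

      B-strictˡ : ∀ {x y e} → B x y → Prefix (s ∷ʳ e) x → ¬ B s y
      B-strictˡ {e = e} b (x′ , refl) b′ with bifixˡ {z = e ∷ x′} b′ (subst (λ x → B x _) (++-assoc s _ x′) b)
      ... | ()

      B-strictʳ : ∀ {x y e} → B x y → Prefix (t ∷ʳ e) y → ¬ B x t
      B-strictʳ {e = e} b (y′ , refl) b′ with bifixʳ {z = e ∷ y′} b′ (subst (B _) (++-assoc t _ y′) b)
      ... | ()

      B-S : ∀ {x y e d} → B x y → Prefix (s ∷ʳ e) x → Prefix (t ∷ʳ d) y → S (s ∷ʳ e) (t ∷ʳ d)
      B-S b (x′ , refl) (y′ , refl) = S-prefix (B⇒S b)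

      -- A path leaving through x = s only turns around at s until it comes
      -- back to a word beginning with t c.
      return-at-s : ∀ {m z y″} → B s z → Path B s t m z y″ → Prefix (t ∷ʳ c) y″ →
        ∃[ z′ ] ∃[ m′ ] m′ ≤ m × B s z′ × Prefix (t ∷ʳ c) z′ × Path B s t m′ z′ y″
      return-at-s {m} {z} b p q with em {P = Prefix (t ∷ʳ c) z}
      ... | yes r = z , m , ≤-refl , b , r , p
      return-at-s b done q | no ¬r = ⊥-elim (¬r q)
      return-at-s b (step pz px b₁ b₂ p) q | no ¬r with prefix-strict px
      ... | inj₂ (_ , px′) = ⊥-elim (B-strictˡ b₁ px′ b)
      ... | inj₁ refl with return-at-s b₂ p q
      ... | z′ , m′ , le , rest = z′ , m′ , m≤n⇒m≤1+n le , rest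

      -- The colouring χ of E(s,t) separating the ends of the edge (e , c)
      -- is constant along an excursion outside t c.
      module _ (e : A) (χ⁻ χ⁺ : A → Bool)
        (eq : ∀ e′ c′ → S (s ∷ʳ e′) (t ∷ʳ c′) → ¬ (e′ ≡ e × c′ ≡ c) → χ⁻ e′ ≡ χ⁺ c′) where

        return : ∀ {m x y z e₁ d y″} → Prefix (s ∷ʳ e₁) x → χ⁻ e₁ ≡ χ⁻ e →
          B x y → Prefix (t ∷ʳ d) y → B x z →
          Path B s t m z y″ → Prefix (t ∷ʳ c) y″ →
          ∃[ x′ ] ∃[ z′ ] ∃[ e₂ ] ∃[ j ] ∃[ m′ ]
            j + m′ ≤ m × Path (λ x y → B y x) t s j x x′ × Prefix (s ∷ʳ e₂) x′ × χ⁻ e₂ ≡ χ⁻ e ×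
            B x′ z′ × Prefix (t ∷ʳ c) z′ × Path B s t m′ z′ y″
        return {m} {x} {z = z} px χe b₀ py b p q with em {P = Prefix (t ∷ʳ c) z}
        ... | yes r = x , z , _ , 0 , m , ≤-refl , done , px , χe , b , r , p
        return px χe b₀ py b done q | no ¬r = ⊥-elim (¬r q)
        return px χe b₀ py b (step pz px₂ b₁ b₂ p) q | no ¬r
          with prefix-strict pz | prefix-strict px₂
        ... | inj₁ refl | _ = ⊥-elim (B-strictʳ b₀ py b)
        ... | inj₂ _ | inj₁ refl = ⊥-elim (B-strictˡ b px b₁)
        ... | inj₂ (d , pz′) | inj₂ (e₂ , px₂′)
          with return px₂′ χe₂ b₁ pz′ b₂ p q
          where
          d≢c : d ≢ c
          d≢c refl = ¬r pz′
          -- Both `e₂` and the letter before it on the path are adjacent to d, by edges other than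
          -- (e , c) because d ≠ c; hence both have the colour of d.
          χe₂ : χ⁻ e₂ ≡ χ⁻ e
          χe₂ = trans (eq e₂ d (B-S b₁ px₂′ pz′) (d≢c ∘ proj₂))
            (trans (sym (eq _ d (B-S b px pz′) (d≢c ∘ proj₂))) χe)
        ... | x′ , z′ , e₃ , j , m′ , le , P , rest =
          x′ , z′ , e₃ , suc j , m′ , s≤s le ,
          step (prefix-∷ʳ s px) pz b b₁ P , rest

    -- Two right parts beginning with t c and connected by a path can be connected
    -- without leaving t c: on an excursion outside t c, the first and the last
    -- left part end with the same letter e before s, because E(s,t) is acyclic;
    -- by the mirror image of the statement, for a shorter path, they are
    -- connected within e s, and one concludes by induction on |s| + |t|.
    Narrowing : ℕ → ℕ → Set₁
    Narrowing fuel n = ∀ (F : Folding A) s t c {m y y′} → m ≤ n →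
      Folding.bound F ≤ fuel + (length s + length t) → Path (Folding.B F) s t m y y′ →
      Prefix (t ∷ʳ c) y → Prefix (t ∷ʳ c) y′ → ∃[ m′ ] Path (Folding.B F) s (t ∷ʳ c) m′ y y′

    module _ fuel n (rec : Narrowing fuel n)
             (rec′ : ∀ fuel′ → fuel ≡ suc fuel′ → ∀ n → Narrowing fuel′ n) where

      narrow-step : Narrowing fuel (suc n)
      narrow-step F s t c le M done py py′ = 0 , done
      narrow-step F s t c (s≤s le) M (step {y′ = y₁} pt px b b₁ p) py py′
        with em {P = Prefix (t ∷ʳ c) y₁}
      ... | yes py₁ = let m′ , q = rec F s t c le M p py₁ py′ in
        suc m′ , step py px b b₁ q
      ... | no ¬py₁ with prefix-strict px
      ... | inj₁ refl =
        let z , k , k≤ , bz , pz , q = return-at-s b₁ p py′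
            m′ , r = rec F s t c (≤-trans k≤ le) M q pz py′
        in suc m′ , step py px b bz r
        where open Search F s t c
      ... | inj₂ (e , px′)
        with Folding.cut F s t e c (Search.B-S F s t c b px′ py)
      ... | χ⁻ , χ⁺ , χ≢ , eq with Search.return F s t c e χ⁻ χ⁺ eq px′ refl b py b₁ p py′
      ... | x′ , z , e₂ , j , k , jk , P , px₂ , χe₂ , bz , pz , q with em {P = e₂ ≡ e}
      -- Otherwise (e₂ , c) is an edge other than (e , c), so c has the colour of `e₂`, which is
      -- that of e, although the cut separates e from c.
      ... | no e₂≢e = ⊥-elim (χ≢ (trans (sym χe₂)
              (eq e₂ c (Search.B-S F s t c bz px₂ pz) (e₂≢e ∘ proj₁))))
      ... | yes refl =
        -- `P` joins left parts beginning with s e, so the mirrored statement keeps it there. Turned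
        -- back into a path of right parts, it has uncontrolled length, which is why the longer pair
        -- (s e , t) is treated with less fuel and any length.
        let _ , P′ = rec (mirror F) t s e (≤-trans (m≤m+n j k) (≤-trans jk le))
                       (subst (λ l → Folding.bound F ≤ fuel + l) (+-comm (length s) _) M)
                       P px′ px₂
            Q = path-turn px₂ (prefix-∷ʳ t py) b P′ bz
            fuel′ , eq = positive fuel M
            _ , Q′ = rec′ fuel′ eq _ F (s ∷ʳ e) t c ≤-refl
                       (subst (Folding.bound F ≤_) (len eq) M) Q py pz
            m′ , r = rec F s t c (≤-trans (m≤n+m k j) (≤-trans jk le)) M q pz py′
        in _ , path-++ (path-∷ʳ s Q′) r
        where
        len : ∀ {fuel fuel′} → fuel ≡ suc fuel′ →
              fuel + (length s + length t) ≡ fuel′ + (length (s ∷ʳ e) + length t)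
        len {fuel′ = f} refl rewrite length-++ s {e ∷ []} | +-comm (length s) 1 = sym (+-suc f _)
        -- Fuel bounds how far s and t may still grow. It is not exhausted: x and y properly extend
        -- s and t, and their total length is at most `bound`.
        positive : ∀ fuel → Folding.bound F ≤ fuel + (length s + length t) → ∃[ f ] fuel ≡ suc f
        positive (suc f) _ = f , refl
        positive zero M = ⊥-elim (<-irrefl refl (begin-strict
          Folding.bound F          ≤⟨ M ⟩
          length s + length t
            <⟨ +-mono-<-≤ (prefix-∷ʳ-length s px′) (≤-trans (n≤1+n _) (prefix-∷ʳ-length t py)) ⟩
          _                        ≤⟨ Folding.bounded F b ⟩
          Folding.bound F          ∎))
          where open ≤-Reasoning

    narrow : ∀ fuel n → Narrowing fuel n
    narrow fuel zero F s t c z≤n M done py py′ = 0 , done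
    narrow zero (suc n) = narrow-step zero n (narrow zero n) λ _ ()
    narrow (suc fuel) (suc n) =
      narrow-step (suc fuel) n (narrow (suc fuel) n) λ { _ refl n → narrow fuel n }

    -- Vertices of the folded graph: positions (x , y) inside the words of
    -- the code, all the ends of words being identified.
    End : List A → List A → Set
    End x y = x ≡ [] ⊎ y ≡ []

    -- `path` records right parts only: `B x y` joins x to y, so the component of y also contains x.
    data Same (B : List A → List A → Set) : (x y x′ y′ : List A) → Set where
      ends : ∀ {x y x′ y′} → End x y → End x′ y′ → Same B x y x′ y′
      path : ∀ {x y x′ y′ n} → Path B [] [] n y y′ → Same B x y x′ y′

    module _ {F : Folding A} where
      open Folding F

      -- By bifixity a complete code word has no neighbour but itself on its empty side: an empty
      -- left or right part remains empty along the path.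
      path-end : ∀ {n x y x′ y′} → B x y → End x y → Path B [] [] n y y′ → B x′ y′ → End x′ y′
      path-end b (inj₁ refl) done b′ = inj₁ (bifixˡ b b′)
      path-end b (inj₂ refl) done b′ = inj₂ refl
      path-end b (inj₁ refl) (step _ _ b₁ b₂ p) b′ with refl ← bifixˡ b b₁ =
        path-end b₂ (inj₁ refl) p b′
      path-end b (inj₂ refl) (step _ _ b₁ b₂ p) b′ with refl ← bifixʳ b₁ b₂ =
        path-end b₂ (inj₂ refl) p b′

      path-sym : ∀ {n y y′} → Path B [] [] n y y′ → Path B [] [] n y′ y
      path-sym {n} {y} {y′} p = subst (λ n → Path B [] [] n y′ y) (+-identityʳ n) (reverse-onto p done)
        where
        reverse-onto : ∀ {m n y y′ z} → Path B [] [] n y y′ → Path B [] [] m y z →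
                       Path B [] [] (n + m) y′ z
        reverse-onto done q = q
        reverse-onto {m} {suc n} {y′ = y′} {z} (step _ a b₁ b₂ p) q =
          subst (λ n → Path B [] [] n y′ z) (+-suc n m)
          (reverse-onto p (step (_ , refl) a b₂ b₁ q))

      same-sym : ∀ {x y x′ y′} → Same B x y x′ y′ → Same B x′ y′ x y
      same-sym (ends a b) = ends b a
      same-sym (path p) = path (path-sym p)

      same-trans : ∀ {x y x′ y′ x″ y″} → B x y → B x′ y′ → B x″ y″ →
                   Same B x y x′ y′ → Same B x′ y′ x″ y″ → Same B x y x″ y″
      same-trans _ _ _ (ends a b) (ends c d) = ends a d
      same-trans _ b₂ b₃ (ends a b) (path p) = ends a (path-end b₂ b p b₃)
      same-trans b₁ b₂ _ (path p) (ends c d) = ends (path-end b₂ c (path-sym p) b₁) d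
      same-trans _ _ _ (path p) (path q) = path (path-++ p q)

      same-mirror : ∀ {x y x′ y′} → B x y → B x′ y′ → Same B x y x′ y′ → Same (λ x y → B y x) y x y′ x′
      same-mirror b b′ (ends p q) = ends (swap p) (swap q)
      same-mirror b b′ (path p) = path (path-turn (_ , refl) (_ , refl) b p b′)

      -- As long as all right parts begin with c, this letter can be moved to the left parts of all
      -- edges at once.
      path-shift : ∀ {c n y y′} → Path B [] (c ∷ []) n (c ∷ y) (c ∷ y′) → ∃[ m ] Path B [] [] m y y′
      path-shift done = 0 , done
      path-shift (step _ _ b₁ b₂ done) = 1 , step (_ , refl) (_ , refl) (shiftʳ b₁) (shiftʳ b₂) done
      path-shift (step _ _ b₁ b₂ p@(step (_ , refl) _ _ _ _)) =
        let m , q = path-shift p in suc m , step (_ , refl) (_ , refl) (shiftʳ b₁) (shiftʳ b₂) q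

      -- A path from c y to c y′ may visit right parts that do not begin with c; `narrow` brings it
      -- back among those that do, and `path-shift` then applies. At beginnings of words, both
      -- positions acquire the same left part c.
      deterministic : ∀ {c x y x′ y′} → B x (c ∷ y) → B x′ (c ∷ y′) →
                      Same B x (c ∷ y) x′ (c ∷ y′) → Same B (c ∷ x) y (c ∷ x′) y′
      deterministic b b′ (ends (inj₁ refl) (inj₁ refl)) =
        path (step (_ , refl) (_ , refl) (shiftʳ b) (shiftʳ b′) done)
      deterministic {c} b b′ (path {n = n} p) =
        path (proj₂ (path-shift (proj₂ (narrow bound n F [] [] c ≤-refl
          (m≤m+n bound 0) p (_ , refl) (_ , refl)))))

    module _ {F : Folding A} where
      open Folding F

      codeterministic : ∀ {c x y x′ y′} → B (c ∷ x) y → B (c ∷ x′) y′ →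
                        Same B (c ∷ x) y (c ∷ x′) y′ → Same B x (c ∷ y) x′ (c ∷ y′)
      codeterministic b b′ p =
        same-mirror {mirror F} (shiftˡ b) (shiftˡ b′)
          (deterministic {mirror F} b b′ (same-mirror {F} b b′ p))

      Position : Set
      Position = ∃[ x ] ∃[ y ] B x y

      infix 4 _∼_
      record _∼_ (P Q : Position) : Set where
        constructor same
        field same⁻ : Same B (proj₁ P) (proj₁ (proj₂ P)) (proj₁ Q) (proj₁ (proj₂ Q))

      ∼-refl : ∀ {P} → P ∼ P
      ∼-refl = same (path done)

      ∼-trans : ∀ {P Q R} → P ∼ Q → Q ∼ R → P ∼ R
      ∼-trans {_ , _ , b₁} {_ , _ , b₂} {_ , _ , b₃} (same p) (same q) =
        same (same-trans {F} b₁ b₂ b₃ p q)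

      data Run : List (Sign × A) → Position → Position → Set where
        stop : ∀ {P Q} → P ∼ Q → Run [] P Q
        forth : ∀ {P Q w x c y} (b : B x (c ∷ y)) → P ∼ (x , c ∷ y , b) →
                Run w (c ∷ x , y , shiftʳ b) Q → Run ((Sign.+ , c) ∷ w) P Q
        back : ∀ {P Q w x c y} (b : B (c ∷ x) y) → P ∼ (c ∷ x , y , b) →
               Run w (x , c ∷ y , shiftˡ b) Q → Run ((Sign.- , c) ∷ w) P Q

      run-∼ : ∀ {w P Q R} → P ∼ Q → Run w Q R → Run w P R
      run-∼ p (stop q) = stop (∼-trans p q)
      run-∼ p (forth b q r) = forth b (∼-trans p q) r
      run-∼ p (back b q r) = back b (∼-trans p q) r

      run-++ : ∀ {v w P Q R} → Run v P Q → Run w Q R → Run (v ++ w) P R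
      run-++ (stop p) r = run-∼ p r
      run-++ (forth b q r) r′ = forth b q (run-++ r r′)
      run-++ (back b q r) r′ = back b q (run-++ r r′)

      -- Reading c and then its inverse, or conversely, returns to an identified position, because
      -- the folded graph is deterministic in both directions.
      run-cancel : ∀ {s c w P Q} → Run ((s , c) ∷ (opposite s , c) ∷ w) P Q → Run w P Q
      run-cancel (forth b p (back b′ (same q) r)) =
        run-∼ (∼-trans p (same (codeterministic (shiftʳ b) b′ q))) r
      run-cancel (back b p (forth b′ (same q) r)) =
        run-∼ (∼-trans p (same (deterministic {F} (shiftˡ b) b′ q))) r

-- Morphisms of free groups and reduced words

module _ (G H : Group 0ℓ 0ℓ) where
  private
    module G = Group G
    module H = Group H

  IsHom : (G.Carrier → H.Carrier) → Set
  IsHom = Morphism.GroupMorphisms.IsGroupHomomorphism G.rawGroup H.rawGroup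

  isHom : ∀ {φ} → (∀ {x y} → x G.≈ y → φ x H.≈ φ y) →
          (∀ x y → φ (x G.∙ y) H.≈ φ x H.∙ φ y) → IsHom φ
  isHom {φ} φ-cong φ-∙ = record
    { isMonoidHomomorphism = record
      { isMagmaHomomorphism = record
        { isRelHomomorphism = record { cong = φ-cong } ; homo = φ-∙ }
      ; ε-homo = φ-ε
      }
    ; ⁻¹-homo = λ x → inverseˡ-unique (φ (x G.⁻¹)) (φ x)
        (H.trans (H.sym (φ-∙ (x G.⁻¹) x)) (H.trans (φ-cong (G.inverseˡ x)) φ-ε))
    }
    where
    open GroupProperties H
    φ-ε : φ G.ε H.≈ H.ε
    φ-ε = identityʳ-unique (φ G.ε) (φ G.ε)
      (H.trans (H.sym (φ-∙ G.ε G.ε)) (φ-cong (G.identityˡ G.ε)))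

module _ {G H K : Group 0ℓ 0ℓ} where
  hom-∘ : ∀ {φ ψ} → IsHom G H φ → IsHom H K ψ → IsHom G K (ψ ∘ φ)
  hom-∘ = Composition.isGroupHomomorphism (Group.trans K)

module _ (S : Setoid 0ℓ 0ℓ) (G : Group 0ℓ 0ℓ) where
  open Setoid S using () renaming (Carrier to X; _≈_ to _≈ₓ_)
  open Free S using (SignedWord; Step; letter; cancel; inv) renaming (group to F; extend to extendTo)
  private module G = Group G
  open G using (Carrier; _≈_; _∙_; _⁻¹; ∙-cong; ∙-congˡ; ∙-congʳ; ⁻¹-cong; assoc; identityˡ; identityʳ)
  open SetoidReasoning G.setoid

  generator : X → SignedWord
  generator x = (Sign.+ , x) ∷ []

  module _ (f : X → Carrier) (f-cong : ∀ {x y} → x ≈ₓ y → f x ≈ f y) where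
    private
      ⟦_⟧ : SignedWord → Carrier
      ⟦_⟧ = extendTo G f

    extend-++ : ∀ u v → ⟦ u ++ v ⟧ ≈ ⟦ u ⟧ ∙ ⟦ v ⟧
    extend-++ [] v = G.sym (identityˡ _)
    extend-++ ((Sign.+ , x) ∷ u) v = G.trans (∙-congˡ (extend-++ u v)) (G.sym (assoc _ _ _))
    extend-++ ((Sign.- , x) ∷ u) v = G.trans (∙-congˡ (extend-++ u v)) (G.sym (assoc _ _ _))

    extend-step : ∀ {u v} → Step u v → ⟦ u ⟧ ≈ ⟦ v ⟧
    extend-step (letter u {s} {x} {y} v e) = begin
      ⟦ u ++ (s , x) ∷ v ⟧      ≈⟨ extend-++ u _ ⟩
      ⟦ u ⟧ ∙ ⟦ (s , x) ∷ v ⟧   ≈⟨ ∙-congˡ (head-cong s) ⟩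
      ⟦ u ⟧ ∙ ⟦ (s , y) ∷ v ⟧   ≈⟨ extend-++ u _ ⟨
      ⟦ u ++ (s , y) ∷ v ⟧      ∎
      where
      head-cong : ∀ s → ⟦ (s , x) ∷ v ⟧ ≈ ⟦ (s , y) ∷ v ⟧
      head-cong Sign.+ = ∙-congʳ (f-cong e)
      head-cong Sign.- = ∙-congʳ (⁻¹-cong (f-cong e))
    extend-step (cancel u s x v) = begin
      ⟦ u ++ (s , x) ∷ (opposite s , x) ∷ v ⟧      ≈⟨ extend-++ u _ ⟩
      ⟦ u ⟧ ∙ ⟦ (s , x) ∷ (opposite s , x) ∷ v ⟧   ≈⟨ ∙-congˡ (pair s) ⟩
      ⟦ u ⟧ ∙ ⟦ v ⟧                                ≈⟨ extend-++ u v ⟨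
      ⟦ u ++ v ⟧                                   ∎
      where
      open GroupProperties G
      pair : ∀ s → ⟦ (s , x) ∷ (opposite s , x) ∷ v ⟧ ≈ ⟦ v ⟧
      pair Sign.+ = \\-leftDividesˡ (f x) ⟦ v ⟧
      pair Sign.- = \\-leftDividesʳ (f x) ⟦ v ⟧

    extend-hom : IsHom F G ⟦_⟧
    extend-hom = isHom F G (Eq.gfold G.isEquivalence ⟦_⟧ extend-step) extend-++

    extend-unique : ∀ {φ} → IsHom F G φ → (∀ x → φ (generator x) ≈ f x) →
                    ∀ w → φ w ≈ ⟦ w ⟧
    extend-unique {φ} h e [] = ε-homo h
    extend-unique {φ} h e ((Sign.+ , x) ∷ w) =
      G.trans (homo h (generator x) w) (∙-cong (e x) (extend-unique h e w))
    extend-unique {φ} h e ((Sign.- , x) ∷ w) =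
      G.trans (homo h (inv (generator x)) w)
        (∙-cong (G.trans (⁻¹-homo h (generator x)) (⁻¹-cong (e x))) (extend-unique h e w))

  extend-gen : ∀ (f : X → Carrier) x → extendTo G f (generator x) ≈ f x
  extend-gen f x = identityʳ (f x)

module FreeGroupProperties {A : Set} (em : ExcludedMiddle 0ℓ) where
  open FreeGroup A
  open Free (≡.setoid A) using (inv; Step; letter; cancel)
  private module F = Group group

  embed-++ : ∀ u v → embed (u ++ v) ≡ embed u ++ embed v
  embed-++ = map-++ _

  flip : Sign × A → Sign × A
  flip (s , a) = opposite s , a

  flip² : ∀ l → flip (flip l) ≡ l
  flip² (Sign.+ , a) = refl
  flip² (Sign.- , a) = refl

  push : Sign × A → List (Sign × A) → List (Sign × A)
  push l [] = l ∷ []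
  push l (l′ ∷ w) with em {P = l′ ≡ flip l}
  ... | yes _ = w
  ... | no  _ = l ∷ l′ ∷ w

  reduce : List (Sign × A) → List (Sign × A)
  reduce = foldr push []

  Reduced : List (Sign × A) → Set
  Reduced = Linked λ l l′ → l′ ≢ flip l

  push-reduced : ∀ l {w} → Reduced w → Reduced (push l w)
  push-reduced l [] = [-]
  push-reduced l {l′ ∷ w} r with em {P = l′ ≡ flip l}
  push-reduced l [-] | yes _ = []
  push-reduced l (_ ∷ r) | yes _ = r
  push-reduced l r | no ne = ne ∷ r

  reduce-reduced : ∀ w → Reduced (reduce w)
  reduce-reduced [] = []
  reduce-reduced (l ∷ w) = push-reduced l (reduce-reduced w)

  push-∷ : ∀ l {w} → Reduced (l ∷ w) → push l w ≡ l ∷ w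
  push-∷ l [-] = refl
  push-∷ l {l′ ∷ _} (ne ∷ _) with em {P = l′ ≡ flip l}
  ... | yes e = ⊥-elim (ne e)
  ... | no _ = refl

  push-flip : ∀ l w → push l (flip l ∷ w) ≡ w
  push-flip l w with em {P = flip l ≡ flip l}
  ... | yes _ = refl
  ... | no ne = ⊥-elim (ne refl)

  -- If w begins with l, pushing `flip l` deletes this letter, and restoring it causes no new
  -- cancellation because w is reduced.
  push-push-flip : ∀ l {w} → Reduced w → push l (push (flip l) w) ≡ w
  push-push-flip l [] = push-flip l []
  push-push-flip l {l′ ∷ w} r with em {P = l′ ≡ flip (flip l)}
  ... | no _ = push-flip l (l′ ∷ w)
  ... | yes e = subst (λ m → Reduced (m ∷ w) → push l w ≡ m ∷ w)
    (trans (sym (flip² l)) (sym e)) (push-∷ l) r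

  reduce-step : ∀ {u v} → Step u v → reduce u ≡ reduce v
  reduce-step (letter u v refl) = refl
  reduce-step (cancel [] s a v) = push-push-flip (s , a) (reduce-reduced v)
  reduce-step (cancel (l ∷ u) s a v) = cong (push l) (reduce-step (cancel u s a v))

  reduce-cong : ∀ {u v} → u ≈ v → reduce u ≡ reduce v
  reduce-cong = Eq.gfold ≡.isEquivalence reduce reduce-step

  reduce-embed : ∀ u → reduce (embed u) ≡ embed u
  reduce-embed [] = refl
  reduce-embed (a ∷ u) rewrite reduce-embed u = push-∷ _ (positive a u)
    where
    positive : ∀ a u → Reduced (embed (a ∷ u))
    positive a [] = [-]
    positive a (b ∷ u) = (λ ()) ∷ positive b u

  embed-injective : ∀ {u v} → embed u ≈ embed v → u ≡ v
  embed-injective {u} {v} e = map-injective (cong proj₂)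
    (trans (sym (reduce-embed u)) (trans (reduce-cong e) (reduce-embed v)))

  module _ {F : Folding A} where
    open FoldedGraph {A} em

    run-push : ∀ l {w P Q} → Run {F} (l ∷ w) P Q → Run {F} (push l w) P Q
    run-push l {[]} r = r
    run-push l {l′ ∷ w} r with em {P = l′ ≡ flip l}
    ... | yes refl = run-cancel r
    ... | no _ = r

    run-reduce : ∀ w {P Q} → Run {F} w P Q → Run {F} (reduce w) P Q
    run-reduce [] r = r
    run-reduce (l ∷ w) (forth b p r) = run-push l (forth b p (run-reduce w r))
    run-reduce (l ∷ w) (back b p r) = run-push l (back b p (run-reduce w r))

-- Bifix codes spanning the free group

module _ {A : Set} (L : Pred (List A) 0ℓ) where

  Factorial : Set
  Factorial = ∀ u {v} w → u ++ v ++ w ∈ L → v ∈ L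

  suffix-∈ : Factorial → ∀ u {v} → u ++ v ∈ L → v ∈ L
  suffix-∈ factorial u {v} p = factorial u [] (subst (λ v → u ++ v ∈ L) (sym (++-identityʳ v)) p)

  -- Every edge of the extension graph of v is cut by a 2-colouring of the
  -- vertices: the graph is acyclic.
  Cut : List A → Set
  Cut v = ∀ a b → a ∷ v ∷ʳ b ∈ L →
    Σ[ χ⁻ ∈ (A → Bool) ] Σ[ χ⁺ ∈ (A → Bool) ] χ⁻ a ≢ χ⁺ b ×
      (∀ a′ b′ → a′ ∷ v ∷ʳ b′ ∈ L → ¬ (a′ ≡ a × b′ ≡ b) → χ⁻ a′ ≡ χ⁺ b′)

ev : {A I : Set} → (I → List A) → List (Sign × I) → FreeGroup.Carrier A
ev {A} {I} σ = Free.extend (≡.setoid I) group (embed ∘ σ)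
  where open FreeGroup A

module Saturation {A : Set} (em : ExcludedMiddle 0ℓ)
  {L : Pred (List A) 0ℓ} (factorial : Factorial L) (cut : ∀ v → Cut L v)
  {I : Set} (σ : I → List A) (σ∈L : ∀ i → σ i ∈ L)
  {bound : ℕ} (bounded : ∀ i → length (σ i) ≤ bound)
  (prefix-free : ∀ {i j z} → σ j ≡ σ i ++ z → z ≡ [])
  (suffix-free : ∀ {i j z} → σ j ≡ z ++ σ i → z ≡ [])
  where
  open FreeGroup A
  open Free (≡.setoid A) using (inv)
  open FreeGroupProperties {A} em
  open FoldedGraph {A} em
  private module F = Group group

  folding : Folding A
  folding = record
    { B = λ x y → ∃[ i ] σ i ≡ x ʳ++ y
    ; S = λ x y → x ʳ++ y ∈ L
    ; B⇒S = λ (i , e) → subst (_∈ L) e (σ∈L i)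
    ; S-prefix = λ {s} {x} {t} {y} p →
        factorial (reverse x) y (subst (_∈ L) (split s x t y) p)
    ; cut = λ s t e c p →
        let χ⁻ , χ⁺ , ne , eq = cut (s ʳ++ t) e c (subst (_∈ L) (outer s t e c) p) in
        χ⁻ , χ⁺ , ne , λ e′ c′ p′ → eq e′ c′ (subst (_∈ L) (outer s t e′ c′) p′)
    ; bifixˡ = λ { {x} {y} {z} (i , e) (j , e′) →
        reverse-injective (suffix-free {i} {j} (trans e′ (trans (++-ʳ++ x)
          (trans (ʳ++-defn z) (cong (reverse z ++_) (sym e)))))) }
    ; bifixʳ = λ { {x} {y} {z} (i , e) (j , e′) →
        prefix-free {i} {j} (trans e′ (trans (ʳ++-assoc x y z) (cong (_++ z) (sym e)))) }
    -- `(c ∷ x) ʳ++ y` computes to `x ʳ++ (c ∷ y)`.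
    ; shiftˡ = id
    ; shiftʳ = id
    ; bound = bound
    ; bounded = λ {x} (i , e) → subst (_≤ bound) (trans (cong length e) (length-ʳ++ x)) (bounded i)
    }
    where
    ʳ++-assoc : ∀ (x y z : List A) → x ʳ++ (y ++ z) ≡ (x ʳ++ y) ++ z
    ʳ++-assoc x y z = trans (ʳ++-defn x)
      (trans (sym (++-assoc (reverse x) y z)) (cong (_++ z) (sym (ʳ++-defn x))))
    split : ∀ (s x t y : List A) → (s ++ x) ʳ++ (t ++ y) ≡ reverse x ++ (s ʳ++ t) ++ y
    split s x t y = trans (++-ʳ++ s) (trans (ʳ++-defn x) (cong (reverse x ++_) (ʳ++-assoc s t y)))
    outer : ∀ s t e c → (s ∷ʳ e) ʳ++ (t ∷ʳ c) ≡ e ∷ (s ʳ++ t) ∷ʳ c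
    outer s t e c = trans (++-ʳ++ s) (cong (e ∷_) (ʳ++-assoc s t (c ∷ [])))

  R : List (Sign × A) → Position {folding} → Position {folding} → Set
  R = Run {folding}

  run-embed : ∀ y x b → ∃[ b′ ] R (embed y) (x , y , b) (y ʳ++ x , [] , b′)
  run-embed [] x b = b , stop ∼-refl
  run-embed (c ∷ y) x b = let b′ , r = run-embed y (c ∷ x) b in b′ , forth b ∼-refl r

  run-inv-embed : ∀ y x b → ∃[ b′ ] R (inv (embed y)) (y ʳ++ x , [] , b′) (x , y , b)
  run-inv-embed [] x b = b , stop ∼-refl
  run-inv-embed (c ∷ y) x b =
    let b′ , r = run-inv-embed y (c ∷ x) b in
    b′ , subst (λ w → R w (y ʳ++ (c ∷ x) , [] , b′) (x , c ∷ y , b))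
      (sym (unfold-reverse (Sign.- , c) (map _ (embed y))))
      (run-++ r (back b ∼-refl (stop ∼-refl)))

  AtEnd : Position {folding} → Set
  AtEnd (x , y , _) = End x y

  -- All ends of words form one vertex, the base point, at which every code word labels a loop.
  run-ev : ∀ w {P Q} → AtEnd P → AtEnd Q → R (ev σ w) P Q
  run-ev [] p q = stop (same (ends p q))
  run-ev ((Sign.+ , i) ∷ w) p q =
    let b , r = run-embed (σ i) [] (i , refl) in
    run-∼ (same (ends p (inj₁ refl))) (run-++ r (run-ev w (inj₂ refl) q))
  run-ev ((Sign.- , i) ∷ w) p q =
    let b , r = run-inv-embed (σ i) [] (i , refl) in
    run-∼ (same (ends p (inj₂ refl))) (run-++ r (run-ev w (inj₁ refl) q))

  ∼-end : ∀ {P Q} → _∼_ {folding} P Q → AtEnd P → AtEnd Q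
  ∼-end (same (ends _ q)) p = q
  ∼-end {_ , _ , b} {_ , _ , b′} (same (path q)) p = path-end {folding} b p q b′

  ∼-sym : ∀ {P Q} → _∼_ {folding} P Q → _∼_ {folding} Q P
  ∼-sym (same e) = same (same-sym {folding} e)

  -- An end is never identified with an inner position, so c is read from the beginning of a code
  -- word to its end.
  letter-in-code : ∀ {P Q c} → AtEnd P → AtEnd Q → R ((Sign.+ , c) ∷ []) P Q → ∃[ i ] σ i ≡ c ∷ []
  letter-in-code p q (forth {x = x} {y = y} b e (stop e′))
    with ∼-end e p | ∼-end (∼-sym e′) q
  ... | inj₁ refl | inj₂ refl = b

  -- A product of code words labels a loop at the base point, and so does its reduced form, here the
  -- single letter c. The first factor supplies a code word at which to place the base point.
  letters-in-code : ∀ {c} w → gen c ≈ ev σ w → ∃[ i ] σ i ≡ c ∷ []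
  letters-in-code [] e with reduce-cong e
  ... | ()
  letters-in-code {c} w@((_ , i) ∷ _) e =
    letter-in-code {P} {P} (inj₁ refl) (inj₁ refl)
      (subst (λ u → R u P P) (sym (reduce-cong e))
        (run-reduce (ev σ w) (run-ev w (inj₁ refl) (inj₁ refl))))
    where
    P : Position {folding}
    P = [] , σ i , i , refl

-- Automorphisms of the free group and tame bases

module _ {A : Set} (em : ExcludedMiddle 0ℓ) where
  open FreeGroup A
  open FreeGroupProperties {A} em
  private module F = Group group

  record Automorphism (φ : Carrier → Carrier) : Set where
    field
      hom : IsHom group group φ
      inverse : Carrier → Carrier
      inverse-hom : IsHom group group inverse
      inverseˡ : ∀ x → inverse (φ x) ≈ x
      inverseʳ : ∀ x → φ (inverse x) ≈ x

  identity-automorphism : Automorphism id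
  identity-automorphism = record
    { hom = Identity.isGroupHomomorphism F.rawGroup F.refl
    ; inverse = id
    ; inverse-hom = Identity.isGroupHomomorphism F.rawGroup F.refl
    ; inverseˡ = λ _ → F.refl
    ; inverseʳ = λ _ → F.refl
    }

  automorphism-∘ : ∀ {φ ψ} → Automorphism φ → Automorphism ψ → Automorphism (φ ∘ ψ)
  automorphism-∘ Φ Ψ = record
    { hom = hom-∘ {group} {group} {group} Ψ.hom Φ.hom
    ; inverse = Ψ.inverse ∘ Φ.inverse
    ; inverse-hom = hom-∘ {group} {group} {group} Φ.inverse-hom Ψ.inverse-hom
    ; inverseˡ = λ x → F.trans (⟦⟧-cong Ψ.inverse-hom (Φ.inverseˡ _)) (Ψ.inverseˡ x)
    ; inverseʳ = λ x → F.trans (⟦⟧-cong Φ.hom (Ψ.inverseʳ _)) (Φ.inverseʳ x)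
    }
    where
    module Φ = Automorphism Φ
    module Ψ = Automorphism Ψ

  endo : ∀ f → IsHom group group (extend group f)
  endo f = extend-hom (≡.setoid A) group f λ { refl → F.refl }

  extend-automorphism : ∀ (f g : A → Carrier) →
    (∀ a → extend group g (f a) ≈ gen a) → (∀ a → extend group f (g a) ≈ gen a) →
    Automorphism (extend group f)
  extend-automorphism f g gf fg = record
    { hom = endo f
    ; inverse = extend group g
    ; inverse-hom = endo g
    ; inverseˡ = cancels f g gf
    ; inverseʳ = cancels g f fg
    }
    where
    cancels : ∀ f g → (∀ a → extend group g (f a) ≈ gen a) →
              ∀ x → extend group g (extend group f x) ≈ x
    cancels f g e x = F.trans
      (extend-unique (≡.setoid A) group gen (λ { refl → F.refl })
        (hom-∘ {group} {group} {group} (endo f) (endo g))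
        (λ a → F.trans (⟦⟧-cong (endo g) (extend-gen (≡.setoid A) group f a)) (e a)) x)
      (F.sym (extend-unique (≡.setoid A) group gen (λ { refl → F.refl })
        (Identity.isGroupHomomorphism F.rawGroup F.refl) (λ _ → F.refl) x))

  -- The inverse of a transvection a ↦ u a v, where u and v are powers of
  -- a generator b ≠ a, is a ↦ u⁻¹ a v⁻¹.
  transvection : ∀ {a : A} (u v : Carrier) (f : A → Carrier) →
    f a ≈ u ∙ (gen a ∙ v) → (∀ c → c ≢ a → f c ≈ gen c) →
    (∀ g → (∀ c → c ≢ a → g c ≈ gen c) →
      extend group g u ≈ u × extend group g v ≈ v) →
    Automorphism (extend group f)
  transvection {a} u v f fa fc fix = extend-automorphism f g gf fg
    where
    open GroupProperties group
    open SetoidReasoning F.setoid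
    ext : ∀ f c → extend group f (gen c) ≈ f c
    ext = extend-gen (≡.setoid A) group
    g : A → Carrier
    g c with em {P = c ≡ a}
    ... | yes _ = (u F.⁻¹) ∙ (gen a ∙ (v F.⁻¹))
    ... | no  _ = gen c
    ga : g a ≈ (u F.⁻¹) ∙ (gen a ∙ (v F.⁻¹))
    ga with em {P = a ≡ a}
    ... | yes _ = F.refl
    ... | no ne = ⊥-elim (ne refl)
    gc : ∀ c → c ≢ a → g c ≈ gen c
    gc c ne with em {P = c ≡ a}
    ... | yes e = ⊥-elim (ne e)
    ... | no _ = F.refl
    image : ∀ h {x y} →
            extend group h (x ∙ (gen a ∙ y)) ≈ extend group h x ∙ (h a ∙ extend group h y)
    image h {x} {y} = F.trans (homo (endo h) x _)
      (F.∙-congˡ {extend group h x} (F.trans (homo (endo h) (gen a) y) (F.∙-congʳ (ext h a))))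
    unwrap : ∀ x y w → x ∙ (((x F.⁻¹) ∙ (w ∙ (y F.⁻¹))) ∙ y) ≈ w
    unwrap x y w = begin
      x ∙ (((x F.⁻¹) ∙ (w ∙ (y F.⁻¹))) ∙ y)   ≈⟨ F.∙-congˡ {x} (F.assoc (x F.⁻¹) (w ∙ (y F.⁻¹)) y) ⟩
      x ∙ ((x F.⁻¹) ∙ ((w ∙ (y F.⁻¹)) ∙ y))   ≈⟨ \\-leftDividesˡ x _ ⟩
      (w ∙ (y F.⁻¹)) ∙ y                      ≈⟨ //-rightDividesˡ y w ⟩
      w                                       ∎
    unwrap′ : ∀ x y w → (x F.⁻¹) ∙ ((x ∙ (w ∙ y)) ∙ (y F.⁻¹)) ≈ w
    unwrap′ x y w = begin
      (x F.⁻¹) ∙ ((x ∙ (w ∙ y)) ∙ (y F.⁻¹))   ≈⟨ F.∙-congˡ {x F.⁻¹} (F.assoc x (w ∙ y) (y F.⁻¹)) ⟩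
      (x F.⁻¹) ∙ (x ∙ ((w ∙ y) ∙ (y F.⁻¹)))   ≈⟨ \\-leftDividesʳ x _ ⟩
      (w ∙ y) ∙ (y F.⁻¹)                      ≈⟨ //-rightDividesʳ y w ⟩
      w                                       ∎
    gf : ∀ c → extend group g (f c) ≈ gen c
    gf c with em {P = c ≡ a}
    ... | no ne = F.trans (⟦⟧-cong (endo g) (fc c ne)) (F.trans (ext g c) (gc c ne))
    ... | yes refl = begin
      extend group g (f a)                                  ≈⟨ ⟦⟧-cong (endo g) fa ⟩
      extend group g (u ∙ (gen a ∙ v))                      ≈⟨ image g {u} {v} ⟩
      extend group g u ∙ (g a ∙ extend group g v)
        ≈⟨ F.∙-cong (proj₁ (fix g gc)) (F.∙-cong ga (proj₂ (fix g gc))) ⟩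
      u ∙ (((u F.⁻¹) ∙ (gen a ∙ (v F.⁻¹))) ∙ v)             ≈⟨ unwrap u v (gen a) ⟩
      gen a                                                 ∎
    fg : ∀ c → extend group f (g c) ≈ gen c
    fg c with em {P = c ≡ a}
    ... | no ne = F.trans (ext f c) (fc c ne)
    ... | yes refl = begin
      extend group f ((u F.⁻¹) ∙ (gen a ∙ (v F.⁻¹)))        ≈⟨ image f {u F.⁻¹} {v F.⁻¹} ⟩
      extend group f (u F.⁻¹) ∙ (f a ∙ extend group f (v F.⁻¹))
        ≈⟨ F.∙-cong (inv-fix u (proj₁ (fix f fc))) (F.∙-cong fa (inv-fix v (proj₂ (fix f fc)))) ⟩
      (u F.⁻¹) ∙ ((u ∙ (gen a ∙ v)) ∙ (v F.⁻¹))             ≈⟨ unwrap′ u v (gen a) ⟩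
      gen a                                                 ∎
      where
      inv-fix : ∀ x → extend group f x ≈ x → extend group f (x F.⁻¹) ≈ x F.⁻¹
      inv-fix x e = F.trans (⁻¹-homo (endo f) x) (F.⁻¹-cong e)

  elementary-automorphism : ∀ {φ} → Elementary φ → Automorphism φ
  elementary-automorphism (perm π) =
    extend-automorphism (gen ∘ to) (gen ∘ from)
      (λ a → F.trans (extend-gen (≡.setoid A) group (gen ∘ from) (to a))
               (F.reflexive (cong gen (strictlyInverseʳ a))))
      (λ a → F.trans (extend-gen (≡.setoid A) group (gen ∘ to) (from a))
               (F.reflexive (cong gen (strictlyInverseˡ a))))
    where open Inverse π
  elementary-automorphism (α {a} {b} a≢b f fa fc) =
    transvection {a} [] (gen b) f fa fc λ g gc →
      F.refl , F.trans (extend-gen (≡.setoid A) group g b) (gc b (a≢b ∘ sym))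
  elementary-automorphism (α̃ {a} {b} a≢b f fa fc) =
    transvection {a} (gen b) [] f fa fc λ g gc →
      F.trans (extend-gen (≡.setoid A) group g b) (gc b (a≢b ∘ sym)) , F.refl

  tame-automorphism : ∀ {φ} → TameMorphism φ → Automorphism φ
  tame-automorphism identity = identity-automorphism
  tame-automorphism (compose e t) = automorphism-∘ (elementary-automorphism e) (tame-automorphism t)

  -- `compose` adds a factor on the left, whereas undoing a reduction of a code composes on the
  -- right.
  tame-∘ : ∀ {φ ψ} → TameMorphism φ → Elementary ψ → TameMorphism (φ ∘ ψ)
  tame-∘ identity e = compose e identity
  tame-∘ (compose e′ t) e = compose e′ (tame-∘ t e)

  -- Let `κ` send each letter a to the generator φ a of the free group on B. The canonical morphism
  -- `ext` satisfies ext ∘ κ = φ, and κ ∘ φ⁻¹ is its inverse.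
  automorphism-basis : ∀ {φ} {B : Pred Carrier 0ℓ} → Automorphism φ →
    (∀ g → g ∈ B ⇔ (∃[ a ] g ≈ φ (gen a))) → IsBasis group B
  automorphism-basis {φ} {B} Φ B⇔ = record
    { isGroupMonomorphism = record
      { isGroupHomomorphism = ext-hom
      ; injective = λ {x} {y} e → FB.trans (FB.sym (κψF x))
          (FB.trans (⟦⟧-cong κ-hom (⟦⟧-cong inverse-hom e)) (κψF y))
      }
    ; surjective = λ y → κ (inverse y) , λ {z} e →
        F.trans (⟦⟧-cong ext-hom e) (F.trans (Fκ (inverse y)) (inverseʳ y))
    }
    where
    open Automorphism Φ
    S = subsetSetoid group B
    module FB = Group (Free.group S)
    ext : FB.Carrier → Carrier
    ext = Free.extend S group proj₁
    ext-hom : IsHom (Free.group S) group ext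
    ext-hom = extend-hom S group proj₁ id
    member : A → ∃ B
    member a = φ (gen a) , Equivalence.from (B⇔ (φ (gen a))) (a , F.refl)
    κ : Carrier → FB.Carrier
    κ = extend (Free.group S) (λ a → (Sign.+ , member a) ∷ [])
    κ-hom : IsHom group (Free.group S) κ
    κ-hom = extend-hom (≡.setoid A) (Free.group S) _ λ { refl → FB.refl }
    κ-gen : ∀ a → κ (gen a) FB.≈ (Sign.+ , member a) ∷ []
    κ-gen = extend-gen (≡.setoid A) (Free.group S) _
    Fκ : ∀ x → ext (κ x) ≈ φ x
    Fκ x = F.trans
      (extend-unique (≡.setoid A) group (φ ∘ gen) (λ { refl → F.refl })
        (hom-∘ {group} {Free.group S} {group} κ-hom ext-hom)
        (λ a → F.trans (⟦⟧-cong ext-hom (κ-gen a)) (extend-gen S group proj₁ (member a))) x)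
      (F.sym (extend-unique (≡.setoid A) group (φ ∘ gen) (λ { refl → F.refl }) hom (λ _ → F.refl) x))
    κψF : ∀ x → κ (inverse (ext x)) FB.≈ x
    κψF x = FB.trans
      (extend-unique S (Free.group S) (λ b → (Sign.+ , b) ∷ []) letter≈
        (hom-∘ {Free.group S} {group} {Free.group S} ext-hom
          (hom-∘ {group} {group} {Free.group S} inverse-hom κ-hom))
        on-gen x)
      (FB.sym (extend-unique S (Free.group S) _ letter≈
        (Identity.isGroupHomomorphism FB.rawGroup FB.refl) (λ _ → FB.refl) x))
      where
      letter≈ : ∀ {b b′ : ∃ B} → proj₁ b ≈ proj₁ b′ → ((Sign.+ , b) ∷ []) FB.≈ ((Sign.+ , b′) ∷ [])
      letter≈ e = fwd (Free.letter [] [] e) ◅ ε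
      on-gen : ∀ b → κ (inverse (ext ((Sign.+ , b) ∷ []))) FB.≈ (Sign.+ , b) ∷ []
      on-gen b@(g , b∈B) with Equivalence.to (B⇔ g) b∈B
      ... | a , e = FB.trans (⟦⟧-cong κ-hom (F.trans (⟦⟧-cong inverse-hom
                      (F.trans (extend-gen S group proj₁ b) e)) (inverseˡ (gen a))))
                    (FB.trans (κ-gen a) (letter≈ (F.sym e)))

-- Weights modulo 2 and tame families

parity : Group 0ℓ 0ℓ
parity = CommutativeRing.+-group xor-∧-commutativeRing

weight : {A : Set} → (A → Bool) → List A → Bool
weight λ′ []      = false
weight λ′ (a ∷ u) = λ′ a xor weight λ′ u

weight-++ : {A : Set} (λ′ : A → Bool) (u v : List A) →
            weight λ′ (u ++ v) ≡ weight λ′ u xor weight λ′ v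
weight-++ λ′ [] v = refl
weight-++ λ′ (a ∷ u) v =
  trans (cong (λ′ a xor_) (weight-++ λ′ u v)) (sym (xor-assoc (λ′ a) _ _))

module _ {A : Set} (λ′ : A → Bool) where
  open FreeGroup A

  signedWeight : Carrier → Bool
  signedWeight = extend parity λ′

  signedWeight-hom : IsHom group parity signedWeight
  signedWeight-hom = extend-hom (≡.setoid A) parity λ′ (cong λ′)

  signedWeight-embed : ∀ u → signedWeight (embed u) ≡ weight λ′ u
  signedWeight-embed [] = refl
  signedWeight-embed (a ∷ u) = cong (λ′ a xor_) (signedWeight-embed u)

module _ {A : Set} (em : ExcludedMiddle 0ℓ) {R : Pred (List A) 0ℓ}
         (basis : IsBasis (FreeGroup.group A) (FreeGroup.wordSet A R)) where
  open FreeGroup A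
  open FreeGroupProperties {A} em
  private
    module F = Group group
    S = subsetSetoid group (wordSet R)
    module FR = Group (Free.group S)
    open Morphism.IsGroupIsomorphism basis using (isGroupHomomorphism; injective; surjective)
    F⟦_⟧ : FR.Carrier → Carrier
    F⟦_⟧ = Free.extend S group proj₁

    preimage : Carrier → FR.Carrier
    preimage g = proj₁ (surjective g)

    image-preimage : ∀ g → F⟦ preimage g ⟧ ≈ g
    image-preimage g = proj₂ (surjective g) FR.refl

  -- f extends to a morphism on the free group over the basis; transported to the free group on A,
  -- this morphism is given by its values on the letters.
  basis-weights : (f : List A → Bool) → ∃[ λ′ ] (∀ r → r ∈ R → weight λ′ r ≡ f r)
  basis-weights f = λ′ , λ r r∈R → trans (sym (agree r))
    (trans (⟦⟧-cong f̂-hom (injective {preimage (embed r)} {(Sign.+ , member r r∈R) ∷ []}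
             (F.trans (image-preimage (embed r)) (F.sym (extend-gen S group proj₁ (member r r∈R))))))
           (xor-identityʳ (f r)))
    where
    member : ∀ r → r ∈ R → ∃ (wordSet R)
    member r r∈R = embed r , r , r∈R , F.refl
    f̂ : FR.Carrier → Bool
    f̂ = Free.extend S parity (f ∘ proj₁ ∘ proj₂)
    f̂-hom : IsHom (Free.group S) parity f̂
    -- Basis elements are compared in the free group; f is well defined on them because positive
    -- words embed injectively.
    f̂-hom = extend-hom S parity _ λ { {_ , r , _ , e} {_ , r′ , _ , e′} g≈g′ →
      cong f (embed-injective (F.trans (F.sym e) (F.trans g≈g′ e′))) }
    λ′ : A → Bool
    λ′ a = f̂ (preimage (gen a))
    preimage-++ : ∀ g h → preimage (g ++ h) FR.≈ preimage g ++ preimage h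
    preimage-++ g h = injective (F.trans (image-preimage (g ++ h))
      (F.trans (F.sym (F.∙-cong (image-preimage g) (image-preimage h)))
        (F.sym (homo isGroupHomomorphism (preimage g) (preimage h)))))
    agree : ∀ u → f̂ (preimage (embed u)) ≡ weight λ′ u
    agree [] = ⟦⟧-cong f̂-hom (injective {preimage []} {[]} (image-preimage []))
    agree (a ∷ u) = trans (⟦⟧-cong f̂-hom (preimage-++ (gen a) (embed u)))
      (trans (homo f̂-hom (preimage (gen a)) (preimage (embed u))) (cong (λ′ a xor_) (agree u)))

  -- A basis generates, so a morphism to ℤ/2 vanishing on it is zero.
  basis-null : ∀ λ′ → (∀ r → r ∈ R → weight λ′ r ≡ false) → ∀ c → λ′ c ≡ false
  basis-null λ′ null c = trans (sym (xor-identityʳ (λ′ c)))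
    (trans (sym (⟦⟧-cong (signedWeight-hom λ′) (image-preimage (gen c)))) (vanish (preimage (gen c))))
    where
    on-basis : ∀ (b : ∃ (wordSet R)) → signedWeight λ′ (proj₁ b) ≡ false
    on-basis (g , r , r∈R , e) = trans (⟦⟧-cong (signedWeight-hom λ′) e)
      (trans (signedWeight-embed λ′ r) (null r r∈R))
    vanish : ∀ w → signedWeight λ′ F⟦ w ⟧ ≡ false
    vanish [] = refl
    vanish ((Sign.+ , b) ∷ w) = trans (homo (signedWeight-hom λ′) (proj₁ b) F⟦ w ⟧)
      (cong₂ _xor_ (on-basis b) (vanish w))
    vanish ((Sign.- , b) ∷ w) = trans (homo (signedWeight-hom λ′) (proj₁ b F.⁻¹) F⟦ w ⟧)
      (cong₂ _xor_ (trans (⁻¹-homo (signedWeight-hom λ′) (proj₁ b)) (on-basis b)) (vanish w))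

total : ∀ {m} → (Fin m → ℕ) → ℕ
total {zero}  f = 0
total {suc m} f = f zero + total (f ∘ suc)

total-mono : ∀ {m} {f g : Fin m → ℕ} → (∀ i → f i ≤ g i) → total f ≤ total g
total-mono {zero}  le = z≤n
total-mono {suc m} le = +-mono-≤ (le zero) (total-mono (le ∘ suc))

total-mono-< : ∀ {m} {f g : Fin m → ℕ} j → (∀ i → f i ≤ g i) → f j < g j → total f < total g
total-mono-< zero    le lt = +-mono-<-≤ lt (total-mono (le ∘ suc))
total-mono-< (suc j) le lt = +-mono-≤-< (le zero) (total-mono-< j (le ∘ suc) lt)

≤-total-at : ∀ {m} (f : Fin m → ℕ) i → f i ≤ total f
≤-total-at f zero    = m≤m+n _ _
≤-total-at f (suc i) = ≤-trans (≤-total-at (f ∘ suc) i) (m≤n+m _ (f zero))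

data Side : Set where
  left right : Side

glue : {B : Set} → Side → List B → List B → List B
glue left  u z = u ++ z
glue right u z = z ++ u

module Tameness {A : Set} (em : ExcludedMiddle 0ℓ)
  {L : Pred (List A) 0ℓ} (factorial : Factorial L) (cut : ∀ v → Cut L v) where
  open FreeGroup A
  open FreeGroupProperties {A} em
  private module F = Group group

  Spanning : ∀ {m} → (Fin m → List A) → Set
  Spanning σ = ∀ c → ∃[ w ] gen c ≈ ev σ w

  -- Linear independence, in dual form, of the images of the `σ i` in the ℤ/2-vector space on the
  -- letters.
  Independent : ∀ {m} → (Fin m → List A) → Set
  Independent {m} σ = (f : Fin m → Bool) → ∃[ λ′ ] (∀ i → weight λ′ (σ i) ≡ f i)

  record TameCode {m} (σ : Fin m → List A) : Set₁ where
    field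
      φ : Carrier → Carrier
      tame : TameMorphism φ
      index : A → Fin m
      index-injective : ∀ {a b} → index a ≡ index b → a ≡ b
      index-surjective : ∀ i → ∃[ a ] index a ≡ i
      φ-gen : ∀ a → φ (gen a) ≈ embed (σ (index a))

  -- The empty word has weight `false`, so it cannot realise the constant function `true`.
  nonempty : ∀ {m} {σ : Fin m → List A} → Independent σ → ∀ i → 1 ≤ length (σ i)
  nonempty {σ = σ} indep i with σ i | proj₂ (indep (λ _ → true)) i
  ... | _ ∷ _ | _ = s≤s z≤n

  factorˡ : ∀ u {v} → u ++ v ∈ L → v ∈ L
  factorˡ = suffix-∈ L factorial

  factor-glue : ∀ s {u z} → glue s u z ∈ L → z ∈ L
  factor-glue left {u} p = factorˡ u p
  factor-glue right {u} p = factorial [] u p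

  length-glue : ∀ s (u z : List A) → length (glue s u z) ≡ length u + length z
  length-glue left u z = length-++ u
  length-glue right u z = trans (length-++ z) (+-comm (length z) _)

  weight-glue : ∀ s (λ′ : A → Bool) u z → weight λ′ (glue s u z) ≡ weight λ′ u xor weight λ′ z
  weight-glue left λ′ u z = weight-++ λ′ u z
  weight-glue right λ′ u z = trans (weight-++ λ′ z u) (xor-comm (weight λ′ z) _)

  module Reduction {m} (σ : Fin m → List A) {i j : Fin m} (i≢j : i ≢ j) (s : Side) {z : List A}
                   (σj : σ j ≡ glue s (σ i) z) where

    σ′ : Fin m → List A
    σ′ = updateAt σ j (const z)

    σ′-j : σ′ j ≡ z
    σ′-j = updateAt-updates j σ

    σ′-≢ : ∀ {k} → k ≢ j → σ′ k ≡ σ k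
    σ′-≢ {k} = updateAt-minimal k j σ

    σ′∈L : (∀ k → σ k ∈ L) → ∀ k → σ′ k ∈ L
    σ′∈L σ∈L k with k Fin.≟ j
    ... | yes refl = subst (_∈ L) (sym σ′-j) (factor-glue s (subst (_∈ L) σj (σ∈L j)))
    ... | no k≢j = subst (_∈ L) (sym (σ′-≢ k≢j)) (σ∈L k)

    shorter : 1 ≤ length (σ i) → total (length ∘ σ′) < total (length ∘ σ)
    shorter ne = total-mono-< j le lt
      where
      lt : length (σ′ j) < length (σ j)
      lt = subst₂ _<_ (cong length (sym σ′-j)) (sym (trans (cong length σj) (length-glue s (σ i) z)))
             (+-monoˡ-≤ (length z) ne)
      le : ∀ k → length (σ′ k) ≤ length (σ k)
      le k with k Fin.≟ j
      ... | yes refl = <⇒≤ lt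
      ... | no k≢j = ≤-reflexive (cong length (σ′-≢ k≢j))

    independent : Independent σ → Independent σ′
    independent indep f = λ′ , λ k → on k
      where
      -- The weight of `σ j` is the sum of those of `σ i` and z, and z must receive `f j`.
      g = updateAt f j (const (f i xor f j))
      λ′ = proj₁ (indep g)
      eq = proj₂ (indep g)
      on-j : weight λ′ z ≡ f j
      on-j = solve (weight λ′ (σ i)) (weight λ′ z) (f i) (f j)
               (trans (sym (weight-glue s λ′ (σ i) z))
                 (trans (cong (weight λ′) (sym σj)) (trans (eq j) (updateAt-updates j f))))
               (trans (eq i) (updateAt-minimal i j f i≢j))
        where
        solve : ∀ x y p q → x xor y ≡ p xor q → x ≡ p → y ≡ q
        solve false y .false q e refl = e
        solve true true .true true e refl = refl
        solve true false .true false e refl = refl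
      on : ∀ k → weight λ′ (σ′ k) ≡ f k
      on k with k Fin.≟ j
      ... | yes refl = trans (cong (weight λ′) σ′-j) on-j
      ... | no k≢j = trans (cong (weight λ′) (σ′-≢ k≢j)) (trans (eq k) (updateAt-minimal k j f k≢j))

    spanning : Spanning σ → Spanning σ′
    spanning span c =
      let w , e = span c in Free.extend (≡.setoid (Fin m)) (Free.group (≡.setoid (Fin m))) η w ,
        F.trans e (F.sym (extend-unique (≡.setoid (Fin m)) group (embed ∘ σ) (λ { refl → F.refl })
          (hom-∘ {FI} {FI} {group} η-hom ev-hom)
          (λ k → F.trans (⟦⟧-cong ev-hom (extend-gen (≡.setoid (Fin m)) FI η k)) (on-gen k)) w))
      where
      FI = Free.group (≡.setoid (Fin m))
      module FI = Group FI
      -- A product of the `σ k` becomes a product of the `σ′ k` when the generator j is replaced by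
      -- i and j, in the order of the gluing.
      η : Fin m → FI.Carrier
      η k with k Fin.≟ j
      ... | yes _ = glue s ((Sign.+ , i) ∷ []) ((Sign.+ , j) ∷ [])
      ... | no _ = (Sign.+ , k) ∷ []
      η-hom : IsHom FI FI (Free.extend (≡.setoid (Fin m)) FI η)
      η-hom = extend-hom (≡.setoid (Fin m)) FI η λ { refl → FI.refl }
      ev-hom : IsHom FI group (ev σ′)
      ev-hom = extend-hom (≡.setoid (Fin m)) group (embed ∘ σ′) λ { refl → F.refl }
      pair : ∀ s → ev σ′ (glue s ((Sign.+ , i) ∷ []) ((Sign.+ , j) ∷ [])) ≡ embed (glue s (σ i) z)
      pair left = trans (cong₂ (λ u v → embed u ++ (embed v ++ [])) (σ′-≢ i≢j) σ′-j)
        (trans (cong (embed (σ i) ++_) (++-identityʳ _)) (sym (embed-++ (σ i) z)))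
      pair right = trans (cong₂ (λ u v → embed v ++ (embed u ++ [])) (σ′-≢ i≢j) σ′-j)
        (trans (cong (embed z ++_) (++-identityʳ _)) (sym (embed-++ z (σ i))))
      on-gen : ∀ k → ev σ′ (η k) ≈ embed (σ k)
      on-gen k with k Fin.≟ j
      ... | yes refl = F.reflexive (trans (pair s) (cong embed (sym σj)))
      ... | no k≢j = F.reflexive (trans (++-identityʳ _) (cong embed (σ′-≢ k≢j)))

    tameCode : TameCode σ′ → TameCode σ
    tameCode T = record
      { φ = T.φ ∘ extend group f
      ; tame = tame-∘ em T.tame (elementary s refl)
      ; index = T.index
      ; index-injective = T.index-injective
      ; index-surjective = T.index-surjective
      ; φ-gen = λ c → F.trans (⟦⟧-cong φ-hom (extend-gen (≡.setoid A) group f c)) (on-gen c)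
      }
      where
      module T = TameCode T
      φ-hom = Automorphism.hom (tame-automorphism em T.tame)
      a = proj₁ (T.index-surjective i)
      b = proj₁ (T.index-surjective j)
      index-a = proj₂ (T.index-surjective i)
      index-b = proj₂ (T.index-surjective j)
      b≢a : b ≢ a
      b≢a e = i≢j (trans (sym index-a) (trans (cong T.index (sym e)) index-b))
      f : A → Carrier
      f c with em {P = c ≡ b}
      ... | yes _ = glue s (gen a) (gen b)
      ... | no  _ = gen c
      fb : f b ≈ glue s (gen a) (gen b)
      fb with em {P = b ≡ b}
      ... | yes _ = F.refl
      ... | no ne = ⊥-elim (ne refl)
      fc : ∀ c → c ≢ b → f c ≈ gen c
      fc c ne with em {P = c ≡ b}
      ... | yes e = ⊥-elim (ne e)
      ... | no _ = F.refl
      -- With a and b the letters of indices i and j, the transvection sends b to ab or to ba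
      -- according to the side of the common factor.
      elementary : ∀ s′ → s ≡ s′ → Elementary (extend group f)
      elementary left refl = α̃ b≢a f fb fc
      elementary right refl = α b≢a f fb fc
      φ-glue : ∀ s → T.φ (glue s (gen a) (gen b)) ≈ embed (glue s (σ i) z)
      φa : T.φ (gen a) ≈ embed (σ i)
      φa = F.trans (T.φ-gen a) (F.reflexive (cong embed (trans (cong σ′ index-a) (σ′-≢ i≢j))))
      φb : T.φ (gen b) ≈ embed z
      φb = F.trans (T.φ-gen b) (F.reflexive (cong embed (trans (cong σ′ index-b) σ′-j)))
      φ-glue left = F.trans (homo φ-hom (gen a) (gen b))
        (F.trans (F.∙-cong φa φb) (F.reflexive (sym (embed-++ (σ i) z))))
      φ-glue right = F.trans (homo φ-hom (gen b) (gen a))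
        (F.trans (F.∙-cong φb φa) (F.reflexive (sym (embed-++ z (σ i)))))
      on-gen : ∀ c → T.φ (f c) ≈ embed (σ (T.index c))
      on-gen c with em {P = c ≡ b}
      ... | yes refl = F.trans (φ-glue s)
              (F.reflexive (cong embed (trans (sym σj) (cong σ (sym index-b)))))
      ... | no c≢b = F.trans (T.φ-gen c) (F.reflexive (cong embed (σ′-≢ λ e →
              c≢b (T.index-injective (trans e (sym index-b))))))

  tameCode : ∀ fuel {m} (σ : Fin m → List A) → total (length ∘ σ) < fuel →
             (∀ i → σ i ∈ L) → Spanning σ → Independent σ → TameCode σ
  tameCode (suc fuel) {m} σ (s≤s le) σ∈L span indep
    with em {P = ∃[ i ] ∃[ j ] i ≢ j × ∃[ s ] ∃[ z ] σ j ≡ glue s (σ i) z}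
  ... | yes (i , j , i≢j , s , z , e) =
    tameCode′ (tameCode fuel σ′ (<-≤-trans (shorter (nonempty {σ = σ} indep i)) le) (σ′∈L σ∈L)
      (spanning span) (independent indep))
    where open Reduction σ i≢j s e renaming (tameCode to tameCode′)
  ... | no bifix = record
    { φ = id
    ; tame = identity
    ; index = index
    ; index-injective = λ {a} {b} e →
        ∷-injectiveˡ (trans (sym (σ-index a)) (trans (cong σ e) (σ-index b)))
    ; index-surjective = surj
    ; φ-gen = λ a → F.reflexive (cong embed (sym (σ-index a)))
    }
    where
    -- `bifix` concerns distinct indices; for i = j, lengths force z to be empty.
    glue-free : ∀ s {i j z} → σ j ≡ glue s (σ i) z → z ≡ []
    glue-free s {i} {j} {z} e with i Fin.≟ j
    ... | no i≢j = ⊥-elim (bifix (i , j , i≢j , s , z , e))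
    ... | yes refl with z | +-cancelˡ-≡ (length (σ i)) (length z) 0
                    (trans (sym (length-glue s (σ i) z)) (trans (cong length (sym e)) (sym (+-identityʳ _))))
    ... | [] | _ = refl
    open Saturation em factorial cut σ σ∈L (≤-total-at (length ∘ σ))
      (glue-free left) (λ {i} {j} {z} e → glue-free right {i} {j} {z} e)
    letter : ∀ a → ∃[ i ] σ i ≡ a ∷ []
    letter a = let w , e = span a in letters-in-code w e
    index : A → Fin m
    index a = proj₁ (letter a)
    σ-index : ∀ a → σ (index a) ≡ a ∷ []
    σ-index a = proj₂ (letter a)
    -- The first letter of `σ i` is itself a code word and a prefix of `σ i`, so by bifixity it has
    -- index i.
    surj : ∀ i → ∃[ a ] index a ≡ i
    surj i with σ i in e | nonempty {σ = σ} indep i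
    ... | a ∷ u | _ with index a Fin.≟ i
    ... | yes eq = a , eq
    ... | no ne = ⊥-elim (bifix (index a , i , ne , left , u ,
            trans e (cong (_++ u) (sym (σ-index a)))))

-- Return words in a uniformly recurrent language

Contains : {A : Set} → List A → List A → Set
Contains w u = ∃[ p ] ∃[ q ] u ≡ p ++ w ++ q

prefix-of-prefix : {A : Set} {x y z : List A} → Prefix x z → Prefix y z → length x ≤ length y → Prefix x y
prefix-of-prefix {x = []} {y} p q le = y , refl
prefix-of-prefix {x = a ∷ x} {b ∷ y} (p , refl) (q , e) (s≤s le)
  with refl ← ∷-injectiveˡ e =
  let r , e′ = prefix-of-prefix {x = x} {y} (p , refl) (q , ∷-injectiveʳ e) le in r , cong (a ∷_) e′

prefix-++ : {A : Set} {x y : List A} (p : List A) → Prefix x y → Prefix x (y ++ p)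
prefix-++ {x = x} p (q , refl) = q ++ p , ++-assoc x q p

record RecurrentLanguage {A : Set} (L : Pred (List A) 0ℓ) : Set where
  field
    factorial : Factorial L
    extendˡ : ∀ {u} → u ∈ L → ∃[ a ] a ∷ u ∈ L
    extendʳ : ∀ {u} → u ∈ L → ∃[ b ] u ∷ʳ b ∈ L
    recurrent : ∀ {w} → w ∈ L → ∃[ N ] (∀ {u} → u ∈ L → N ≤ length u → Contains w u)
    letters-∈ : ∀ a → a ∷ [] ∈ L

module _ {A : Set} (L : Pred (List A) 0ℓ) where

  -- `ReturnWord` for an arbitrary language; at `Language X` the two agree by computation.
  Return : List A → Pred (List A) 0ℓ
  Return w r =
    r ≢ [] ×
    r ++ w ∈ L ×
    (∃[ s ] r ++ w ≡ w ++ s) ×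
    ¬ (∃[ u ] ∃[ v ] u ≢ [] × v ≢ [] × r ++ w ≡ u ++ w ++ v)

  -- The extension graph of v is connected: a set of vertices that is closed
  -- under adjacency contains all right vertices as soon as it contains one.
  Conn : List A → Set₁
  Conn v = ∀ (P Q : A → Set) →
    (∀ a b → a ∷ v ∷ʳ b ∈ L → (P a → Q b) × (Q b → P a)) →
    ∀ b b′ → v ∷ʳ b ∈ L → v ∷ʳ b′ ∈ L → Q b → Q b′

module FirstOccurrence {A : Set} (em : ExcludedMiddle 0ℓ) where

  -- Equal to u, a junk value, when w does not occur in u.
  first : List A → List A → List A
  first w [] = []
  first w (b ∷ u) with em {P = Prefix w (b ∷ u)}
  ... | yes _ = []
  ... | no  _ = b ∷ first w u

  first-hit : ∀ {w b u} → Prefix w (b ∷ u) → first w (b ∷ u) ≡ []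
  first-hit {w} {b} {u} p with em {P = Prefix w (b ∷ u)}
  ... | yes _ = refl
  ... | no n = ⊥-elim (n p)

  first-miss : ∀ {w b u} → ¬ Prefix w (b ∷ u) → first w (b ∷ u) ≡ b ∷ first w u
  first-miss {w} {b} {u} n with em {P = Prefix w (b ∷ u)}
  ... | yes p = ⊥-elim (n p)
  ... | no _ = refl

  first-self : ∀ w → first w w ≡ []
  first-self [] = refl
  first-self (b ∷ w) = first-hit ([] , sym (++-identityʳ (b ∷ w)))

  contains-tail : ∀ {w : List A} {b u} → ¬ Prefix w (b ∷ u) → Contains w (b ∷ u) → Contains w u
  contains-tail n ([] , q , e) = ⊥-elim (n (q , e))
  contains-tail n (c ∷ p , q , e) = p , q , ∷-injectiveʳ e

  first-spec : ∀ w u → Contains w u → Prefix (first w u ++ w) u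
  first-spec w [] (p , q , e) with p | w
  first-spec w [] (p , q , e) | [] | [] = [] , refl
  first-spec w (b ∷ u) c with em {P = Prefix w (b ∷ u)}
  ... | yes p = p
  ... | no n = let q , e = first-spec w u (contains-tail n c) in q , cong (b ∷_) e

  no-room : ∀ {w : List A} x {y} → w ≡ x ++ w ++ y → y ≡ []
  no-room x {[]} e = refl
  no-room {w} x {y@(_ ∷ _)} e =
    case m+n≡0⇒n≡0 (length x) (+-cancelʳ-≡ (length w) (length x + length y) 0 (sym len)) of λ ()
    where
    len : length w ≡ length x + length y + length w
    len = trans (cong length e) (trans (length-++ x) (trans (cong (length x +_)
      (trans (length-++ w) (+-comm (length w) (length y)))) (sym (+-assoc (length x) (length y) (length w)))))

  -- An occurrence of w that is not final would start inside `first w u`, hence before the first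
  -- occurrence in u.
  first-least : ∀ w u → Contains w u → ∀ x {y} → first w u ++ w ≡ x ++ w ++ y → y ≡ []
  first-least w [] c x e = no-room {w} x e
  first-least w (b ∷ u) c x e with em {P = Prefix w (b ∷ u)}
  first-least w (b ∷ u) c x e | yes p = no-room {w} x e
  first-least w (b ∷ u) c [] {y} e | no n =
    ⊥-elim (n (prefix-trans (y , e) (proj₁ s , cong (b ∷_) (proj₂ s))))
    where
    s = first-spec w u (contains-tail n c)
    prefix-trans : ∀ {x y z : List A} → Prefix x y → Prefix y z → Prefix x z
    prefix-trans {x} (p , refl) (q , refl) = p ++ q , ++-assoc x p q
  first-least w (b ∷ u) c (a ∷ x) e | no n =
    first-least w u (contains-tail n c) x (∷-injectiveʳ e)

  contains-length : ∀ {w u : List A} → Contains w u → length w ≤ length u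
  contains-length {w} (p , q , refl) = ≤-trans (m≤m+n (length w) (length q))
    (≤-trans (≤-reflexive (sym (length-++ w))) (≤-trans (m≤n+m _ (length p))
      (≤-reflexive (sym (length-++ p)))))

  first-stable : ∀ w v p → Contains w v → first w (v ++ p) ≡ first w v
  first-stable w [] p c with contains-length c
  first-stable [] [] [] c | _ = refl
  first-stable [] [] (x ∷ p) c | _ = first-hit (x ∷ p , refl)
  first-stable w (b ∷ v) p c with em {P = Prefix w (b ∷ v)}
  ... | yes q = first-hit (prefix-++ p q)
  ... | no n = trans (first-miss λ q → n (prefix-of-prefix q (p , refl) (contains-length c)))
                 (cong (b ∷_) (first-stable w v p (contains-tail n c)))

module Words {A : Set} (em : ExcludedMiddle 0ℓ) {L : Pred (List A) 0ℓ} (lang : RecurrentLanguage L) where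
  open RecurrentLanguage lang public
  open FirstOccurrence {A} em public

  factorʳ : ∀ {u} v → u ++ v ∈ L → u ∈ L
  factorʳ v p = factorial [] v p

  factorˡ : ∀ u {v} → u ++ v ∈ L → v ∈ L
  factorˡ = suffix-∈ L factorial

  prefix-∈ : ∀ {u v} → Prefix u v → v ∈ L → u ∈ L
  prefix-∈ (p , refl) v∈L = factorʳ p v∈L

  long-right : ∀ {u} N → u ∈ L → ∃[ p ] u ++ p ∈ L × N ≤ length p
  long-right {u} zero u∈L = [] , subst (_∈ L) (sym (++-identityʳ u)) u∈L , z≤n
  long-right {u} (suc N) u∈L =
    let b , ub = extendʳ u∈L
        p , ubp , le = long-right N ub
    in b ∷ p , subst (_∈ L) (++-assoc u _ p) ubp , s≤s le

  long-left : ∀ {u} N → u ∈ L → ∃[ p ] p ++ u ∈ L × N ≤ length p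
  long-left {u} zero u∈L = [] , u∈L , z≤n
  long-left {u} (suc N) u∈L =
    let a , au = extendˡ u∈L
        p , pau , le = long-left N au
    in p ∷ʳ a , subst (_∈ L) (sym (++-assoc p _ u)) pau ,
       subst (suc N ≤_) (sym (trans (length-++ p) (+-comm (length p) 1))) (s≤s le)

  long : ∀ {u} N → u ∈ L → ∃[ p ] u ++ p ∈ L × N ≤ length (u ++ p)
  long {u} N u∈L = let p , up , le = long-right N u∈L in
    p , up , ≤-trans le (≤-trans (m≤n+m _ (length u)) (≤-reflexive (sym (length-++ u))))

  -- `first w u` locates the next occurrence after the one at the start, and `first-least` excludes
  -- any occurrence in between.
  return-hit : ∀ {w b u} → b ∷ u ∈ L → Contains w u → Prefix w (b ∷ u) → Return L w (b ∷ first w u)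
  return-hit {w} {b} {u} bu∈L c p =
    (λ ()) , prefix-∈ r bu∈L ,
    prefix-of-prefix p r (≤-trans (m≤n+m (length w) _) (≤-reflexive (sym (length-++ (b ∷ first w u))))) ,
    λ { ([] , _ , ne , _ , _) → ne refl
      ; (a ∷ x , y , _ , ne , e) → ne (first-least w u c x (∷-injectiveʳ e)) }
    where
    r : Prefix (b ∷ first w u ++ w) (b ∷ u)
    r = let q , e = first-spec w u c in q , cong (b ∷_) e

  -- Common to both directions: `h` takes values in cosets (with m = 0) or in ℤ/2. By induction on
  -- longer words, the class of `h` on long words through v is constant at each right vertex b, via
  -- v b, and at each left vertex a, via a v and cancellation of a. Connectedness of E(v) makes it
  -- constant.
  module Descent {T : Set} {_~_ : T → T → Set} (equiv : IsEquivalence _~_)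
    (h : List A → T) (N m : ℕ)
    (base : ∀ v p p′ → N ≤ length v → v ++ p ∈ L → h (v ++ p) ~ h (v ++ p′))
    (conn : ∀ v → m ≤ length v → v ∈ L → Conn L v)
    (cancel : ∀ a v p p′ → m ≤ length v → a ∷ v ++ p ∈ L → a ∷ v ++ p′ ∈ L →
      N ≤ length (v ++ p) → N ≤ length (v ++ p′) →
      h (a ∷ v ++ p) ~ h (a ∷ v ++ p′) → h (v ++ p) ~ h (v ++ p′))
    where
    private module ~ = IsEquivalence equiv

    Determined : List A → Set
    Determined v = ∀ p p′ → v ++ p ∈ L → v ++ p′ ∈ L →
      N ≤ length (v ++ p) → N ≤ length (v ++ p′) → h (v ++ p) ~ h (v ++ p′)

    determined-step : ∀ v → m ≤ length v → (∀ a → Determined (a ∷ v)) →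
                      (∀ b → Determined (v ∷ʳ b)) → Determined v
    determined-step v m≤ ihˡ ihʳ [] p′ vp vp′ le le′ =
      base v [] p′ (subst (λ v → N ≤ length v) (++-identityʳ v) le) vp
    determined-step v m≤ ihˡ ihʳ (b ∷ q) [] vp vp′ le le′ =
      ~.sym (base v [] (b ∷ q) (subst (λ v → N ≤ length v) (++-identityʳ v) le′) vp′)
    determined-step v m≤ ihˡ ihʳ (b ∷ q) (b′ ∷ q′) vp vp′ le le′
      with conn v m≤ (factorʳ (b ∷ q) vp) P Q closed b b′ (vb∈L vp) (vb∈L vp′) (q , vp , le , ~.refl)
      where
      -- The vertices through which some long word has the class of the reference word v b q; every
      -- edge (a , c) transmits this mark through a long word beginning with a v c.
      P Q : A → Set
      P a = ∃[ p ] a ∷ v ++ p ∈ L × N ≤ length (v ++ p) × h (v ++ p) ~ h (v ++ b ∷ q)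
      Q c = ∃[ p ] v ++ c ∷ p ∈ L × N ≤ length (v ++ c ∷ p) × h (v ++ c ∷ p) ~ h (v ++ b ∷ q)
      vb∈L : ∀ {b q} → v ++ b ∷ q ∈ L → v ∷ʳ b ∈ L
      vb∈L {b} {q} p = factorʳ q (subst (_∈ L) (sym (++-assoc v _ q)) p)
      ihʳ′ : ∀ c p p′ → v ++ c ∷ p ∈ L → v ++ c ∷ p′ ∈ L → N ≤ length (v ++ c ∷ p) →
               N ≤ length (v ++ c ∷ p′) → h (v ++ c ∷ p) ~ h (v ++ c ∷ p′)
      ihʳ′ c p p′ = subst₂ (λ x y → x ∈ L → y ∈ L → N ≤ length x → N ≤ length y → h x ~ h y)
        (++-assoc v _ p) (++-assoc v _ p′) (ihʳ c p p′)
      closed : ∀ a c → a ∷ v ∷ʳ c ∈ L → (P a → Q c) × (Q c → P a)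
      closed a c avc with long-right N avc
      ... | p₀ , avcp , le₀ = to , from
        where
        avcp′ : a ∷ v ++ c ∷ p₀ ∈ L
        avcp′ = subst (λ u → a ∷ u ∈ L) (++-assoc v _ p₀) avcp
        vcp = factorˡ (a ∷ []) avcp′
        le₁ : N ≤ length (v ++ c ∷ p₀)
        le₁ = ≤-trans le₀ (≤-trans (n≤1+n _) (≤-trans (m≤n+m _ (length v)) (≤-reflexive (sym (length-++ v)))))
        to : P a → Q c
        to (p , avp , le , e) = p₀ , vcp , le₁ , ~.trans
          (cancel a v (c ∷ p₀) p m≤ avcp′ avp le₁ le
            (ihˡ a (c ∷ p₀) p avcp′ avp (m≤n⇒m≤1+n le₁) (m≤n⇒m≤1+n le))) e
        from : Q c → P a
        from (p , vcp₁ , le , e) = c ∷ p₀ , avcp′ , le₁ , ~.trans (ihʳ′ c p₀ p vcp vcp₁ le₁ le) e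
    ... | p , vp₁ , le₁ , e = ~.trans (~.sym e)
      (subst₂ (λ x y → x ∈ L → y ∈ L → N ≤ length x → N ≤ length y → h x ~ h y)
        (++-assoc v _ p) (++-assoc v _ q′) (ihʳ b′ p q′) vp₁ vp′ le₁ le′)

    -- Both a v and v b are one letter longer than v, so k decreases until v has N letters and
    -- `base` applies.
    determined : ∀ k v → N ≤ k + length v → m ≤ length v → Determined v
    determined zero v le m≤ p p′ vp vp′ _ _ = base v p p′ le vp
    determined (suc k) v le m≤ = determined-step v m≤
      (λ a → determined k (a ∷ v) (subst (N ≤_) (sym (+-suc k _)) le) (m≤n⇒m≤1+n m≤))
      (λ b → determined k (v ∷ʳ b)
        (subst (N ≤_) (trans (sym (+-suc k _)) (cong (k +_) (sym (length-∷ʳ v)))) le)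
        (≤-trans m≤ (≤-trans (n≤1+n _) (≤-reflexive (sym (length-∷ʳ v))))))
      where
      length-∷ʳ : ∀ (v : List A) {b} → length (v ∷ʳ b) ≡ suc (length v)
      length-∷ʳ v = trans (length-++ v) (+-comm (length v) 1)

-- Return words span the free group

module Span {A : Set} (em : ExcludedMiddle 0ℓ) {L : Pred (List A) 0ℓ} (lang : RecurrentLanguage L)
  (conn : ∀ v → v ∈ L → Conn L v) {w : List A} (w∈L : w ∈ L)
  {m : ℕ} (σ : Fin m → List A) (covers : ∀ {r} → Return L w r → ∃[ i ] σ i ≡ r) where
  open FreeGroup A
  open Words em lang
  private module F = Group group
  open GroupProperties group using (\\-leftDividesʳ; //-rightDividesˡ)

  SI = ≡.setoid (Fin m)
  module FI = Group (Free.group SI)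

  ev-hom : IsHom (Free.group SI) group (ev σ)
  ev-hom = extend-hom SI group (embed ∘ σ) λ { refl → F.refl }

  -- x and y lie in the same left coset of the subgroup spanned by σ.
  record _~_ (x y : Carrier) : Set where
    constructor coset
    field
      word : FI.Carrier
      translate : y ≈ x ∙ ev σ word

  ~-equiv : IsEquivalence _~_
  ~-equiv = record
    { refl = λ {x} → coset [] (F.sym (F.identityʳ x))
    ; sym = λ { {x} {y} (coset s e) → coset (s FI.⁻¹) (F.sym (F.trans
        (F.∙-cong e (⁻¹-homo ev-hom s)) (//-rightDividesʳ (ev σ s) x))) }
    ; trans = λ { {x} (coset s e) (coset t e′) → coset (s ++ t) (F.trans e′
        (F.trans (F.∙-congʳ e) (F.trans (F.assoc x (ev σ s) (ev σ t))
          (F.∙-congˡ {x} (F.sym (homo ev-hom s t)))))) }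
    }
    where open GroupProperties group using (//-rightDividesʳ)

  module ~ = IsEquivalence ~-equiv

  ≈⇒~ : ∀ {x y} → x ≈ y → x ~ y
  ≈⇒~ {x} e = coset [] (F.trans (F.sym e) (F.sym (F.identityʳ x)))

  ~-left : ∀ g {x y} → x ~ y → (g ∙ x) ~ (g ∙ y)
  ~-left g {x} (coset s e) = coset s (F.trans (F.∙-congˡ {g} e) (F.sym (F.assoc g x _)))

  ~-cancel : ∀ g {x y} → (g ∙ x) ~ (g ∙ y) → x ~ y
  ~-cancel g {x} {y} p = ~.trans (≈⇒~ (F.sym (\\-leftDividesʳ g x)))
    (~.trans (~-left (g F.⁻¹) p) (≈⇒~ (\\-leftDividesʳ g y)))

  h : List A → Carrier
  h u = embed (first w u)

  N = proj₁ (recurrent w∈L)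
  contains = proj₂ (recurrent w∈L)

  -- The two sides are equal unless w begins b u; then `h (b ∷ u)` is trivial and the right-hand
  -- side is a return word.
  h-∷ : ∀ {b u} → b ∷ u ∈ L → N ≤ length u → h (b ∷ u) ~ (gen b ∙ h u)
  h-∷ {b} {u} bu le with em {P = Prefix w (b ∷ u)}
  ... | no _ = ~.refl
  ... | yes p =
    let i , e = covers (return-hit bu (contains (factorˡ (b ∷ []) bu) le) p)
    in coset ((Sign.+ , i) ∷ []) (F.reflexive (trans (sym (cong embed e)) (sym (++-identityʳ _))))

  open Descent ~-equiv h N 0
    (λ v p p′ le vp → ≈⇒~ (F.reflexive (cong embed (trans
      (first-stable w v p (contains (factorʳ p vp) le))
      (sym (first-stable w v p′ (contains (factorʳ p vp) le)))))))
    (λ v _ → conn v)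
    (λ a v p p′ _ avp avp′ le le′ e → ~-cancel (gen a)
      (~.trans (~.sym (h-∷ avp le)) (~.trans e (h-∷ avp′ le′))))

  all-cosets-equal : ∀ {u v} → u ∈ L → v ∈ L → N ≤ length u → N ≤ length v → h u ~ h v
  all-cosets-equal {u} {v} = determined N [] (m≤m+n N 0) z≤n u v

  -- Let H be the subgroup spanned by σ and gH the common coset. Every letter fixes gH on the left,
  -- hence so does the element g c g⁻¹; thus g c H = gH and c lies in H.
  spanning : ∀ c → ∃[ s ] gen c ≈ ev σ s
  spanning c =
    let coset s e = ~.sym (~-cancel g {gen c} {[]} (~.trans (≈⇒~ conjugate)
                      (~.trans (absorb (g ∙ (gen c ∙ (g F.⁻¹)))) (≈⇒~ (F.sym (F.identityʳ g))))))
    in s , e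
    where
    start : ∃[ u ] u ∈ L × N ≤ length u
    start = let u , p , le = long N w∈L in w ++ u , p , le
    g : Carrier
    g = h (proj₁ start)
    conjugate : g ∙ gen c ≈ (g ∙ (gen c ∙ (g F.⁻¹))) ∙ g
    conjugate = F.sym (F.trans (F.assoc g (gen c ∙ (g F.⁻¹)) g) (F.∙-congˡ {g} (//-rightDividesˡ g (gen c))))
    letter-absorbed : ∀ b → (gen b ∙ g) ~ g
    letter-absorbed b =
      let u , bu , le = long-right N (letters-∈ b)
          u∈L = factorˡ (b ∷ []) bu
          same-class = all-cosets-equal (proj₁ (proj₂ start)) u∈L (proj₂ (proj₂ start)) le
      in ~.trans (~-left (gen b) same-class) (~.trans (~.sym (h-∷ bu le))
           (all-cosets-equal bu (proj₁ (proj₂ start)) (m≤n⇒m≤1+n le) (proj₂ (proj₂ start))))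
    absorb : ∀ x → (x ∙ g) ~ g
    absorb [] = ~.refl
    absorb ((Sign.+ , b) ∷ x) = ~.trans (~-left (gen b) (absorb x)) (letter-absorbed b)
    absorb ((Sign.- , b) ∷ x) = ~.trans (~-left (gen b F.⁻¹) (absorb x))
      (~-cancel (gen b) (~.trans (≈⇒~ (\\-leftDividesˡ (gen b) g)) (~.sym (letter-absorbed b))))
      where open GroupProperties group using (\\-leftDividesˡ)

-- Trees from bases of return words

≡-of-⇔ : {P Q : Set} (p : Dec P) (q : Dec Q) → (P → Q) → (Q → P) → does p ≡ does q
≡-of-⇔ (yes p) (yes q) f g = refl
≡-of-⇔ (yes p) (no ¬q) f g = ⊥-elim (¬q (f p))
≡-of-⇔ (no ¬p) (yes q) f g = ⊥-elim (¬p (g q))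
≡-of-⇔ (no ¬p) (no ¬q) f g = refl

does-true : {P : Set} (p : Dec P) → does p ≡ true → P
does-true (yes p) _ = p

true-does : {P : Set} (p : Dec P) → P → does p ≡ true
true-does (yes _) _ = refl
true-does (no ¬p) p = ⊥-elim (¬p p)

drop-length : {B : Set} (u v : List B) → drop (length u) (u ++ v) ≡ v
drop-length [] v = refl
drop-length (_ ∷ u) v = drop-length u v

nonempty-suffix : {B : Set} (u v : List B) {t : List B} → u ++ v ≡ v ++ t → u ≢ [] → t ≢ []
nonempty-suffix u v e ne refl = ne (++-identityˡ-unique u (trans (sym (++-identityʳ v)) (sym e)))

-- From the assumption that return words form bases, only the consequences
-- for ℤ/2-valued weights are needed.
module FromBases {A : Set} (em : ExcludedMiddle 0ℓ) {L : Pred (List A) 0ℓ} (lang : RecurrentLanguage L)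
  (weights : ∀ {w} → w ∈ L → (f : List A → Bool) → ∃[ λ′ ] (∀ r → Return L w r → weight λ′ r ≡ f r))
  (null : ∀ {w} → w ∈ L → ∀ λ′ → (∀ r → Return L w r → weight λ′ r ≡ false) → ∀ c → λ′ c ≡ false)
  where
  open Words em lang

  module Colouring {w : List A} (w∈L : w ∈ L) (P Q : A → Set)
    (closed : ∀ a b → a ∷ w ∷ʳ b ∈ L → (P a → Q b) × (Q b → P a)) where

    p q : A → Bool
    p a = does (em {P = P a})
    q b = does (em {P = Q b})

    p≡q : ∀ {a b} → a ∷ w ∷ʳ b ∈ L → p a ≡ q b
    p≡q {a} {b} awb = ≡-of-⇔ em em (proj₁ (closed a b awb)) (proj₂ (closed a b awb))

    -- The default `false` is not reached on return words r: both r and the part of r w after its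
    -- prefix w are nonempty.
    lastColour headColour : List A → Bool
    lastColour [] = false
    lastColour (a ∷ []) = p a
    lastColour (a ∷ r@(_ ∷ _)) = lastColour r
    headColour [] = false
    headColour (b ∷ _) = q b

    lastColour-next : ∀ r {c} → r ≢ [] → r ++ w ∷ʳ c ∈ L → lastColour r ≡ q c
    lastColour-next [] ne _ = ⊥-elim (ne refl)
    lastColour-next (a ∷ []) _ rwc = p≡q rwc
    lastColour-next (a ∷ r@(_ ∷ _)) _ rwc = lastColour-next r (λ ()) (factorˡ (a ∷ []) rwc)

    f : List A → Bool
    f r = lastColour r xor headColour (drop (length w) (r ++ w))

    λ′ = proj₁ (weights w∈L f)
    λ′-f = proj₂ (weights w∈L f)

    -- A relation, since the first occurrence of w may end the word u.
    Potential : List A → Bool → Set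
    Potential u x = ∃[ c ] ∃[ t ] u ≡ first w u ++ w ++ c ∷ t × x ≡ weight λ′ (first w u) xor q c

    potential-unique : ∀ {u x y} → Potential u x → Potential u y → x ≡ y
    potential-unique {u} (c , t , e , refl) (d , t′ , e′ , refl)
      with refl ← ++-cancelˡ w _ _ (++-cancelˡ (first w u) _ _ (trans (sym e) e′)) = refl

    potential-prefix : ∀ {c t} → w ++ c ∷ t ∈ L → Potential (w ++ c ∷ t) (q c)
    potential-prefix {c} {t} wct =
      c , t , sym (cong (_++ w ++ c ∷ t) first≡[]) , sym (cong (λ s → weight λ′ s xor q c) first≡[])
      where
      first≡[] : first w (w ++ c ∷ t) ≡ []
      first≡[] = trans (first-stable w w (c ∷ t) ([] , [] , sym (++-identityʳ w))) (first-self w)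

    -- If w begins b u, then b and `first w u` form a return word r, of weight the colour of its
    -- last letter plus `q d`. This last letter and c are the ends of an edge of E(w), so their
    -- colours cancel and `q d` remains.
    potential-∷ : ∀ {b u x} → b ∷ u ∈ L → Dec (Prefix w (b ∷ u)) →
                  Potential u x → Potential (b ∷ u) (λ′ b xor x)
    potential-∷ {b} {u} {x} bu (no n) (c , t , e , ex) = c , t ,
        trans (cong (b ∷_) e) (cong (_++ w ++ c ∷ t) (sym miss)) ,
        trans (cong (λ′ b xor_) ex) (trans (sym (xor-assoc (λ′ b) _ _))
          (cong (λ s → weight λ′ s xor q c) (sym miss)))
      where
      miss = first-miss {w} {b} {u} n
    potential-∷ {b} {u} {x} bu (yes ([] , e′)) (c , t , e , ex) =
      ⊥-elim (<-irrefl (sym (trans (cong length e′) (cong length (++-identityʳ w))))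
        (s≤s (contains-length {w} {u} (first w u , c ∷ t , e))))
    potential-∷ {b} {u} {x} bu (yes (d ∷ t″ , e′)) (c , t , e , ex) = d , t″ ,
        trans e′ (cong (_++ w ++ d ∷ t″) (sym hit′)) ,
        trans colours (cong (λ s → weight λ′ s xor q d) (sym hit′))
      where
      hit′ = first-hit {w} {b} {u} (d ∷ t″ , e′)
      s = first w u
      r = b ∷ s
      ret : Return L w r
      ret = return-hit bu (s , c ∷ t , e) (d ∷ t″ , e′)
      rw≡ : ∃[ y ] r ++ w ≡ w ++ d ∷ y
      rw≡ with proj₁ (proj₂ (proj₂ ret))
      ... | [] , eq = ⊥-elim (nonempty-suffix r w eq (λ ()) refl)
      ... | d′ ∷ y , eq = y , trans eq (cong (λ d → w ++ d ∷ y) d′≡d)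
        where
        d′≡d : d′ ≡ d
        d′≡d = ∷-injectiveˡ (++-cancelˡ w (d′ ∷ y ++ c ∷ t) (d ∷ t″) (begin
          w ++ d′ ∷ y ++ c ∷ t     ≡⟨ ++-assoc w (d′ ∷ y) (c ∷ t) ⟨
          (w ++ d′ ∷ y) ++ c ∷ t   ≡⟨ cong (_++ c ∷ t) eq ⟨
          (r ++ w) ++ c ∷ t        ≡⟨ ++-assoc r w (c ∷ t) ⟩
          r ++ w ++ c ∷ t          ≡⟨ cong (b ∷_) e ⟨
          b ∷ u                    ≡⟨ e′ ⟩
          w ++ d ∷ t″              ∎))
          where open ≡.≡-Reasoning
      rwc : r ++ w ∷ʳ c ∈ L
      rwc = factorʳ t (subst (_∈ L) (cong (b ∷_) (trans e
        (trans (cong (s ++_) (sym (++-assoc w _ t))) (sym (++-assoc s (w ∷ʳ c) t))))) bu)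
      colours : λ′ b xor x ≡ q d
      colours = begin
        λ′ b xor x                           ≡⟨ cong (λ′ b xor_) ex ⟩
        λ′ b xor (weight λ′ s xor q c)       ≡⟨ xor-assoc (λ′ b) (weight λ′ s) (q c) ⟨
        weight λ′ r xor q c                  ≡⟨ cong (_xor q c) (λ′-f r ret) ⟩
        (lastColour r xor headColour (drop (length w) (r ++ w))) xor q c
          ≡⟨ cong₂ (λ x y → (x xor y) xor q c) (lastColour-next r (λ ()) rwc)
               (cong headColour (trans (cong (drop (length w)) (proj₂ rw≡)) (drop-length w _))) ⟩
        (q c xor q d) xor q c
          ≡⟨ solve 2 (λ x y → (x :+ y) :+ x := y) refl (q c) (q d) ⟩
        q d                                  ∎
        where
        open ≡.≡-Reasoning
        open xor-∧-Solver

    potential-++ : ∀ v {u x} → v ++ u ∈ L → Potential u x → Potential (v ++ u) (weight λ′ v xor x)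
    potential-++ [] vu P = P
    potential-++ (b ∷ v) {u} {x} vu P = subst (Potential (b ∷ v ++ u)) (sym (xor-assoc (λ′ b) _ x))
      (potential-∷ vu em (potential-++ v (factorˡ (b ∷ []) vu) P))

    -- Conjugating by a turns a return word to aw into a word leading from an
    -- occurrence of w to another, both preceded by a.
    null-on-longer : ∀ {a} → a ∷ w ∈ L → ∀ ρ → Return L (a ∷ w) ρ → weight λ′ ρ ≡ false
    null-on-longer aw [] (ne , _) = ⊥-elim (ne refl)
    null-on-longer {a} aw (a′ ∷ ρ) (_ , ρaw , (s , e) , _) with refl ← ∷-injectiveˡ e
      with s | extendʳ ρaw
    ... | [] | _ = ⊥-elim (nonempty-suffix (a ∷ ρ) (a ∷ w) e (λ ()) refl)
    ... | d ∷ s′ | c , ρawc = begin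
      λ′ a xor weight λ′ ρ                 ≡⟨ xor-comm (λ′ a) _ ⟩
      weight λ′ ρ xor λ′ a                 ≡⟨ cong (weight λ′ ρ xor_) (xor-identityʳ (λ′ a)) ⟨
      weight λ′ ρ xor weight λ′ (a ∷ [])   ≡⟨ weight-++ λ′ ρ (a ∷ []) ⟨
      weight λ′ (ρ ∷ʳ a)                   ≡⟨ solve 2 (λ x y → x := (x :+ y) :+ y) refl _ (q c) ⟩
      (weight λ′ (ρ ∷ʳ a) xor q c) xor q c ≡⟨ cong (_xor q c) along ⟩
      q d xor q c                          ≡⟨ cong (_xor q c) (trans (sym (p≡q awd)) (p≡q awc)) ⟩
      q c xor q c                          ≡⟨ xor-same (q c) ⟩
      false                                ∎
      where
      open ≡.≡-Reasoning
      open xor-∧-Solver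
      awc : a ∷ w ∷ʳ c ∈ L
      awc = factorˡ (a ∷ ρ) (subst (_∈ L) (++-assoc (a ∷ ρ) (a ∷ w) (c ∷ [])) ρawc)
      awd : a ∷ w ∷ʳ d ∈ L
      awd = factorʳ s′ (subst (_∈ L) (trans e (cong (a ∷_) (sym (++-assoc w _ s′)))) ρaw)
      ρawc≡ : (ρ ∷ʳ a) ++ w ∷ʳ c ≡ w ++ d ∷ s′ ∷ʳ c
      ρawc≡ = begin
        (ρ ∷ʳ a) ++ w ∷ʳ c     ≡⟨ ++-assoc ρ _ (w ∷ʳ c) ⟩
        ρ ++ a ∷ w ∷ʳ c        ≡⟨ ++-assoc ρ (a ∷ w) (c ∷ []) ⟨
        (ρ ++ a ∷ w) ∷ʳ c      ≡⟨ cong (_∷ʳ c) (∷-injectiveʳ e) ⟩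
        (w ++ d ∷ s′) ∷ʳ c     ≡⟨ ++-assoc w (d ∷ s′) (c ∷ []) ⟩
        w ++ d ∷ s′ ∷ʳ c       ∎
      word∈L : w ++ d ∷ s′ ∷ʳ c ∈ L
      word∈L = factorˡ (a ∷ []) (subst (λ u → a ∷ u ∈ L)
        (trans (cong (_∷ʳ c) (∷-injectiveʳ e)) (++-assoc w (d ∷ s′) (c ∷ []))) ρawc)
      along : weight λ′ (ρ ∷ʳ a) xor q c ≡ q d
      along = potential-unique
        (subst (λ u → Potential u _) ρawc≡
          (potential-++ (ρ ∷ʳ a) (subst (_∈ L) (sym ρawc≡) word∈L)
            (potential-prefix (factorˡ (a ∷ []) awc))))
        (potential-prefix word∈L)

    λ′-null : ∀ c → λ′ c ≡ false
    λ′-null = let a , aw = extendˡ w∈L in null aw λ′ (null-on-longer aw)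

    weight-null : ∀ u → weight λ′ u ≡ false
    weight-null [] = refl
    weight-null (a ∷ u) = cong₂ _xor_ (λ′-null a) (weight-null u)

    right-closed : ∀ b b′ → w ∷ʳ b ∈ L → w ∷ʳ b′ ∈ L → Q b → Q b′
    -- By recurrence some word of the language begins with w b′ and ends with w b. Its potential is
    -- `q b′` when read at the start, and `q b` when computed from the end, since all weights
    -- vanish.
    right-closed b b′ wb wb′ Qb with recurrent wb′
    ... | N , contains with long-left N wb
    ... | x , xwb , le with contains {x} (factorʳ (w ∷ʳ b) xwb) le
    ... | x₁ , x₂ , refl = does-true em (trans (sym q≡) (true-does em Qb))
      where
      middle : w ++ b′ ∷ x₂ ++ w ∷ʳ b ∈ L
      middle = subst (_∈ L) (++-assoc w _ (x₂ ++ w ∷ʳ b))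
        (subst (_∈ L) (++-assoc (w ∷ʳ b′) x₂ (w ∷ʳ b))
          (factorˡ x₁ (subst (_∈ L) (++-assoc x₁ ((w ∷ʳ b′) ++ x₂) (w ∷ʳ b)) xwb)))
      split : (w ++ b′ ∷ x₂) ++ w ∷ʳ b ≡ w ++ b′ ∷ x₂ ++ w ∷ʳ b
      split = ++-assoc w (b′ ∷ x₂) (w ∷ʳ b)
      q≡ : q b ≡ q b′
      q≡ = trans (cong (_xor q b) (sym (weight-null (w ++ b′ ∷ x₂))))
        (potential-unique (subst (λ u → Potential u (weight λ′ (w ++ b′ ∷ x₂) xor q b)) split
            (potential-++ (w ++ b′ ∷ x₂) (subst (_∈ L) (sym split) middle) (potential-prefix wb)))
          (potential-prefix middle))

  conn : ∀ w → w ∈ L → Conn L w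
  conn w w∈L = Colouring.right-closed w∈L

  -- With w = a v b itself, h(u) is the weight up to the first occurrence of
  -- w; it jumps exactly when w is read, i.e. across the edge (a , b).
  cut : ∀ v → Cut L v
  cut v a b w∈L = χ⁻ , χ⁺ , jump , equal
    where
    w = a ∷ v ∷ʳ b
    λ′ = proj₁ (weights w∈L (λ _ → true))
    λ′-true = proj₂ (weights w∈L (λ _ → true))
    N = proj₁ (recurrent w∈L)
    contains = proj₂ (recurrent w∈L)
    h : List A → Bool
    h u = weight λ′ (first w u)

    h-miss : ∀ {c u} → ¬ Prefix w (c ∷ u) → h (c ∷ u) ≡ λ′ c xor h u
    h-miss n = cong (weight λ′) (first-miss n)

    h-hit : ∀ {c u} → c ∷ u ∈ L → N ≤ length u → Prefix w (c ∷ u) → true xor h (c ∷ u) ≡ λ′ c xor h u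
    h-hit {c} {u} cu le p = trans (cong (λ s → true xor weight λ′ s) (first-hit p))
      (sym (λ′-true (c ∷ first w u) (return-hit cu (contains (factorˡ (c ∷ []) cu) le) p)))

    length-w : length w ≡ suc (suc (length v))
    length-w = cong suc (trans (length-++ v) (+-comm (length v) 1))

    w-prefix : ∀ {c u} p p′ → suc (length v) ≤ length u → Prefix w (c ∷ u ++ p) → Prefix w (c ∷ u ++ p′)
    w-prefix {c} {u} p p′ le pre = prefix-++ p′ (prefix-of-prefix {y = c ∷ u} pre (p , refl)
      (subst (_≤ suc (length u)) (sym length-w) (s≤s le)))

    xor-cancelˡ : ∀ x {y z} → x xor y ≡ x xor z → y ≡ z
    xor-cancelˡ false e = e
    xor-cancelˡ true {false} {false} e = refl
    xor-cancelˡ true {true} {true} e = refl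

    cancel : ∀ c u p p′ → suc (length v) ≤ length u → c ∷ u ++ p ∈ L → c ∷ u ++ p′ ∈ L →
      N ≤ length (u ++ p) → N ≤ length (u ++ p′) → h (c ∷ u ++ p) ≡ h (c ∷ u ++ p′) →
      Dec (Prefix w (c ∷ u ++ p)) → λ′ c xor h (u ++ p) ≡ λ′ c xor h (u ++ p′)
    cancel c u p p′ m≤ cup cup′ le le′ e (yes pre) = trans (sym (h-hit cup le pre))
      (trans (cong (true xor_) e) (h-hit cup′ le′ (w-prefix p p′ m≤ pre)))
    cancel c u p p′ m≤ cup cup′ le le′ e (no n) = trans (sym (h-miss n))
      (trans e (h-miss (λ pre → n (w-prefix p′ p m≤ pre))))

    -- The threshold is |v| + 1 because w has |v| + 2 letters: once u is that long, the letter c and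
    -- u decide whether w begins c u, whatever follows.
    open Descent ≡.isEquivalence h N (suc (length v))
      (λ u p p′ le up → cong (weight λ′) (trans
        (first-stable w u p (contains (factorʳ p up) le))
        (sym (first-stable w u p′ (contains (factorʳ p up) le)))))
      (λ u _ → conn u)
      (λ c u p p′ m≤ cup cup′ le le′ e → xor-cancelˡ (λ′ c) (cancel c u p p′ m≤ cup cup′ le le′ e em))

    -- The common value of `h` on the long words beginning with u; `false` is a default outside the
    -- language.
    value : List A → Bool
    value u with em {P = u ∈ L}
    ... | yes u∈L = h (u ++ proj₁ (long N u∈L))
    ... | no _ = false

    value-h : ∀ {u p} → suc (length v) ≤ length u → u ++ p ∈ L → N ≤ length (u ++ p) → h (u ++ p) ≡ value u
    value-h {u} {p} m≤ up le with em {P = u ∈ L}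
    ... | no n = ⊥-elim (n (factorʳ p up))
    ... | yes u∈L = let p′ , up′ , le′ = long N u∈L in
      determined N u (m≤m+n N (length u)) m≤ p p′ up up′ le le′

    -- Removing a′ from a long word changes `h` by `λ′ a′`, unless w is read there; both colours
    -- thus measure `h` on the word that begins with v b′.
    χ⁻ χ⁺ : A → Bool
    χ⁻ a′ = value (a′ ∷ v) xor λ′ a′
    χ⁺ b′ = value (v ∷ʳ b′)

    module _ {a′ b′} (e∈L : a′ ∷ v ∷ʳ b′ ∈ L) where
      p = proj₁ (long-right N e∈L)
      ep = proj₁ (proj₂ (long-right N e∈L))
      le = proj₂ (proj₂ (long-right N e∈L))
      le-vb : N ≤ length ((v ∷ʳ b′) ++ p)
      le-vb = ≤-trans le (≤-trans (m≤n+m _ (length (v ∷ʳ b′))) (≤-reflexive (sym (length-++ (v ∷ʳ b′)))))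
      left-value : h (a′ ∷ (v ∷ʳ b′) ++ p) ≡ value (a′ ∷ v)
      left-value = trans (cong (λ u → h (a′ ∷ u)) (++-assoc v _ p))
        (value-h {a′ ∷ v} {b′ ∷ p} ≤-refl (subst (λ u → a′ ∷ u ∈ L) (++-assoc v _ p) ep)
          (subst (λ u → N ≤ suc (length u)) (++-assoc v _ p) (m≤n⇒m≤1+n le-vb)))
      right-value : h ((v ∷ʳ b′) ++ p) ≡ value (v ∷ʳ b′)
      right-value = value-h (≤-reflexive (trans (+-comm 1 (length v)) (sym (length-++ v))))
        (factorˡ (a′ ∷ []) ep) le-vb

      across : Prefix w (a′ ∷ (v ∷ʳ b′) ++ p) → true xor χ⁻ a′ ≡ χ⁺ b′
      across pre = trans (sym (xor-assoc true (value (a′ ∷ v)) (λ′ a′)))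
        (trans (cong (_xor λ′ a′) (trans (cong (true xor_) (sym left-value))
          (trans (h-hit ep le-vb pre) (cong (λ′ a′ xor_) right-value))))
          (solve 2 (λ x y → (x :+ y) :+ x := y) refl (λ′ a′) (χ⁺ b′)))
        where open xor-∧-Solver

      along : ¬ Prefix w (a′ ∷ (v ∷ʳ b′) ++ p) → χ⁻ a′ ≡ χ⁺ b′
      along n = trans (cong (_xor λ′ a′) (trans (sym left-value)
          (trans (h-miss n) (cong (λ′ a′ xor_) right-value))))
          (solve 2 (λ x y → (x :+ y) :+ x := y) refl (λ′ a′) (χ⁺ b′))
        where open xor-∧-Solver

    jump : χ⁻ a ≢ χ⁺ b
    jump e = contradiction-xor (χ⁺ b) (trans (cong (true xor_) (sym e)) (across w∈L (_ , refl)))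
      where
      contradiction-xor : ∀ x → true xor x ≢ x
      contradiction-xor true ()
      contradiction-xor false ()

    equal : ∀ a′ b′ → a′ ∷ v ∷ʳ b′ ∈ L → ¬ (a′ ≡ a × b′ ≡ b) → χ⁻ a′ ≡ χ⁺ b′
    equal a′ b′ e∈L ne = along e∈L λ (t , eq) → ne
      ( ∷-injectiveˡ eq
      , ∷-injectiveˡ (++-cancelˡ v _ _ (trans (sym (++-assoc v _ _))
          (trans (∷-injectiveʳ eq) (++-assoc v _ t)))))

-- Acyclicity makes return words independent

xor-≢ : ∀ {x y} → x ≢ y → x xor y ≡ true
xor-≢ {true} {true} ne = ⊥-elim (ne refl)
xor-≢ {true} {false} ne = refl
xor-≢ {false} {true} ne = refl
xor-≢ {false} {false} ne = ⊥-elim (ne refl)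

xor-≡ : ∀ {x y} → x ≡ y → x xor y ≡ false
xor-≡ {x} refl = xor-same x

take-sandwich : {B : Set} (n : ℕ) (t r q : List B) → take n (t ++ r ++ q) ≡ t → take n (t ++ r) ≡ t
take-sandwich zero t r q e = e
take-sandwich (suc n) [] [] q e = refl
take-sandwich (suc n) (c ∷ t) r q e = cong (c ∷_) (take-sandwich n t r q (∷-injectiveʳ e))

take-drop-[] : {B : Set} (n : ℕ) (u : List B) → drop n u ≡ [] → take n u ≡ u
take-drop-[] n u e = trans (sym (++-identityʳ _)) (trans (cong (take n u ++_) (sym e)) (take++drop≡id n u))

take-suc-[] : {B : Set} (n : ℕ) (u : List B) → drop n u ≡ [] → take (suc n) u ≡ u
take-suc-[] zero .[] refl = refl
take-suc-[] (suc n) [] e = refl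
take-suc-[] (suc n) (x ∷ u) e = cong (x ∷_) (take-suc-[] n u e)

take-suc-∷ : {B : Set} (n : ℕ) (u : List B) {b : B} {q : List B} →
             drop n u ≡ b ∷ q → take (suc n) u ≡ take n u ∷ʳ b
take-suc-∷ zero .(_ ∷ _) refl = refl
take-suc-∷ (suc n) (x ∷ u) e = cong (x ∷_) (take-suc-∷ n u e)

module Independence {A : Set} (em : ExcludedMiddle 0ℓ) {L : Pred (List A) 0ℓ} (lang : RecurrentLanguage L)
  (alphabet : List A) (complete : ∀ a → a ∈ˡ alphabet) (cut : ∀ v → Cut L v) where
  open Words em lang

  -- The first cohomology group of a forest vanishes.
  edge-potential : ∀ v (θ : A → A → Bool) →
    Σ[ α ∈ (A → Bool) ] Σ[ β ∈ (A → Bool) ] (∀ a b → a ∷ v ∷ʳ b ∈ L → θ a b ≡ α a xor β b)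
  edge-potential v θ =
    let α , β , on , _ = sum-cuts (cartesianProduct alphabet alphabet) in
    α , β , λ a b e → sym (on a b e (∈-cartesianProduct⁺ (complete a) (complete b)))
    where
    -- The coboundary of (α , β) equals θ on the edges listed in `ps` and vanishes on the others. A
    -- new edge with θ = 1 is treated by adding its cut, whose coboundary is the indicator function
    -- of this edge.
    sum-cuts : ∀ ps → Σ[ α ∈ (A → Bool) ] Σ[ β ∈ (A → Bool) ]
      (∀ a b → a ∷ v ∷ʳ b ∈ L → (a , b) ∈ˡ ps → α a xor β b ≡ θ a b) ×
      (∀ a b → a ∷ v ∷ʳ b ∈ L → ¬ (a , b) ∈ˡ ps → α a xor β b ≡ false)
    sum-cuts [] = (λ _ → false) , (λ _ → false) , (λ _ _ _ ()) , λ _ _ _ _ → refl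
    sum-cuts ((a , b) ∷ ps) with sum-cuts ps | em {P = (a , b) ∈ˡ ps} | em {P = a ∷ v ∷ʳ b ∈ L}
    ... | α , β , on , off | yes old | _ = α , β ,
        (λ { a′ b′ e (here refl) → on a′ b′ e old ; a′ b′ e (there p) → on a′ b′ e p }) ,
        λ a′ b′ e n → off a′ b′ e (n ∘ there)
    ... | α , β , on , off | no _ | no ¬e = α , β ,
        (λ { a′ b′ e (here refl) → ⊥-elim (¬e e) ; a′ b′ e (there p) → on a′ b′ e p }) ,
        λ a′ b′ e n → off a′ b′ e (n ∘ there)
    ... | α , β , on , off | no new | yes e₀ with θ a b in θab | cut v a b e₀
    ... | false | _ = α , β ,
        (λ { a′ b′ e (here refl) → trans (off a′ b′ e new) (sym θab) ; a′ b′ e (there p) → on a′ b′ e p }) ,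
        λ a′ b′ e n → off a′ b′ e (n ∘ there)
    ... | true | χ⁻ , χ⁺ , jump , equal = (λ a → α a xor χ⁻ a) , (λ b → β b xor χ⁺ b) ,
        (λ { a′ b′ e (here refl) → trans (regroup a′ b′)
               (trans (cong₂ _xor_ (off a′ b′ e new) (xor-≢ jump)) (sym θab))
           ; a′ b′ e (there p) → trans (unchanged a′ b′ e λ { (refl , refl) → new p }) (on a′ b′ e p) }) ,
        λ a′ b′ e n → trans (unchanged a′ b′ e λ { (refl , refl) → n (here refl) }) (off a′ b′ e (n ∘ there))
      where
      regroup : ∀ a′ b′ → (α a′ xor χ⁻ a′) xor (β b′ xor χ⁺ b′) ≡ (α a′ xor β b′) xor (χ⁻ a′ xor χ⁺ b′)
      regroup a′ b′ = solve 4 (λ x y z t → (x :+ y) :+ (z :+ t) := (x :+ z) :+ (y :+ t)) refl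
                        (α a′) (χ⁻ a′) (β b′) (χ⁺ b′)
        where open xor-∧-Solver
      unchanged : ∀ a′ b′ → a′ ∷ v ∷ʳ b′ ∈ L → ¬ (a′ ≡ a × b′ ≡ b) →
                  (α a′ xor χ⁻ a′) xor (β b′ xor χ⁺ b′) ≡ α a′ xor β b′
      unchanged a′ b′ e ne = trans (regroup a′ b′)
        (trans (cong ((α a′ xor β b′) xor_) (xor-≡ (equal a′ b′ e ne))) (xor-identityʳ _))

  module _ {w : List A} (w∈L : w ∈ L) (f : List A → Bool) where

    -- The leaves of the tree of words pruned at the first occurrence of w.
    Leaf : List A → Set
    Leaf ℓ = ℓ ≡ first w ℓ ++ w

    leaf-contains : ∀ {ℓ} → Leaf ℓ → Contains w ℓ
    leaf-contains {ℓ} leaf = first w ℓ , [] , trans leaf (cong (first w ℓ ++_) (sym (++-identityʳ w)))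

    leaf-take : ∀ n {ℓ} → Leaf ℓ → Contains w (take n ℓ) → drop n ℓ ≡ []
    leaf-take n {ℓ} leaf (x , y , e) = ++-conicalʳ y (drop n ℓ)
      (first-least w ℓ (leaf-contains leaf) x (begin
        first w ℓ ++ w                 ≡⟨ leaf ⟨
        ℓ                              ≡⟨ take++drop≡id n ℓ ⟨
        take n ℓ ++ drop n ℓ           ≡⟨ cong (_++ drop n ℓ) e ⟩
        (x ++ w ++ y) ++ drop n ℓ      ≡⟨ ++-assoc x (w ++ y) (drop n ℓ) ⟩
        x ++ (w ++ y) ++ drop n ℓ      ≡⟨ cong (x ++_) (++-assoc w y (drop n ℓ)) ⟩
        x ++ w ++ y ++ drop n ℓ        ∎))
      where open ≡.≡-Reasoning

    -- For a leaf ℓ with a ℓ ∈ L, source a ℓ is the leaf that is a prefix of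
    -- a ℓ; reading a costs f r if this completes a return word r.
    source : A → List A → List A
    source a ℓ with em {P = Prefix w (a ∷ ℓ)}
    ... | yes _ = w
    ... | no _ = a ∷ ℓ

    cost : A → List A → Bool
    cost a ℓ with em {P = Prefix w (a ∷ ℓ)}
    ... | yes _ = f (a ∷ first w ℓ)
    ... | no _ = false

    -- The two sources may differ only if w begins a ℓ but is longer than a followed by n letters of
    -- ℓ; this shorter word is then a prefix of w, so the first n + 1 letters agree.
    source-take : ∀ n a ℓ → take (suc n) (source a ℓ) ≡ take (suc n) (source a (take n ℓ))
    source-take n a ℓ with em {P = Prefix w (a ∷ ℓ)} | em {P = Prefix w (a ∷ take n ℓ)}
    ... | yes _ | yes _ = refl
    ... | no _ | no _ = cong (a ∷_) (sym (trans (take-take n n ℓ) (cong (λ k → take k ℓ) (⊓-idem n))))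
    ... | no n′ | yes p = ⊥-elim (n′ (subst (λ ℓ → Prefix w (a ∷ ℓ))
            (take++drop≡id n ℓ) (prefix-++ (drop n ℓ) p)))
    ... | yes p@(q , e) | no n′ with ≤-total (length (a ∷ take n ℓ)) (length w)
    ... | inj₂ le = ⊥-elim (n′ (prefix-of-prefix p
            (drop n ℓ , cong (a ∷_) (sym (take++drop≡id n ℓ))) le))
    ... | inj₁ le with prefix-of-prefix (drop n ℓ , cong (a ∷_) (sym (take++drop≡id n ℓ))) p le
    ... | r , refl = trans (take-sandwich (suc n) (a ∷ take n ℓ) r q
            (cong (take (suc n)) (trans (sym (++-assoc (a ∷ take n ℓ) r q)) (sym e))))
          (cong (a ∷_) (sym (trans (take-take n n ℓ) (cong (λ k → take k ℓ) (⊓-idem n)))))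

    -- The cost is cohomologous to a function depending on n letters of ℓ.
    Truncated : ℕ → Set
    Truncated n = Σ[ θ ∈ (A → List A → Bool) ] Σ[ k ∈ (List A → Bool) ] (∀ a ℓ → Leaf ℓ → a ∷ ℓ ∈ L →
      cost a ℓ ≡ θ a (take n ℓ) xor (k (source a ℓ) xor k ℓ))

    -- On a prefix u b with n + 1 letters, acyclicity at u splits θ into `α u a` and `β u b`. The
    -- second term depends on ℓ alone and goes into the coboundary, at the price of the same term at
    -- `source a ℓ`, which involves only n letters of ℓ.
    truncate : ∀ n → Truncated (suc n) → Truncated n
    truncate n (θ , k , eq) = θ′ , k′ , eq′
      where
      α : List A → A → Bool
      α u = proj₁ (edge-potential u (λ a b → θ a (u ∷ʳ b)))
      β : List A → A → Bool
      β u = proj₁ (proj₂ (edge-potential u (λ a b → θ a (u ∷ʳ b))))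
      αβ : ∀ u a b → a ∷ u ∷ʳ b ∈ L → θ a (u ∷ʳ b) ≡ α u a xor β u b
      αβ u = proj₂ (proj₂ (edge-potential u (λ a b → θ a (u ∷ʳ b))))
      head-β : List A → List A → Bool
      head-β u [] = false
      head-β u (b ∷ _) = β u b
      β̂ : List A → Bool
      β̂ ℓ = head-β (take n ℓ) (drop n ℓ)
      β̂-take : ∀ t → β̂ t ≡ β̂ (take (suc n) t)
      β̂-take t = combine (take-prefix n t) (head-drop n t)
        where
        take-prefix : ∀ n (t : List A) → take n t ≡ take n (take (suc n) t)
        take-prefix zero t = refl
        take-prefix (suc n) [] = refl
        take-prefix (suc n) (x ∷ t) = cong (x ∷_) (take-prefix n t)
        head-drop : ∀ n (t : List A) → ∀ u → head-β u (drop n t) ≡ head-β u (drop n (take (suc n) t))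
        head-drop zero [] u = refl
        head-drop zero (x ∷ t) u = refl
        head-drop (suc n) [] u = refl
        head-drop (suc n) (x ∷ t) u = head-drop n t u
        combine : take n t ≡ take n (take (suc n) t) →
                 (∀ u → head-β u (drop n t) ≡ head-β u (drop n (take (suc n) t))) →
                 β̂ t ≡ β̂ (take (suc n) t)
        combine e h = trans (h (take n t)) (cong (λ u → head-β u (drop n (take (suc n) t))) e)
      -- If u already contains w, the leaf ends within u: there is no further letter to split off,
      -- and `β̂` is `false`.
      residue : A → List A → Bool
      residue a u with em {P = Contains w u}
      ... | yes _ = θ a u
      ... | no _ = α u a
      θ′ : A → List A → Bool
      θ′ a u = residue a u xor β̂ (source a u)
      k′ : List A → Bool
      k′ ℓ = k ℓ xor β̂ ℓ
      residue-eq : ∀ a ℓ → Leaf ℓ → a ∷ ℓ ∈ L → θ a (take (suc n) ℓ) ≡ residue a (take n ℓ) xor β̂ ℓ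
      residue-eq a ℓ leaf aℓ with drop n ℓ in eq-d | em {P = Contains w (take n ℓ)}
      ... | [] | yes _ = trans (cong (θ a) (trans (take-suc-[] n ℓ eq-d) (sym (take-drop-[] n ℓ eq-d))))
              (sym (xor-identityʳ _))
      ... | [] | no ¬c = ⊥-elim (¬c (subst (Contains w) (sym (take-drop-[] n ℓ eq-d)) (leaf-contains leaf)))
      ... | b ∷ q | yes c = case trans (sym eq-d) (leaf-take n leaf c) of λ ()
      ... | b ∷ q | no _ = trans (cong (θ a) (take-suc-∷ n ℓ eq-d))
              (αβ (take n ℓ) a b (prefix-∈ (q , cong (a ∷_) (begin
                ℓ                          ≡⟨ take++drop≡id n ℓ ⟨
                take n ℓ ++ drop n ℓ       ≡⟨ cong (take n ℓ ++_) eq-d ⟩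
                take n ℓ ++ b ∷ q          ≡⟨ ++-assoc (take n ℓ) _ q ⟨
                (take n ℓ ∷ʳ b) ++ q       ∎)) aℓ))
        where open ≡.≡-Reasoning
      eq′ : ∀ a ℓ → Leaf ℓ → a ∷ ℓ ∈ L →
            cost a ℓ ≡ θ′ a (take n ℓ) xor (k′ (source a ℓ) xor k′ ℓ)
      eq′ a ℓ leaf aℓ = begin
        cost a ℓ                                                   ≡⟨ eq a ℓ leaf aℓ ⟩
        θ a (take (suc n) ℓ) xor (k (source a ℓ) xor k ℓ)
          ≡⟨ cong (_xor (k (source a ℓ) xor k ℓ)) (residue-eq a ℓ leaf aℓ) ⟩
        (residue a (take n ℓ) xor β̂ ℓ) xor (k (source a ℓ) xor k ℓ)
          ≡⟨ solve 5 (λ r b s k k′ → (r :+ b) :+ (k :+ k′) := (r :+ s) :+ ((k :+ s) :+ (k′ :+ b))) refl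
               (residue a (take n ℓ)) (β̂ ℓ) (β̂ (source a ℓ)) (k (source a ℓ)) (k ℓ) ⟩
        (residue a (take n ℓ) xor β̂ (source a ℓ)) xor (k′ (source a ℓ) xor k′ ℓ)
          ≡⟨ cong (λ s → (residue a (take n ℓ) xor s) xor (k′ (source a ℓ) xor k′ ℓ)) (begin
               β̂ (source a ℓ)                              ≡⟨ β̂-take (source a ℓ) ⟩
               β̂ (take (suc n) (source a ℓ))               ≡⟨ cong β̂ (source-take n a ℓ) ⟩
               β̂ (take (suc n) (source a (take n ℓ)))      ≡⟨ β̂-take (source a (take n ℓ)) ⟨
               β̂ (source a (take n ℓ))                     ∎) ⟩
        θ′ a (take n ℓ) xor (k′ (source a ℓ) xor k′ ℓ)             ∎
        where
        open ≡.≡-Reasoning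
        open xor-∧-Solver

    truncated : ∀ n → Truncated n → Truncated 0
    truncated zero t = t
    truncated (suc n) t = truncated n (truncate n t)

    start : Truncated (proj₁ (recurrent w∈L))
    -- By recurrence the first N letters of a longer leaf would contain w, so a leaf has at most N
    -- letters and the cost is already truncated.
    start = cost , (λ _ → false) , λ a ℓ leaf aℓ → trans
      (cong (cost a) (sym (take-drop-[] N ℓ (whole a leaf aℓ)))) (sym (xor-identityʳ _))
      where
      N = proj₁ (recurrent w∈L)
      whole : ∀ a {ℓ} → Leaf ℓ → a ∷ ℓ ∈ L → drop N ℓ ≡ []
      whole a {ℓ} leaf aℓ with drop N ℓ in e
      ... | [] = refl
      ... | b ∷ q = trans (sym e) (leaf-take N leaf (proj₂ (recurrent w∈L)
            (prefix-∈ (drop N ℓ , sym (take++drop≡id N ℓ)) (factorˡ (a ∷ []) aℓ))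
            (≤-reflexive (sym (trans (length-take N ℓ) (m≤n⇒m⊓n≡m le))))))
        where
        le : N ≤ length ℓ
        le = ≮⇒≥ λ lt → case trans (sym e) (drop-all N ℓ (<⇒≤ lt)) of λ ()

    private
      θ₀ = proj₁ (truncated (proj₁ (recurrent w∈L)) start)
      k₀ = proj₁ (proj₂ (truncated (proj₁ (recurrent w∈L)) start))
      eq₀ = proj₂ (proj₂ (truncated (proj₁ (recurrent w∈L)) start))

    λ′ : A → Bool
    λ′ a = θ₀ a []

    OnlySuffix : List A → Set
    OnlySuffix s = ∀ x {y} → s ++ w ≡ x ++ w ++ y → y ≡ []

    only-suffix-miss : ∀ {a s} → OnlySuffix (a ∷ s) → ¬ Prefix w (a ∷ s ++ w)
    only-suffix-miss {a} {s} o (y , e) with refl ← o [] e =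
      <-irrefl (sym (trans (cong length e) (cong length (++-identityʳ w))))
        (s≤s (≤-trans (m≤n+m (length w) (length s)) (≤-reflexive (sym (length-++ s)))))

    only-suffix-leaf : ∀ {s} → OnlySuffix s → first w (s ++ w) ≡ s
    only-suffix-leaf {[]} o = first-self w
    only-suffix-leaf {a ∷ s} o = trans (first-miss (only-suffix-miss o))
      (cong (a ∷_) (only-suffix-leaf λ x e → o (a ∷ x) (cong (a ∷_) e)))

    -- No return word is completed before the end, so each letter has zero cost and its weight is a
    -- difference of values of `k₀`; the sum telescopes.
    weight-leaf : ∀ s → OnlySuffix s → s ++ w ∈ L → weight λ′ s ≡ k₀ (s ++ w) xor k₀ w
    weight-leaf [] o _ = sym (xor-same (k₀ w))
    weight-leaf (a ∷ s) o asw = begin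
      λ′ a xor weight λ′ s
        ≡⟨ cong (λ′ a xor_) (weight-leaf s o′ (factorˡ (a ∷ []) asw)) ⟩
      λ′ a xor (k₀ (s ++ w) xor k₀ w)
        ≡⟨ solve 4 (λ x y z t → x :+ (y :+ z) := (x :+ (t :+ y)) :+ (t :+ z)) refl
             (λ′ a) (k₀ (s ++ w)) (k₀ w) (k₀ (a ∷ s ++ w)) ⟩
      (λ′ a xor (k₀ (a ∷ s ++ w) xor k₀ (s ++ w))) xor (k₀ (a ∷ s ++ w) xor k₀ w)
        ≡⟨ cong (_xor (k₀ (a ∷ s ++ w) xor k₀ w)) (sym no-cost) ⟩
      k₀ (a ∷ s ++ w) xor k₀ w ∎
      where
      open ≡.≡-Reasoning
      open xor-∧-Solver
      o′ : OnlySuffix s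
      o′ x e = o (a ∷ x) (cong (a ∷_) e)
      no-cost : false ≡ λ′ a xor (k₀ (a ∷ s ++ w) xor k₀ (s ++ w))
      no-cost with eq₀ a (s ++ w) (cong (_++ w) (sym (only-suffix-leaf o′))) asw
      ... | e with em {P = Prefix w (a ∷ s ++ w)}
      ... | yes p = ⊥-elim (only-suffix-miss o p)
      ... | no _ = e

    -- The letter a completes the return word: its cost is f of this word and its source is w, which
    -- closes the telescoping sum.
    weight-return : ∀ r → Return L w r → weight λ′ r ≡ f r
    weight-return [] (ne , _) = ⊥-elim (ne refl)
    weight-return (a ∷ s) (_ , rw , pre , only) = begin
      λ′ a xor weight λ′ s                  ≡⟨ cong (λ′ a xor_) (weight-leaf s o (factorˡ (a ∷ []) rw)) ⟩
      λ′ a xor (k₀ (s ++ w) xor k₀ w)       ≡⟨ cong (λ′ a xor_) (xor-comm (k₀ (s ++ w)) (k₀ w)) ⟩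
      λ′ a xor (k₀ w xor k₀ (s ++ w))       ≡⟨ return-cost ⟨
      f (a ∷ s)                             ∎
      where
      open ≡.≡-Reasoning
      o : OnlySuffix s
      o x {[]} e = refl
      o x {b ∷ y} e = ⊥-elim (only (a ∷ x , b ∷ y , (λ ()) , (λ ()) , cong (a ∷_) e))
      return-cost : f (a ∷ s) ≡ λ′ a xor (k₀ w xor k₀ (s ++ w))
      return-cost with eq₀ a (s ++ w) (cong (_++ w) (sym (only-suffix-leaf o))) rw
      ... | e with em {P = Prefix w (a ∷ s ++ w)}
      ... | yes p = trans (cong (λ s → f (a ∷ s)) (sym (only-suffix-leaf o))) e
      ... | no n = ⊥-elim (n pre)

  return-weights : ∀ {w} → w ∈ L → (f : List A → Bool) → ∃[ λ′ ] (∀ r → Return L w r → weight λ′ r ≡ f r)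
  return-weights w∈L f = λ′ w∈L f , weight-return w∈L f

-- Recurrence of minimal shift spaces

open import Data.Integer.Base using (ℤ; +_; -[1+_]; _⊖_)



applyUpTo-cong : {B : Set} {f g : ℕ → B} → ∀ n → (∀ k → k < n → f k ≡ g k) → applyUpTo f n ≡ applyUpTo g n
applyUpTo-cong zero e = refl
applyUpTo-cong (suc n) e = cong₂ _∷_ (e 0 (s≤s z≤n)) (applyUpTo-cong n λ k k<n → e (suc k) (s≤s k<n))

applyUpTo-injective : {B : Set} {f g : ℕ → B} → ∀ {n m} →
                      applyUpTo f n ≡ applyUpTo g m → ∀ k → k < n → f k ≡ g k
applyUpTo-injective {n = suc n} {suc m} e zero _ = ∷-injectiveˡ e
applyUpTo-injective {n = suc n} {suc m} e (suc k) (s≤s k<n) =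
  applyUpTo-injective {n = n} {m} (∷-injectiveʳ e) k k<n

applyUpTo-prefix : {B : Set} (f : ℕ → B) (v w : List B) {n : ℕ} →
                   v ++ w ≡ applyUpTo f n → v ≡ applyUpTo f (length v)
applyUpTo-prefix f [] w e = refl
applyUpTo-prefix f (x ∷ v) w {suc n} e =
  cong₂ _∷_ (∷-injectiveˡ e) (applyUpTo-prefix (f ∘ suc) v w (∷-injectiveʳ e))

applyUpTo-suffix : {B : Set} (f : ℕ → B) (u v : List B) {n : ℕ} → u ++ v ≡ applyUpTo f n →
                   v ≡ applyUpTo (λ k → f (length u + k)) (length v)
applyUpTo-suffix f [] v {n} e =
  trans e (cong (applyUpTo f) (trans (sym (length-applyUpTo f n)) (cong length (sym e))))
applyUpTo-suffix f (x ∷ u) v {suc n} e = applyUpTo-suffix (f ∘ suc) u v (∷-injectiveʳ e)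

applyUpTo-++ : {B : Set} (f : ℕ → B) (m n : ℕ) →
               applyUpTo f (m + n) ≡ applyUpTo f m ++ applyUpTo (λ k → f (m + k)) n
applyUpTo-++ f zero n = refl
applyUpTo-++ f (suc m) n = cong (f 0 ∷_) (applyUpTo-++ (f ∘ suc) m n)

applyUpTo-factor : {B : Set} (f : ℕ → B) {s n m : ℕ} → s + n ≤ m →
                   Contains (applyUpTo (λ k → f (s + k)) n) (applyUpTo f m)
applyUpTo-factor f {s} {n} {m} le = applyUpTo f s , applyUpTo (λ k → f (s + (n + k))) (m ∸ (s + n)) , (begin
  applyUpTo f m                                   ≡⟨ cong (applyUpTo f) (m+[n∸m]≡n le) ⟨
  applyUpTo f (s + n + (m ∸ (s + n)))             ≡⟨ cong (applyUpTo f) (+-assoc s n _) ⟩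
  applyUpTo f (s + (n + (m ∸ (s + n))))           ≡⟨ applyUpTo-++ f s _ ⟩
  applyUpTo f s ++ applyUpTo (λ k → f (s + k)) (n + (m ∸ (s + n)))
    ≡⟨ cong (applyUpTo f s ++_) (applyUpTo-++ (λ k → f (s + k)) n _) ⟩
  _                                               ∎)
  where open ≡.≡-Reasoning

factorAt : {A : Set} → (ℤ → A) → ℤ → ℕ → List A
factorAt x i n = applyUpTo (λ k → x (i ℤ.+ + k)) n

module _ {A : Set} (X : ShiftSpace A) where
  open ShiftSpace X using (closed; invariant)

  language-factorial : Factorial (Language X)
  language-factorial u {v} w (x , x∈X , i , n , e) =
    x , x∈X , i ℤ.+ + length u , length v ,
    trans (applyUpTo-prefix _ v w {length (v ++ w)} (applyUpTo-suffix _ u (v ++ w) {n} e))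
      (applyUpTo-cong (length v) λ k _ → cong x (sym (ℤ.+-assoc i (+ length u) (+ k))))

  language-extendʳ : ∀ {u} → u ∈ Language X → ∃[ b ] u ∷ʳ b ∈ Language X
  language-extendʳ (x , x∈X , i , n , e) =
    x (i ℤ.+ + n) , x , x∈X , i , suc n ,
    trans (cong (_∷ʳ x (i ℤ.+ + n)) e) (applyUpTo-∷ʳ (λ k → x (i ℤ.+ + k)) n)

  language-extendˡ : ∀ {u} → u ∈ Language X → ∃[ a ] a ∷ u ∈ Language X
  language-extendˡ (x , x∈X , i , n , e) =
    x (ℤ.pred i ℤ.+ + 0) , x , x∈X , ℤ.pred i , suc n ,
    cong (x (ℤ.pred i ℤ.+ + 0) ∷_) (trans e (applyUpTo-cong n λ k _ → cong x (position i (+ k))))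
    where
    open +-*-Solver
    position : ∀ i k → i ℤ.+ k ≡ ℤ.pred i ℤ.+ (+ 1 ℤ.+ k)
    position = solve 2 (λ i k → i :+ k := (con ℤ.-1ℤ :+ i) :+ (con (+ 1) :+ k)) refl

  -- Closedness makes membership depend on the coordinates only, in place of function
  -- extensionality.
  pointwise : ∀ {x y} → x ∈ Points X → (∀ i → x i ≡ y i) → y ∈ Points X
  pointwise {x} x∈X e = closed λ I → x , x∈X , All.tabulate λ {i} _ → e i

  translate-forth : ∀ n {x} → x ∈ Points X → (λ j → x (+ n ℤ.+ j)) ∈ Points X
  translate-forth zero {x} x∈X = pointwise x∈X λ i → cong x (sym (ℤ.+-identityˡ i))
  translate-forth (suc n) {x} x∈X =
    pointwise (translate-forth n (Equivalence.to (invariant x) x∈X)) λ i →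
      cong x (sym (ℤ.+-assoc (+ 1) (+ n) i))

  translate-back : ∀ n {x} → x ∈ Points X → (λ j → x (ℤ.- (+ n) ℤ.+ j)) ∈ Points X
  translate-back zero {x} x∈X = pointwise x∈X λ i → cong x (sym (ℤ.+-identityˡ i))
  translate-back (suc n) {x} x∈X =
    pointwise (translate-back n (Equivalence.from (invariant (x ∘ ℤ.pred))
        (pointwise x∈X λ i → cong x (sym (ℤ.pred-suc i))))) λ i →
      cong x (trans (sym (ℤ.+-assoc ℤ.-1ℤ (ℤ.- + n) i))
        (cong (ℤ._+ i) (sym (ℤ.neg-distrib-+ (+ 1) (+ n)))))

  translate : ∀ m {x} → x ∈ Points X → (λ j → x (m ℤ.+ j)) ∈ Points X
  translate (+ n) = translate-forth n
  translate -[1+ n ] = translate-back (suc n)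

  avoiding : List A → ShiftSpace A
  avoiding w = record
    { Points = λ x → x ∈ Points X × (∀ i → w ≢ factorAt x i (length w))
    ; closed = λ {x} adh →
        closed (λ I → let y , (y∈X , _) , agree = adh I in y , y∈X , agree) ,
        -- `factorAt id` lists the coordinates covered by the supposed occurrence of w, the only
        -- ones on which the approximating point must agree.
        λ i e → let y , (_ , avoid) , agree = adh (factorAt id i (length w)) in
          avoid i (trans e (agreement i (length w) x y agree))
    ; invariant = λ x → mk⇔
        (λ (x∈X , avoid) → Equivalence.to (invariant x) x∈X , λ i e → avoid (ℤ.suc i)
          (trans e (applyUpTo-cong (length w) λ k _ → cong x (sym (ℤ.+-assoc (+ 1) i (+ k))))))
        (λ (sx∈X , avoid) → Equivalence.from (invariant x) sx∈X , λ i e → avoid (ℤ.pred i)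
          (trans e (applyUpTo-cong (length w) λ k _ → cong x (back i (+ k)))))
    }
    where
    agreement : ∀ i n x y → All (λ j → y j ≡ x j) (factorAt id i n) → factorAt x i n ≡ factorAt y i n
    agreement i n x y = go (λ k → i ℤ.+ + k) n
      where
      go : ∀ p n → All (λ j → y j ≡ x j) (applyUpTo p n) → applyUpTo (x ∘ p) n ≡ applyUpTo (y ∘ p) n
      go p zero _ = refl
      go p (suc n) (e ∷ es) = cong₂ _∷_ (sym e) (go (p ∘ suc) n es)
    open +-*-Solver
    back : ∀ i k → i ℤ.+ k ≡ ℤ.suc (ℤ.pred i ℤ.+ k)
    back = solve 2 (λ i k → i :+ k := con (+ 1) :+ ((con ℤ.-1ℤ :+ i) :+ k)) refl

  module Compactness (em : ExcludedMiddle 0ℓ) {d : ℕ} (A↔ : A ↔ Fin d) (w : List A)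
    (long-avoiding : ∀ N → ∃[ u ] u ∈ Language X × N ≤ length u × ¬ Contains w u) where
    open Inverse A↔ using (to; from; strictlyInverseʳ)

    Extendable : List A → Set
    Extendable u = ∀ N → ∃[ p ] ∃[ q ] N ≤ length p × N ≤ length q ×
      p ++ u ++ q ∈ Language X × ¬ Contains w (p ++ u ++ q)

    extendable-[] : Extendable []
    extendable-[] N with long-avoiding (N + N)
    ... | u , u∈L , le , avoid = take N u , drop N u ,
        ≤-reflexive (sym (trans (length-take N u) (m≤n⇒m⊓n≡m (≤-trans (m≤m+n N N) le)))) ,
        subst (N ≤_) (sym (length-drop N u)) (subst (_≤ length u ∸ N) (m+n∸n≡m N N) (∸-monoˡ-≤ N le)) ,
        subst (_∈ Language X) (sym (take++drop≡id N u)) u∈L ,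
        avoid ∘ subst (Contains w) (take++drop≡id N u)

    bound : (g : A → A → ℕ) → ∃[ M ] (∀ a b → g a b ≤ M)
    bound g = total M , λ a b → subst₂ (λ a′ b′ → g a′ b′ ≤ total M) (strictlyInverseʳ a) (strictlyInverseʳ b)
      (≤-trans (≤-total-at (λ j → g (from (to a)) (from j)) (to b)) (≤-total-at M (to a)))
      where
      M = λ i → total λ j → g (from i) (from j)

    -- Kőnig's lemma: otherwise every extension fails at some length, and
    -- the finitely many lengths are bounded.
    extend : ∀ {u} → Extendable u → ∃[ a ] ∃[ b ] Extendable (a ∷ u ∷ʳ b)
    extend {u} ext with em {P = ∃[ a ] ∃[ b ] Extendable (a ∷ u ∷ʳ b)}
    ... | yes p = p
    ... | no none = ⊥-elim (impossible (ext (suc M)))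
      where
      Fits : ℕ → A → A → Set
      Fits N a b = ∃[ p ] ∃[ q ] N ≤ length p × N ≤ length q ×
        p ++ (a ∷ u ∷ʳ b) ++ q ∈ Language X × ¬ Contains w (p ++ (a ∷ u ∷ʳ b) ++ q)
      fails : ∀ a b → ∃[ N ] ¬ Fits N a b
      fails a b with em {P = ∃[ N ] ¬ Fits N a b}
      ... | yes p = p
      ... | no n = ⊥-elim (none (a , b , λ N → case em {P = Fits N a b} of λ
              { (yes p) → p ; (no ¬p) → ⊥-elim (n (N , ¬p)) }))
      M = proj₁ (bound λ a b → proj₁ (fails a b))
      M≥ = proj₂ (bound λ a b → proj₁ (fails a b))
      impossible : ¬ (∃[ p ] ∃[ q ] suc M ≤ length p × suc M ≤ length q ×
        p ++ u ++ q ∈ Language X × ¬ Contains w (p ++ u ++ q))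
      impossible (p , b ∷ q , le , s≤s le′ , word , avoid) with initLast p
      ... | p′ ∷ʳ′ a = proj₂ (fails a b) (p′ , q ,
          ≤-trans (M≥ a b) (≤-pred (subst (suc M ≤_) (trans (length-++ p′) (+-comm (length p′) 1)) le)) ,
          ≤-trans (M≥ a b) le′ ,
          subst (_∈ Language X) regroup word , avoid ∘ subst (Contains w) (sym regroup))
        where
        regroup : (p′ ∷ʳ a) ++ u ++ b ∷ q ≡ p′ ++ (a ∷ u ∷ʳ b) ++ q
        regroup = trans (++-assoc p′ _ (u ++ b ∷ q))
          (cong (λ t → p′ ++ a ∷ t) (sym (++-assoc u _ q)))

    approximation : ℕ → ∃ Extendable
    approximation zero = [] , extendable-[]
    approximation (suc k) = let u , ext = approximation k
                                a , b , ext′ = extend ext in a ∷ u ∷ʳ b , ext′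

    word : ℕ → List A
    word k = proj₁ (approximation k)

    -- Stage k adds a letter at -k-1 and one at k, so that `word k` occupies the window [-k , k).
    limit : ℤ → A
    limit (+ k) = proj₁ (proj₂ (extend (proj₂ (approximation k))))
    limit -[1+ k ] = proj₁ (extend (proj₂ (approximation k)))

    word-limit : ∀ k → word k ≡ applyUpTo (λ t → limit (t ⊖ k)) (k + k)
    word-limit zero = refl
    word-limit (suc k) rewrite +-suc k k = cong (limit -[1+ k ] ∷_) (begin
      word k ∷ʳ limit (+ k)
        ≡⟨ cong₂ _∷ʳ_ (word-limit k) (cong limit last-position) ⟩
      applyUpTo (λ t → limit (t ⊖ k)) (k + k) ∷ʳ limit ((k + k) ⊖ k)
        ≡⟨ applyUpTo-∷ʳ (λ t → limit (t ⊖ k)) (k + k) ⟩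
      applyUpTo (λ t → limit (t ⊖ k)) (suc (k + k))
        ≡⟨ applyUpTo-cong (suc (k + k)) (λ t _ → cong limit (sym (ℤ.[1+m]⊖[1+n]≡m⊖n t k))) ⟩
      applyUpTo (λ t → limit (suc t ⊖ suc k)) (suc (k + k)) ∎)
      where
      open ≡.≡-Reasoning
      last-position : + k ≡ (k + k) ⊖ k
      last-position = sym (trans (ℤ.⊖-≥ (m≤n+m k k)) (cong +_ (m+n∸n≡m k k)))

    word-avoids : ∀ k → ¬ Contains w (word k)
    word-avoids k (x , y , e) with proj₂ (approximation k) 0
    ... | p , q , _ , _ , _ , avoid = avoid (p ++ x , y ++ q , (begin
      p ++ word k ++ q            ≡⟨ cong (λ u → p ++ u ++ q) e ⟩
      p ++ (x ++ w ++ y) ++ q     ≡⟨ cong (p ++_) (++-assoc x (w ++ y) q) ⟩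
      p ++ x ++ (w ++ y) ++ q     ≡⟨ cong (λ u → p ++ x ++ u) (++-assoc w y q) ⟩
      p ++ x ++ w ++ y ++ q       ≡⟨ ++-assoc p x _ ⟨
      (p ++ x) ++ w ++ y ++ q     ∎))
      where open ≡.≡-Reasoning

    word-∈ : ∀ k → word k ∈ Language X
    word-∈ k with proj₂ (approximation k) 0
    ... | p , q , _ , _ , pq , _ = language-factorial p q pq

    -- The numbers t ⊖ k with t < 2k form the window [-k , k).
    window : ∀ i n → ∃[ k ] ∃[ t ] i ≡ t ⊖ k × t + n ≤ k + k
    window (+ m) n = m + n , m + (m + n) ,
      sym (trans (ℤ.⊖-≥ (m≤n+m (m + n) m)) (cong +_ (m+n∸n≡m m (m + n)))) ,
      ≤-reflexive (trans (cong (_+ n) (+-comm m (m + n))) (+-assoc (m + n) m n))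
    window -[1+ m ] n = suc m + n , n , sym (trans (ℤ.⊖-< {n} (s≤s (m≤n+m n m)))
      (cong (ℤ.-_ ∘ +_) (m+n∸n≡m (suc m) n))) ,
      +-mono-≤ (m≤n+m n (suc m)) (m≤n+m n (suc m))

    windows : ∀ (I : List ℤ) → ∃[ k ] All (λ i → ∃[ t ] i ≡ t ⊖ k × t < k + k) I
    windows [] = 0 , []
    windows (i ∷ I) with window i 1 | windows I
    ... | k , t , e , lt | l , all = k + l ,
        (t + l , trans e (shift-window t k l) , widen t k l (subst (_≤ k + k) (+-comm t 1) lt)) ∷
        All.map (λ { (t , e , lt) → t + k ,
          trans e (trans (shift-window t l k) (cong ((t + k) ⊖_) (+-comm l k))) ,
          subst (t + k <_) (cong (λ m → m + m) (+-comm l k)) (widen t l k lt) }) all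
      where
      shift-window : ∀ t k l → t ⊖ k ≡ (t + l) ⊖ (k + l)
      shift-window t k l = sym (trans (cong₂ _⊖_ (+-comm t l) (+-comm k l)) (ℤ.+-cancelˡ-⊖ l t k))
      widen : ∀ t k l → t < k + k → t + l < (k + l) + (k + l)
      widen t k l lt = <-≤-trans (+-monoˡ-< l lt)
        (≤-trans (+-monoˡ-≤ l (+-monoʳ-≤ k (m≤m+n k l))) (≤-reflexive (rearrange k l)))
        where
        rearrange : ∀ k l → k + (k + l) + l ≡ (k + l) + (k + l)
        rearrange k l = trans (+-assoc k (k + l) l) (trans (cong (λ m → k + m) (+-comm (k + l) l))
          (sym (+-assoc k l (k + l))))

    limit-∈ : limit ∈ Points X
    limit-∈ = closed approximate
      where
      approximate : Adherent (Points X) limit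
      approximate I with windows I
      ... | k , all with word-∈ k
      -- Translation by i + k moves the occurrence of `word k` from i to -k.
      ... | x , x∈X , i , n , e = (λ j → x ((i ℤ.+ + k) ℤ.+ j)) , translate (i ℤ.+ + k) x∈X ,
          All.map (λ { (t , refl , lt) → trans (cong x (position i k t))
            (sym (applyUpTo-injective {n = k + k} {n} (trans (sym (word-limit k)) e) t lt)) }) all
        where
        position : ∀ i k t → (i ℤ.+ + k) ℤ.+ (t ⊖ k) ≡ i ℤ.+ + t
        position i k t = trans (cong (λ z → (i ℤ.+ + k) ℤ.+ z) (sym (ℤ.m-n≡m⊖n t k)))
          (solve 3 (λ i k t → (i :+ k) :+ (t :+ (:- k)) := i :+ t) refl i (+ k) (+ t))
          where open +-*-Solver

    limit-avoids : ∀ i → w ≢ factorAt limit i (length w)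
    limit-avoids i e with window i (length w)
    ... | k , t , refl , le = word-avoids k (subst₂ Contains (sym (trans e
        (applyUpTo-cong (length w) λ s _ → cong limit (ℤ.distribˡ-⊖-+-pos s t k)))) (sym (word-limit k))
        (applyUpTo-factor (λ t → limit (t ⊖ k)) le))

    avoiding-inhabited : ∃ (Points (avoiding w))
    avoiding-inhabited = limit , limit-∈ , limit-avoids

  -- If arbitrarily long words avoid w, compactness yields a point avoiding w. By minimality every
  -- point of X then avoids w, including one in which w occurs.
  minimal-recurrent : ExcludedMiddle 0ℓ → ∀ {d} → A ↔ Fin d → IsMinimal X → ∀ {w} → w ∈ Language X →
    ∃[ N ] (∀ {u} → u ∈ Language X → N ≤ length u → Contains w u)
  minimal-recurrent em A↔ minimal {w} (x , x∈X , i , n , e)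
    with em {P = ∃[ N ] (∀ {u} → u ∈ Language X → N ≤ length u → Contains w u)}
  ... | yes p = p
  ... | no ¬p = ⊥-elim (proj₂ (minimal (avoiding w)
          (Compactness.avoiding-inhabited em A↔ w long-avoiding) proj₁ x∈X) i
          (trans e (cong (factorAt x i) (sym (trans (cong length e) (length-applyUpTo _ n))))))
    where
    long-avoiding : ∀ N → ∃[ u ] u ∈ Language X × N ≤ length u × ¬ Contains w u
    long-avoiding N with em {P = ∃[ u ] u ∈ Language X × N ≤ length u × ¬ Contains w u}
    ... | yes p = p
    ... | no none = ⊥-elim (¬p (N , λ {u} u∈L le → case em {P = Contains w u} of λ
            { (yes c) → c ; (no ¬c) → ⊥-elim (none (u , u∈L , le , ¬c)) }))

-- Extension graphs

module GraphProperties {V : Set} (em : ExcludedMiddle 0ℓ) (G : Graph V) where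
  open Graph G

  module _ (R : V → V → Set) where

    data SimplePath : V → List V → V → Set where
      [] : ∀ {v} → SimplePath v [] v
      _∷_ : ∀ {u x vs v} → R u x → SimplePath x vs v → SimplePath u (x ∷ vs) v

    cut-back : ∀ {x vs v u} → SimplePath x vs v → Unique (x ∷ vs) → u ∈ˡ x ∷ vs →
               ∃[ vs′ ] SimplePath u vs′ v × Unique (u ∷ vs′)
    cut-back p un (here refl) = _ , p , un
    cut-back (_ ∷ p) (_ ∷ un) (there i) = cut-back p un i

    erase-loops : ∀ {u v} → Star R u v → ∃[ vs ] SimplePath u vs v × Unique (u ∷ vs)
    erase-loops ε = [] , [] , [] ∷ []
    erase-loops {u} (r ◅ rs) with erase-loops rs
    ... | vs , p , un with em {P = u ∈ˡ _ ∷ vs}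
    ... | yes i = cut-back p un i
    ... | no n = _ , r ∷ p , All.tabulate (λ { i refl → n i }) ∷ un

  Without : V → V → V → V → Set
  Without u v x y = Adj x y × ¬ (x ≡ u × y ≡ v) × ¬ (x ≡ v × y ≡ u)

  -- A simple path from u to v avoiding the edge would close up to a cycle. It has at least two
  -- steps: no step would give u = v, and one step would be the deleted edge.
  acyclic-disconnects : ¬ Cycle G → ∀ {u v} → Adj u v → ¬ Star (Without u v) u v
  acyclic-disconnects acyclic {u} {v} uv walk with erase-loops (Without u v) walk
  ... | [] , [] , _ = irrefl refl uv
  ... | _ ∷ [] , (_ , ne , _) ∷ [] , _ = ne (refl , refl)
  ... | vs@(_ ∷ _ ∷ _) , p , un = acyclic (u , vs , s≤s (s≤s z≤n) , un , close p)
    where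
    close : ∀ {x vs} → SimplePath (Without u v) x vs v → Linked Adj (x ∷ vs ∷ʳ u)
    close [] = adj-sym uv ∷ [-]
    close ((xy , _) ∷ p) = xy ∷ close p

  -- A 2-colouring that changes across a single edge contradicts a cycle
  -- through this edge.
  cut⇒acyclic : (∀ {u v} → Adj u v → Σ[ χ ∈ (V → Bool) ] χ u ≢ χ v ×
                  (∀ {x y} → Without u v x y → χ x ≡ χ y)) → ¬ Cycle G
  cut⇒acyclic cuts (x , v ∷ vs , s≤s 1≤ , (x∉ ∷ un) , xv ∷ rest) with cuts xv
  ... | χ , jump , equal = jump (sym (first-step vs 1≤ un x∉ rest))
    where
    along : ∀ u vs → x ≢ u → v ≢ u → All (x ≢_) vs → All (v ≢_) vs → Linked Adj (u ∷ vs ∷ʳ x) → χ u ≡ χ x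
    along u [] x≢u v≢u _ _ (ux ∷ [-]) = equal (ux , (λ (e , _) → x≢u (sym e)) , λ (e , _) → v≢u (sym e))
    along u (u′ ∷ vs) x≢u v≢u (x≢u′ ∷ xs) (v≢u′ ∷ vs′) (uu′ ∷ l) = trans
      (equal (uu′ , (λ (e , _) → x≢u (sym e)) , λ (e , _) → v≢u (sym e)))
      (along u′ vs x≢u′ v≢u′ xs vs′ l)
    first-step : ∀ vs → 1 ≤ length vs → Unique (v ∷ vs) → All (x ≢_) (v ∷ vs) →
                 Linked Adj (v ∷ vs ∷ʳ x) → χ v ≡ χ x
    first-step (u ∷ vs) _ ((v≢u ∷ v∉) ∷ _) (x≢v ∷ x≢u ∷ x∉) (vu ∷ l) = trans
      (equal (vu , (λ (e , _) → x≢v (sym e)) , λ (_ , e) → x≢u (sym e)))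
      (along u vs x≢u v≢u x∉ v∉ l)

module ExtensionGraph {A : Set} (em : ExcludedMiddle 0ℓ) (X : ShiftSpace A) (v : List A) where

  private
    L = Language X
    G = extensionGraph X v
  open Graph G
  open GraphProperties em G

  edge : ∀ {a b} → a ∷ v ∷ʳ b ∈ L → Adj (inj₁ a) (inj₂ b)
  edge {a} {b} e =
    language-factorial X [] (b ∷ []) e ,
    language-factorial X (a ∷ []) [] (subst (_∈ L) (sym (++-identityʳ (a ∷ v ∷ʳ b))) e) , e

  connected⇒conn : Connected G → Conn L v
  connected⇒conn (_ , walk) P Q closed b b′ vb vb′ Qb = transport (walk {inj₂ b} {inj₂ b′} vb vb′) Qb
    where
    Marked : A ⊎ A → Set
    Marked (inj₁ a) = P a
    Marked (inj₂ b) = Q b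
    transport : ∀ {x y} → Star Adj x y → Marked x → Marked y
    transport ε m = m
    transport (_◅_ {inj₁ a} {inj₂ b} (_ , _ , e) w) m = transport w (proj₁ (closed a b e) m)
    transport (_◅_ {inj₂ b} {inj₁ a} (_ , _ , e) w) m = transport w (proj₂ (closed a b e) m)

  -- `Conn` is applied to reachability from a right vertex; a left vertex has a right neighbour
  -- because words of the language extend to the right.
  conn⇒connected : v ∈ L → Conn L v → Connected G
  conn⇒connected v∈L conn = (let a , av = language-extendˡ X v∈L in inj₁ a , av) ,
    λ {x} {y} x∈ y∈ → let b , vb , xb = to-right x x∈
                          b′ , vb′ , yb′ = to-right y y∈
                      in xb ◅◅ between vb vb′ ◅◅ Closure.reverse (λ {u} {v} → adj-sym {u} {v}) yb′
    where
    to-right : ∀ x → x ∈ Vertex → ∃[ b ] v ∷ʳ b ∈ L × Star Adj x (inj₂ b)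
    to-right (inj₂ b) vb = b , vb , ε
    to-right (inj₁ a) av = let b , avb = language-extendʳ X av in
      b , proj₁ (proj₂ (edge avb)) , edge avb ◅ ε
    between : ∀ {b b′} → v ∷ʳ b ∈ L → v ∷ʳ b′ ∈ L → Star Adj (inj₂ b) (inj₂ b′)
    between {b} {b′} vb vb′ = conn (λ a → Star Adj (inj₂ b) (inj₁ a)) (λ c → Star Adj (inj₂ b) (inj₂ c))
      (λ a c e → (λ w → w ◅◅ (edge e ◅ ε)) , (λ w → w ◅◅ (edge e ◅ ε))) b b′ vb vb′ ε

  -- A vertex is coloured by whether a reaches it once the edge (a , b) is deleted: acyclicity
  -- excludes b, and every remaining edge preserves the colour.
  acyclic⇒cut : ¬ Cycle G → Cut L v
  acyclic⇒cut acyclic a b e = χ ∘ inj₁ , χ ∘ inj₂ ,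
    (λ eq → acyclic-disconnects acyclic (edge e) (does-true em (trans (sym eq) (true-does em ε)))) ,
    λ a′ b′ e′ ne →
      let R = edge e′ , (λ { (refl , refl) → ne (refl , refl) }) , (λ { (() , _) })
          R′ = edge e′ , (λ { (() , _) }) , (λ { (refl , refl) → ne (refl , refl) })
      in ≡-of-⇔ em em (λ w → w ◅◅ (R ◅ ε)) (λ w → w ◅◅ (R′ ◅ ε))
    where
    χ : A ⊎ A → Bool
    χ x = does (em {P = Star (Without (inj₁ a) (inj₂ b)) (inj₁ a) x})

  cut⇒¬cycle : Cut L v → ¬ Cycle G
  cut⇒¬cycle cut = cut⇒acyclic cuts
    where
    colouring : (A → Bool) → (A → Bool) → A ⊎ A → Bool
    colouring χ⁻ χ⁺ (inj₁ a) = χ⁻ a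
    colouring χ⁻ χ⁺ (inj₂ b) = χ⁺ b
    cuts : ∀ {u w} → Adj u w → Σ[ χ ∈ (A ⊎ A → Bool) ] χ u ≢ χ w ×
             (∀ {x y} → Without u w x y → χ x ≡ χ y)
    cuts {inj₁ a} {inj₂ b} (_ , _ , e) with cut a b e
    ... | χ⁻ , χ⁺ , jump , equal = colouring χ⁻ χ⁺ , jump , λ {x} {y} → eq x y
      where
      eq : ∀ x y → Without (inj₁ a) (inj₂ b) x y → colouring χ⁻ χ⁺ x ≡ colouring χ⁻ χ⁺ y
      eq (inj₁ a′) (inj₂ b′) ((_ , _ , e′) , ne , _) = equal a′ b′ e′ λ { (refl , refl) → ne (refl , refl) }
      eq (inj₂ b′) (inj₁ a′) ((_ , _ , e′) , _ , ne) =
        sym (equal a′ b′ e′ λ { (refl , refl) → ne (refl , refl) })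
    cuts {inj₂ b} {inj₁ a} adj with cuts {inj₁ a} {inj₂ b} adj
    ... | χ , jump , equal = χ , jump ∘ sym , λ { (xy , n₁ , n₂) → equal (xy , n₂ , n₁) }

-- Enumeration of return words and conclusion

lookup-injective : {B : Set} {xs : List B} → Unique xs → ∀ {i j} → lookup xs i ≡ lookup xs j → i ≡ j
lookup-injective (_ ∷ _) {zero} {zero} _ = refl
lookup-injective (x∉ ∷ _) {zero} {suc j} e = ⊥-elim (All.lookup x∉ (∈-lookup j) e)
lookup-injective (x∉ ∷ _) {suc i} {zero} e = ⊥-elim (All.lookup x∉ (∈-lookup i) (sym e))
lookup-injective (_ ∷ un) {suc i} {suc j} e = cong suc (lookup-injective un e)

module Enumeration {A : Set} (em : ExcludedMiddle 0ℓ)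
  {alphabet : List A} (complete : ∀ a → a ∈ˡ alphabet) where

  words : ℕ → List (List A)
  words zero = [] ∷ []
  words (suc N) = [] ∷ cartesianProductWith _∷_ alphabet (words N)

  words-complete : ∀ N {u} → length u ≤ N → u ∈ˡ words N
  words-complete zero {[]} _ = here refl
  words-complete (suc N) {[]} _ = here refl
  words-complete (suc N) {a ∷ u} (s≤s le) =
    there (∈-cartesianProductWith⁺ _∷_ (complete a) (words-complete N le))

  -- Repetitions are removed so that a function of the index is also a function of the word.
  bounded-finite : (P : Pred (List A) 0ℓ) (N : ℕ) → (∀ {u} → u ∈ P → length u ≤ N) →
    ∃[ m ] Σ[ σ ∈ (Fin m → List A) ]
      (∀ {i j} → σ i ≡ σ j → i ≡ j) × (∀ i → σ i ∈ P) × (∀ {u} → u ∈ P → ∃[ i ] σ i ≡ u)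
  bounded-finite P N bounded = length list , lookup list ,
    lookup-injective (deduplicate-! _≟ʷ_ (filter P? (words N))) ,
    (λ i → proj₂ (∈-filter⁻ P? {xs = words N} (∈-deduplicate⁻ _≟ʷ_ (filter P? (words N)) (∈-lookup i)))) ,
    λ {u} u∈P → let i = ∈-deduplicate⁺ _≟ʷ_ (∈-filter⁺ P? (words-complete N (bounded u∈P)) u∈P)
                in Any.index i , sym (lookup-index i)
    where
    P? : ∀ u → Dec (u ∈ P)
    P? u = em
    _≟ʷ_ : (u v : List A) → Dec (u ≡ v)
    u ≟ʷ v = em
    list = deduplicate _≟ʷ_ (filter P? (words N))

module Main (em : ExcludedMiddle 0ℓ) {A : Set} {d : ℕ} (A↔ : A ↔ Fin d)
  (X : ShiftSpace A) (minimal : IsMinimal X) (letters : ∀ a → a ∷ [] ∈ Language X) where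
  open FreeGroup A

  private L = Language X

  language : RecurrentLanguage L
  language = record
    { factorial = language-factorial X
    ; extendˡ = language-extendˡ X
    ; extendʳ = language-extendʳ X
    ; recurrent = minimal-recurrent X em A↔ minimal
    ; letters-∈ = letters
    }

  open Words em language using (recurrent; factorˡ; prefix-∈; factorial)

  bases⇒dendric : ReturnSetsAreBases X → IsDendric X
  bases⇒dendric bases v v∈L = conn⇒connected v∈L (B.conn v v∈L) , cut⇒¬cycle (B.cut v)
    where
    open ExtensionGraph em X v
    module B = FromBases em language
      (λ {w} w∈L → basis-weights em {ReturnWord X w} (bases w w∈L))
      (λ {w} w∈L → basis-null em {ReturnWord X w} (bases w w∈L))

  tame⇒bases : ReturnSetsAreTameBases X → ReturnSetsAreBases X
  tame⇒bases tame w w∈L = proj₁ (tame w w∈L)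

  alphabet : List A
  alphabet = map (Inverse.from A↔) (allFin d)

  complete : ∀ a → a ∈ˡ alphabet
  complete a = subst (_∈ˡ alphabet) (Inverse.strictlyInverseʳ A↔ a)
    (∈-map⁺ (Inverse.from A↔) (∈-allFin (Inverse.to A↔ a)))

  -- If s w has more than N letters, w occurs in its first N letters. In the return situation a s w
  -- this occurrence is preceded by a and followed by some letter, which is excluded.
  return-bounded : ∀ {w} → w ∈ L → ∃[ N ] (∀ {r} → Return L w r → length r ≤ N)
  return-bounded {w} w∈L with recurrent w∈L
  ... | N , contains = suc N , bounded
    where
    bounded : ∀ {r} → Return L w r → length r ≤ suc N
    bounded {[]} _ = z≤n
    bounded {a ∷ s} (_ , rw , _ , only) = s≤s (≤-trans (m≤m+n (length s) (length w))
      (≤-trans (≤-reflexive (sym (length-++ s))) (≮⇒≥ too-long)))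
      where
      too-long : ¬ (N < length (s ++ w))
      too-long lt with drop N (s ++ w) in eq
        | contains {take N (s ++ w)}
            (prefix-∈ (drop N (s ++ w) , sym (take++drop≡id N (s ++ w))) (factorˡ (a ∷ []) rw))
            (≤-reflexive (sym (trans (length-take N (s ++ w)) (m≤n⇒m⊓n≡m (<⇒≤ lt)))))
      ... | [] | _ = <-irrefl refl
            (≤-trans lt (m∸n≡0⇒m≤n (trans (sym (length-drop N (s ++ w))) (cong length eq))))
      ... | c ∷ q | x , y , e = only (a ∷ x , y ++ c ∷ q , (λ ()) ,
            (λ y≡ → case ++-conicalʳ y (c ∷ q) y≡ of λ ()) ,
            cong (a ∷_) (begin
              s ++ w                                 ≡⟨ take++drop≡id N (s ++ w) ⟨
              take N (s ++ w) ++ drop N (s ++ w)     ≡⟨ cong₂ _++_ e eq ⟩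
              (x ++ w ++ y) ++ c ∷ q                 ≡⟨ ++-assoc x (w ++ y) (c ∷ q) ⟩
              x ++ (w ++ y) ++ c ∷ q                 ≡⟨ cong (x ++_) (++-assoc w y (c ∷ q)) ⟩
              x ++ w ++ y ++ c ∷ q                   ∎))
        where open ≡.≡-Reasoning

  dendric⇒tame : IsDendric X → ReturnSetsAreTameBases X
  dendric⇒tame dendric w w∈L =
    automorphism-basis em (tame-automorphism em T.tame) members , T.φ , T.tame , members
    where
    conn : ∀ v → v ∈ L → Conn L v
    conn v v∈L = ExtensionGraph.connected⇒conn em X v (proj₁ (dendric v v∈L))
    cut : ∀ v → Cut L v
    -- Dendricity applies to v because v is a factor of the word a v b of the language.
    cut v a b e = ExtensionGraph.acyclic⇒cut em X v
      (proj₂ (dendric v (factorial (a ∷ []) (b ∷ []) e))) a b e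
    enumeration = Enumeration.bounded-finite em complete (Return L w)
      (proj₁ (return-bounded w∈L)) (proj₂ (return-bounded w∈L))
    m = proj₁ enumeration
    σ : Fin m → List A
    σ = proj₁ (proj₂ enumeration)
    σ-injective : ∀ {i j} → σ i ≡ σ j → i ≡ j
    σ-injective = proj₁ (proj₂ (proj₂ enumeration))
    σ-return : ∀ i → Return L w (σ i)
    σ-return = proj₁ (proj₂ (proj₂ (proj₂ enumeration)))
    σ-covers : ∀ {r} → Return L w r → ∃[ i ] σ i ≡ r
    σ-covers = proj₂ (proj₂ (proj₂ (proj₂ enumeration)))
    open Tameness em (language-factorial X) cut
    independent : Independent σ
    independent f = let λ′ , eq = Independence.return-weights em language alphabet complete cut w∈L f̂ in
      λ′ , λ i → trans (eq (σ i) (σ-return i)) (f̂-σ i)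
      where
      f̂ : List A → Bool
      f̂ r with em {P = ∃[ i ] σ i ≡ r}
      ... | yes (i , _) = f i
      ... | no _ = false
      f̂-σ : ∀ i → f̂ (σ i) ≡ f i
      f̂-σ i with em {P = ∃[ j ] σ j ≡ σ i}
      ... | yes (j , e) = cong f (σ-injective e)
      ... | no n = ⊥-elim (n (i , refl))
    module T = TameCode (tameCode _ σ ≤-refl
      (λ i → prefix-∈ (w , refl) (proj₁ (proj₂ (σ-return i))))
      (Span.spanning em language conn w∈L σ σ-covers) independent)
    module F = Group group
    members : ∀ g → g ∈ wordSet (ReturnWord X w) ⇔ (∃[ a ] g ≈ T.φ (gen a))
    members g = mk⇔
      (λ (r , ret , e) → let i , σi = σ-covers ret
                             a , ia = T.index-surjective i in
        a , F.trans e (F.trans (F.reflexive (cong embed (trans (sym σi) (cong σ (sym ia)))))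
              (F.sym (T.φ-gen a))))
      (λ (a , e) → σ (T.index a) , σ-return (T.index a) , F.trans e (T.φ-gen a))

theorem1 : ExcludedMiddle 0ℓ →
    (A : Set) (n : ℕ) → A ↔ Fin n →
    (X : ShiftSpace A) → IsMinimal X →
    (∀ a → [ a ] ∈ Language X) →
    (IsDendric X ⇔ ReturnSetsAreTameBases X) ×
    (ReturnSetsAreTameBases X ⇔ ReturnSetsAreBases X)
theorem1 em A n A↔ X minimal letters =
  mk⇔ dendric⇒tame (bases⇒dendric ∘ tame⇒bases) ,
  mk⇔ tame⇒bases (dendric⇒tame ∘ bases⇒dendric)
  where open Main em A↔ X minimal letters
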